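{- Let $T\in\mathbb{C}^{n\times n\times n}$ be a complex tensor of size $n$. For any integer $r$, $\operatorname{rank}(T)\le r$ if and only if there is a complex tensor $S$ of order 3 and size $N=r+n$ such that: (i) If $(S_1,\ldots,S_N)$ denotes the tuple of $x$-slices of $S$, or its tuple of $y$-slices, or its tuple of $z$-slices, then: for each $k\in\{1,\ldots,N\}$, $S_k^TS_k$ is diagonalizable (over $\mathbb{C}$) and $\operatorname{rank} S_k=\operatorname{rank} S_k^TS_k$; and the matrices $S_kS_l^T$ and $S_k^TS_l$ are symmetric for all $k,l\in\{1,\ldots,N\}$. (ii) $T$ is a subtensor of $S$ in the sense that $T_{ijk}=S_{ijk}$ for all $1\le i,j,k\le n$. (iii) Any matrix in the subspace spanned by the $z$-slices of $S$ is of rank at most $r$.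
   Context: A tensor of (order 3 and) size $n$ over $K$ is an array $T=(T_{ijk})\in K^{n\times n\times n}$. Its $i$-th $x$-slice is the $n\times n$ matrix $(T_{ijk})_{j,k}$, its $j$-th $y$-slice is $(T_{ijk})_{i,k}$, and its $k$-th $z$-slice is $(T_{ijk})_{i,j}$. For $u,v,w\in K^n$, the tensor $u\otimes v\otimes w$ has entries $u_iv_jw_k$; it has rank one if $u,v,w\ne 0$. The rank over $K$ (here $K=\mathbb{C}$), $\operatorname{rank}(T)$, is the smallest $r$ such that $T$ is a sum of $r$ rank-one tensors over $K$ (with $\operatorname{rank}(0)=0$). $M^T$ denotes the transpose (without conjugation). The span of slices is taken over $\mathbb{C}$. -}

module Defs where

open import Algebra.Bundles using (RawRing; CommutativeMonoid)
import Algebra.Definitions.RawMonoid as RawMonoidDefs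
import Algebra.Properties.CommutativeSemigroup as CommutativeSemigroupProps
open import Data.Bool.Base using (if_then_else_)
open import Data.Fin.Base using (Fin; inject≤)
open import Data.Fin.Properties using (_≟_)
open import Data.Integer.Base as ℤ using (ℤ)
open import Data.Nat.Base as ℕ using (ℕ)
import Data.Nat.Properties as ℕₚ
open import Data.Product.Base using (Σ; _×_; _,_; ∃-syntax; uncurry′; proj₁; proj₂)
open import Data.Rational.Base as ℚ using (ℚ; 0ℚ; 1ℚ; ½; ∣_∣; Positive)
import Data.Rational.Properties as ℚₚ
open import Data.Vec.Functional using (Vector)
open import Function.Bundles using (_⇔_)
open import Level using (0ℓ; _⊔_)
open import Relation.Binary.PropositionalEquality
  using (_≡_; _≢_; refl; sym; trans; cong; cong₂; subst)
open import Relation.Nullary using (¬_; does)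

Cauchy : (ℕ → ℚ) → Set
Cauchy x = ∀ ε → 0ℚ ℚ.< ε →
  ∃[ N ] ∀ m n → N ℕ.≤ m → N ℕ.≤ n → ∣ x m ℚ.- x n ∣ ℚ.< ε

private
  ∣0∣<ε : ∀ {ε} q → 0ℚ ℚ.< ε → ∣ q ℚ.- q ∣ ℚ.< ε
  ∣0∣<ε q 0<ε = subst (ℚ._< _) (sym (cong ∣_∣ (ℚₚ.+-inverseʳ q))) 0<ε

  0<½ε : ∀ {ε} → 0ℚ ℚ.< ε → 0ℚ ℚ.< ½ ℚ.* ε
  0<½ε {ε} 0<ε = subst (ℚ._< ½ ℚ.* ε) (ℚₚ.*-zeroʳ ½) (ℚₚ.*-monoʳ-<-pos ½ 0<ε)

  ½+½≡1 : ½ ℚ.+ ½ ≡ 1ℚ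
  ½+½≡1 = refl

  ½ε+½ε≡ε : ∀ ε → ½ ℚ.* ε ℚ.+ ½ ℚ.* ε ≡ ε
  ½ε+½ε≡ε ε = trans (sym (ℚₚ.*-distribʳ-+ ε ½ ½))
    (trans (cong (ℚ._* ε) ½+½≡1) (ℚₚ.*-identityˡ ε))

  cancel : ∀ a b → a ≡ (a ℚ.- b) ℚ.+ b
  cancel a b = sym (trans (ℚₚ.+-assoc a (ℚ.- b) b)
    (trans (cong (a ℚ.+_) (ℚₚ.+-inverseˡ b)) (ℚₚ.+-identityʳ a)))

  *-distribˡ-- : ∀ a b c → a ℚ.* (b ℚ.- c) ≡ a ℚ.* b ℚ.- a ℚ.* c
  *-distribˡ-- a b c = trans (ℚₚ.*-distribˡ-+ a b (ℚ.- c))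
    (cong (a ℚ.* b ℚ.+_) (sym (ℚₚ.neg-distribʳ-* a c)))

abstract
  cauchy-const : ∀ q → Cauchy (λ _ → q)
  cauchy-const q ε 0<ε = 0 , λ _ _ _ _ → ∣0∣<ε q 0<ε

  cauchy-+ : ∀ x y → Cauchy x → Cauchy y → Cauchy (λ n → x n ℚ.+ y n)
  cauchy-+ x y cx cy ε 0<ε
    with cx (½ ℚ.* ε) (0<½ε 0<ε) | cy (½ ℚ.* ε) (0<½ε 0<ε)
  ... | M , hx | N , hy = M ℕ.⊔ N , λ m n M⊔N≤m M⊔N≤n → begin-strict
    ∣ (x m ℚ.+ y m) ℚ.- (x n ℚ.+ y n) ∣
      ≡⟨ cong ∣_∣ (rearrange (x m) (y m) (x n) (y n)) ⟩
    ∣ (x m ℚ.- x n) ℚ.+ (y m ℚ.- y n) ∣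
      ≤⟨ ℚₚ.∣p+q∣≤∣p∣+∣q∣ (x m ℚ.- x n) (y m ℚ.- y n) ⟩
    ∣ x m ℚ.- x n ∣ ℚ.+ ∣ y m ℚ.- y n ∣
      <⟨ ℚₚ.+-mono-<
           (hx m n (ℕₚ.m⊔n≤o⇒m≤o M N M⊔N≤m) (ℕₚ.m⊔n≤o⇒m≤o M N M⊔N≤n))
           (hy m n (ℕₚ.m⊔n≤o⇒n≤o M N M⊔N≤m) (ℕₚ.m⊔n≤o⇒n≤o M N M⊔N≤n)) ⟩
    ½ ℚ.* ε ℚ.+ ½ ℚ.* ε
      ≡⟨ ½ε+½ε≡ε ε ⟩
    ε ∎
    where
    open ℚₚ.≤-Reasoning
    rearrange : ∀ a b c d →
      (a ℚ.+ b) ℚ.- (c ℚ.+ d) ≡ (a ℚ.- c) ℚ.+ (b ℚ.- d)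
    rearrange a b c d = trans (cong (a ℚ.+ b ℚ.+_) (ℚₚ.neg-distrib-+ c d))
      (CommutativeSemigroupProps.interchange
        (CommutativeMonoid.commutativeSemigroup ℚₚ.+-0-commutativeMonoid)
        a b (ℚ.- c) (ℚ.- d))

  cauchy-neg : ∀ x → Cauchy x → Cauchy (λ n → ℚ.- x n)
  cauchy-neg x cx ε 0<ε with cx ε 0<ε
  ... | M , hx = M , λ m n M≤m M≤n →
    subst (ℚ._< ε) (sym (flip∣∣ (x m) (x n))) (hx m n M≤m M≤n)
    where
    flip∣∣ : ∀ a b → ∣ (ℚ.- a) ℚ.- (ℚ.- b) ∣ ≡ ∣ a ℚ.- b ∣
    flip∣∣ a b = trans (cong ∣_∣ (sym (ℚₚ.neg-distrib-+ a (ℚ.- b))))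
                       (ℚₚ.∣-p∣≡∣p∣ (a ℚ.- b))

  cauchy-bounded : ∀ {x} → Cauchy x →
    ∃[ B ] (0ℚ ℚ.< B) × ∃[ N ] ∀ n → N ℕ.≤ n → ∣ x n ∣ ℚ.≤ B
  cauchy-bounded {x} cx with cx 1ℚ (ℚₚ.positive⁻¹ 1ℚ)
  ... | N , hx = 1ℚ ℚ.+ ∣ x N ∣ , 0<B , N , λ n N≤n → begin
    ∣ x n ∣                          ≡⟨ cong ∣_∣ (cancel (x n) (x N)) ⟩
    ∣ (x n ℚ.- x N) ℚ.+ x N ∣        ≤⟨ ℚₚ.∣p+q∣≤∣p∣+∣q∣ (x n ℚ.- x N) (x N) ⟩
    ∣ x n ℚ.- x N ∣ ℚ.+ ∣ x N ∣
      ≤⟨ ℚₚ.+-monoˡ-≤ ∣ x N ∣ (ℚₚ.<⇒≤ (hx n N N≤n ℕₚ.≤-refl)) ⟩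
    1ℚ ℚ.+ ∣ x N ∣                   ∎
    where
    open ℚₚ.≤-Reasoning
    0<B : 0ℚ ℚ.< 1ℚ ℚ.+ ∣ x N ∣
    0<B = ℚₚ.+-mono-<-≤ (ℚₚ.positive⁻¹ 1ℚ) (ℚₚ.0≤∣p∣ (x N))

  divide : ∀ B C ε → 0ℚ ℚ.< B → 0ℚ ℚ.< C → 0ℚ ℚ.< ε →
    ∃[ δ ] (0ℚ ℚ.< δ) × (B ℚ.* δ ℚ.+ C ℚ.* δ ≡ ε)
  divide B C ε 0<B 0<C 0<ε = D⁻¹ ℚ.* ε , 0<δ , eq
    where
    instance
      D-pos : Positive (B ℚ.+ C)
      D-pos = ℚ.positive (ℚₚ.+-mono-< 0<B 0<C)
      D-nonZero : ℚ.NonZero (B ℚ.+ C)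
      D-nonZero = ℚₚ.pos⇒nonZero (B ℚ.+ C)
    D⁻¹ : ℚ
    D⁻¹ = ℚ.1/ (B ℚ.+ C)
    0<δ : 0ℚ ℚ.< D⁻¹ ℚ.* ε
    0<δ = subst (ℚ._< D⁻¹ ℚ.* ε) (ℚₚ.*-zeroʳ D⁻¹)
      (ℚₚ.*-monoʳ-<-pos D⁻¹ {{ℚₚ.1/pos⇒pos (B ℚ.+ C)}} 0<ε)
    eq : B ℚ.* (D⁻¹ ℚ.* ε) ℚ.+ C ℚ.* (D⁻¹ ℚ.* ε) ≡ ε
    eq = trans (sym (ℚₚ.*-distribʳ-+ (D⁻¹ ℚ.* ε) B C))
        (trans (sym (ℚₚ.*-assoc (B ℚ.+ C) D⁻¹ ε))
        (trans (cong (ℚ._* ε) (ℚₚ.*-inverseʳ (B ℚ.+ C)))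
               (ℚₚ.*-identityˡ ε)))

  cauchy-* : ∀ x y → Cauchy x → Cauchy y → Cauchy (λ n → x n ℚ.* y n)
  cauchy-* x y cx cy ε 0<ε = bound (cauchy-bounded cx) (cauchy-bounded cy)
    where
    open ℚₚ.≤-Reasoning
    split : ∀ a b c d →
      a ℚ.* b ℚ.- c ℚ.* d ≡ a ℚ.* (b ℚ.- d) ℚ.+ d ℚ.* (a ℚ.- c)
    split a b c d = begin-equality
      a ℚ.* b ℚ.- c ℚ.* d
        ≡⟨ cong (ℚ._- c ℚ.* d) (cancel (a ℚ.* b) (a ℚ.* d)) ⟩
      ((a ℚ.* b ℚ.- a ℚ.* d) ℚ.+ a ℚ.* d) ℚ.- c ℚ.* d
        ≡⟨ ℚₚ.+-assoc (a ℚ.* b ℚ.- a ℚ.* d) (a ℚ.* d) (ℚ.- (c ℚ.* d)) ⟩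
      (a ℚ.* b ℚ.- a ℚ.* d) ℚ.+ (a ℚ.* d ℚ.- c ℚ.* d)
        ≡⟨ cong₂ ℚ._+_ (sym (*-distribˡ-- a b d))
             (trans (cong₂ ℚ._-_ (ℚₚ.*-comm a d) (ℚₚ.*-comm c d))
                    (sym (*-distribˡ-- d a c))) ⟩
      a ℚ.* (b ℚ.- d) ℚ.+ d ℚ.* (a ℚ.- c) ∎

    mul< : ∀ p q b d → ∣ p ∣ ℚ.≤ b → 0ℚ ℚ.< b → ∣ q ∣ ℚ.< d → ∣ p ℚ.* q ∣ ℚ.< b ℚ.* d
    mul< p q b d p≤b 0<b q<d = begin-strict
      ∣ p ℚ.* q ∣        ≡⟨ ℚₚ.∣p*q∣≡∣p∣*∣q∣ p q ⟩
      ∣ p ∣ ℚ.* ∣ q ∣    ≤⟨ ℚₚ.*-monoʳ-≤-nonNeg ∣ q ∣ {{ℚₚ.∣-∣-nonNeg q}} p≤b ⟩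
      b ℚ.* ∣ q ∣        <⟨ ℚₚ.*-monoʳ-<-pos b {{ℚ.positive 0<b}} q<d ⟩
      b ℚ.* d            ∎

    bound :
      ∃[ B ] (0ℚ ℚ.< B) × (∃[ N ] ∀ n → N ℕ.≤ n → ∣ x n ∣ ℚ.≤ B) →
      ∃[ C ] (0ℚ ℚ.< C) × (∃[ N ] ∀ n → N ℕ.≤ n → ∣ y n ∣ ℚ.≤ C) →
      ∃[ N ] ∀ m n → N ℕ.≤ m → N ℕ.≤ n → ∣ x m ℚ.* y m ℚ.- x n ℚ.* y n ∣ ℚ.< ε
    bound (B , 0<B , Nx , x≤B) (C , 0<C , Ny , y≤C)
      with divide B C ε 0<B 0<C 0<ε
    ... | δ , 0<δ , Bδ+Cδ≡ε with cx δ 0<δ | cy δ 0<δ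
    ... | Mx , hx | My , hy
      = (Nx ℕ.⊔ Ny) ℕ.⊔ (Mx ℕ.⊔ My) , λ m n N≤m N≤n → begin-strict
        ∣ x m ℚ.* y m ℚ.- x n ℚ.* y n ∣
          ≡⟨ cong ∣_∣ (split (x m) (y m) (x n) (y n)) ⟩
        ∣ x m ℚ.* (y m ℚ.- y n) ℚ.+ y n ℚ.* (x m ℚ.- x n) ∣
          ≤⟨ ℚₚ.∣p+q∣≤∣p∣+∣q∣ (x m ℚ.* (y m ℚ.- y n)) (y n ℚ.* (x m ℚ.- x n)) ⟩
        ∣ x m ℚ.* (y m ℚ.- y n) ∣ ℚ.+ ∣ y n ℚ.* (x m ℚ.- x n) ∣
          <⟨ ℚₚ.+-mono-<
               (mul< (x m) (y m ℚ.- y n) B δ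
                 (x≤B m (ℕₚ.m⊔n≤o⇒m≤o Nx Ny (lo N≤m))) 0<B
                 (hy m n (ℕₚ.m⊔n≤o⇒n≤o Mx My (hi N≤m)) (ℕₚ.m⊔n≤o⇒n≤o Mx My (hi N≤n))))
               (mul< (y n) (x m ℚ.- x n) C δ
                 (y≤C n (ℕₚ.m⊔n≤o⇒n≤o Nx Ny (lo N≤n))) 0<C
                 (hx m n (ℕₚ.m⊔n≤o⇒m≤o Mx My (hi N≤m)) (ℕₚ.m⊔n≤o⇒m≤o Mx My (hi N≤n)))) ⟩
        B ℚ.* δ ℚ.+ C ℚ.* δ
          ≡⟨ Bδ+Cδ≡ε ⟩
        ε ∎
      where
      lo : ∀ {k} → (Nx ℕ.⊔ Ny) ℕ.⊔ (Mx ℕ.⊔ My) ℕ.≤ k → Nx ℕ.⊔ Ny ℕ.≤ k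
      lo = ℕₚ.m⊔n≤o⇒m≤o (Nx ℕ.⊔ Ny) (Mx ℕ.⊔ My)
      hi : ∀ {k} → (Nx ℕ.⊔ Ny) ℕ.⊔ (Mx ℕ.⊔ My) ℕ.≤ k → Mx ℕ.⊔ My ℕ.≤ k
      hi = ℕₚ.m⊔n≤o⇒n≤o (Nx ℕ.⊔ Ny) (Mx ℕ.⊔ My)

record ℝ : Set where
  constructor mkℝ
  field
    seq    : ℕ → ℚ
    cauchy : Cauchy seq

open ℝ public

infix  4 _≈ℝ_
infixl 6 _+ℝ_
infixl 7 _*ℝ_
infix  8 -ℝ_

_≈ℝ_ : ℝ → ℝ → Set
x ≈ℝ y = ∀ ε → 0ℚ ℚ.< ε → ∃[ N ] ∀ n → N ℕ.≤ n → ∣ seq x n ℚ.- seq y n ∣ ℚ.< ε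

fromℚ : ℚ → ℝ
fromℚ q = mkℝ (λ _ → q) (cauchy-const q)

_+ℝ_ : ℝ → ℝ → ℝ
x +ℝ y = mkℝ (λ n → seq x n ℚ.+ seq y n) (cauchy-+ (seq x) (seq y) (cauchy x) (cauchy y))

_*ℝ_ : ℝ → ℝ → ℝ
x *ℝ y = mkℝ (λ n → seq x n ℚ.* seq y n) (cauchy-* (seq x) (seq y) (cauchy x) (cauchy y))

-ℝ_ : ℝ → ℝ
-ℝ x = mkℝ (λ n → ℚ.- seq x n) (cauchy-neg (seq x) (cauchy x))

record ℂ : Set where
  constructor _+i_
  field
    re im : ℝ

open ℂ public

ℂ-rawRing : RawRing 0ℓ 0ℓ
ℂ-rawRing = record
  { Carrier = ℂ
  ; _≈_     = λ z w → (re z ≈ℝ re w) × (im z ≈ℝ im w)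
  ; _+_     = λ z w → (re z +ℝ re w) +i (im z +ℝ im w)
  ; _*_     = λ z w → (re z *ℝ re w +ℝ (-ℝ (im z *ℝ im w)))
                   +i (re z *ℝ im w +ℝ im z *ℝ re w)
  ; -_      = λ z → (-ℝ re z) +i (-ℝ im z)
  ; 0#      = fromℚ 0ℚ +i fromℚ 0ℚ
  ; 1#      = fromℚ 1ℚ +i fromℚ 0ℚ
  }

-- A raw ring suffices for the definitions, but they are only meant for K a field.
module LinearAlgebra {c ℓ} (K : RawRing c ℓ) where
  open RawRing K
  open RawMonoidDefs +-rawMonoid using (sum)

  infix 4 _∈Span_

  -- The index type is arbitrary so that this applies to vectors and to
  -- (uncurried) matrices alike.
  _∈Span_ : ∀ {I : Set} {k} → (I → Carrier) → Vector (I → Carrier) k → Set (c ⊔ ℓ)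
  _∈Span_ {k = k} v b = Σ (Vector Carrier k) λ a → ∀ i → v i ≈ sum (λ t → a t * b t i)

  LinearlyIndependent : ∀ {I : Set} {k} → Vector (I → Carrier) k → Set (c ⊔ ℓ)
  LinearlyIndependent {k = k} b =
    ∀ (a : Vector Carrier k) → (∀ i → sum (λ t → a t * b t i) ≈ 0#) → ∀ t → a t ≈ 0#

  Matrix : ℕ → ℕ → Set c
  Matrix m n = Fin m → Fin n → Carrier

  infix  4 _≈ᴹ_
  infixl 7 _*ᴹ_
  infix  9 _ᵀ

  _≈ᴹ_ : ∀ {m n} → Matrix m n → Matrix m n → Set ℓ
  A ≈ᴹ B = ∀ i j → A i j ≈ B i j

  _ᵀ : ∀ {m n} → Matrix m n → Matrix n m
  (A ᵀ) i j = A j i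

  _*ᴹ_ : ∀ {m n p} → Matrix m n → Matrix n p → Matrix m p
  (A *ᴹ B) i k = sum (λ j → A i j * B j k)

  1ᴹ : ∀ {n} → Matrix n n
  1ᴹ i j = if does (i ≟ j) then 1# else 0#

  Symmetric : ∀ {n} → Matrix n n → Set ℓ
  Symmetric A = A ᵀ ≈ᴹ A

  Diagonal : ∀ {n} → Matrix n n → Set ℓ
  Diagonal D = ∀ i j → i ≢ j → D i j ≈ 0#

  Diagonalizable : ∀ {n} → Matrix n n → Set (c ⊔ ℓ)
  Diagonalizable {n} A =
    ∃[ P ] ∃[ P⁻¹ ] Σ (Matrix n n) λ D →
      (P *ᴹ P⁻¹ ≈ᴹ 1ᴹ) × (P⁻¹ *ᴹ P ≈ᴹ 1ᴹ) × Diagonal D × (A ≈ᴹ (P *ᴹ D) *ᴹ P⁻¹)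

  -- The column space of A has a basis of ρ elements.
  HasRank : ∀ {m n} → Matrix m n → ℕ → Set (c ⊔ ℓ)
  HasRank {m} A ρ = Σ (Vector (Fin m → Carrier) ρ) λ b →
    LinearlyIndependent b × (∀ v → v ∈Span b ⇔ v ∈Span (A ᵀ))

  Rank≤ : ∀ {m n} → Matrix m n → ℤ → Set (c ⊔ ℓ)
  Rank≤ A r = ∃[ ρ ] HasRank A ρ × ℤ.+ ρ ℤ.≤ r

  SameRank : ∀ {m n p q} → Matrix m n → Matrix p q → Set (c ⊔ ℓ)
  SameRank A B = ∃[ ρ ] HasRank A ρ × HasRank B ρ

  Tensor : ℕ → Set c
  Tensor n = Fin n → Fin n → Fin n → Carrier

  xSlice ySlice zSlice : ∀ {n} → Tensor n → Vector (Matrix n n) n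
  xSlice T i = λ j k → T i j k
  ySlice T j = λ i k → T i j k
  zSlice T k = λ i j → T i j k

  infix 4 _≈ᵀ_ _IsSubtensorOf_

  _≈ᵀ_ : ∀ {n} → Tensor n → Tensor n → Set ℓ
  S ≈ᵀ T = ∀ i j k → S i j k ≈ T i j k

  ⟨_⊗_⊗_⟩ : ∀ {n} (u v w : Vector Carrier n) → Tensor n
  ⟨ u ⊗ v ⊗ w ⟩ i j k = (u i * v j) * w k

  NonZeroVector : ∀ {n} → Vector Carrier n → Set ℓ
  NonZeroVector u = ¬ (∀ i → u i ≈ 0#)

  RankOne : ∀ {n} → Tensor n → Set (c ⊔ ℓ)
  RankOne T = ∃[ u ] ∃[ v ] ∃[ w ]
    NonZeroVector u × NonZeroVector v × NonZeroVector w × (T ≈ᵀ ⟨ u ⊗ v ⊗ w ⟩)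

  SumOfRankOnes : ∀ {n} → Tensor n → ℕ → Set (c ⊔ ℓ)
  SumOfRankOnes {n} T r = Σ (Vector (Tensor n) r) λ X →
    (∀ t → RankOne (X t)) × (T ≈ᵀ (λ i j k → sum (λ t → X t i j k)))

  HasTensorRank : ∀ {n} → Tensor n → ℕ → Set (c ⊔ ℓ)
  HasTensorRank T ρ = SumOfRankOnes T ρ × (∀ r → SumOfRankOnes T r → ρ ℕ.≤ r)

  TensorRank≤ : ∀ {n} → Tensor n → ℤ → Set (c ⊔ ℓ)
  TensorRank≤ T r = ∃[ ρ ] HasTensorRank T ρ × ℤ.+ ρ ℤ.≤ r

  -- n ≤ N is part of the relation, since the entries of S at all indices
  -- below n have to exist.
  _IsSubtensorOf_ : ∀ {n N} → Tensor n → Tensor N → Set ℓ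
  _IsSubtensorOf_ {n} {N} T S = Σ (n ℕ.≤ N) λ n≤N →
    ∀ i j k → T i j k ≈ S (inject≤ i n≤N) (inject≤ j n≤N) (inject≤ k n≤N)

  SliceConditions : ∀ {N} → Vector (Matrix N N) N → Set (c ⊔ ℓ)
  SliceConditions A =
    (∀ k → Diagonalizable (A k ᵀ *ᴹ A k) × SameRank (A k) (A k ᵀ *ᴹ A k)) ×
    (∀ k l → Symmetric (A k *ᴹ A l ᵀ) × Symmetric (A k ᵀ *ᴹ A l))

  SpanRank≤ : ∀ {N} → Vector (Matrix N N) N → ℤ → Set (c ⊔ ℓ)
  SpanRank≤ {N} A r =
    ∀ (M : Matrix N N) → uncurry′ M ∈Span (λ k → uncurry′ (A k)) → Rank≤ M r

open LinearAlgebra ℂ-rawRing public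

{-# OPTIONS --safe #-}

-- Let Aₗ be the z-slices of S.
-- The operators Aₖᵀ Aₗ all commute, Aₖᵀ Aₖ is diagonalizable with kernel that of Aₖ,
-- and (Aₖᵀ Aₗ)² = Aₖᵀ Aₖ Aₗᵀ Aₗ; as every complex number is a square, every vector
-- is a sum of joint eigenvectors.  If Aₖᵀ Aₗ w = cₗ w for all l and cₖ ≠ 0, then
-- cₖ Aₗ w = cₗ Aₖ w, so that a maximal independent family of such w, completed by
-- the common kernel of the Aₗ, writes S as a sum of as many rank-one tensors as
-- the family has members.  A generic combination of the Aₗ has exactly this rank.
--
-- Conversely, given T = Σₜ uₜ ⊗ vₜ ⊗ wₜ, adding one coordinate per summand makes
-- each of the families u, v, w orthogonal and free of isotropic vectors, and the
-- slices of the resulting tensor are simultaneously orthogonally diagonal.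
module Submission where

open import Defs using
  ( Cauchy; cauchy-const; cauchy-+; cauchy-bounded; divide
  ; ℝ; mkℝ; seq; cauchy; _≈ℝ_; fromℚ; _+ℝ_; _*ℝ_; -ℝ_
  ; ℂ; _+i_; re; im; ℂ-rawRing; module LinearAlgebra)
open import Algebra.Bundles using (CommutativeRing; RawRing)
import Algebra.Properties.Semiring.Sum
import Algebra.Solver.Ring
open import Algebra.Solver.Ring.AlmostCommutativeRing using (fromCommutativeRing; _-Raw-AlmostCommutative⟶_)
open import Axiom.ExcludedMiddle using (ExcludedMiddle)
open import Data.Fin.Base as Fin using (Fin; zero; suc; punchIn; punchOut)
import Data.Fin.Properties as Finₚ
open import Data.Integer.Base as ℤ using (ℤ; +_; -[1+_])
import Data.Integer.Properties as ℤₚ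
open import Data.List.Base using (List; []; _∷_)
open import Data.List.Membership.Propositional using (_∈_)
open import Data.List.Relation.Unary.All as All using ([]; _∷_)
open import Data.List.Relation.Unary.All.Properties using (¬Any⇒All¬)
open import Data.List.Relation.Unary.AllPairs using (AllPairs; []; _∷_)
open import Data.List.Relation.Unary.Any using (Any; here; there)
open import Data.Maybe.Base using (Maybe; just; nothing)
open import Data.Nat.Base as ℕ using (ℕ; zero; suc)
import Data.Nat.Coprimality as Coprime
import Data.Nat.Properties as ℕₚ
open import Data.Product.Base using (Σ; _×_; _,_; ∃-syntax; proj₁; proj₂)
open import Data.Rational.Base as ℚ using (ℚ; 0ℚ; 1ℚ; ½; ∣_∣; mkℚ; *≤*)
import Data.Rational.Properties as ℚₚ
open import Data.Rational.Solver using (module +-*-Solver)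
import Data.Rational.Unnormalised.Base as ℚᵘ
import Data.Rational.Unnormalised.Properties as ℚᵘₚ
open import Data.Sum.Base using (_⊎_; inj₁; inj₂; [_,_]′)
open import Data.Unit.Base using (⊤)
open import Data.Vec.Functional as Vec using (Vector)
open import Function.Base using (_∘_)
open import Function.Bundles using (_⇔_; mk⇔; Equivalence)
open import Level using (0ℓ)
import Relation.Binary.Reasoning.Setoid
open import Relation.Binary.PropositionalEquality as ≡ using (_≡_; _≢_; cong; cong₂)
open import Relation.Binary.Structures using (IsEquivalence)
open import Relation.Nullary using (¬_; Dec; yes; no; contradiction; decidable-stable)

-- Null sequences and the ring of Cauchy reals

-- The hypotheses supply the eigenvalues of the Aₖᵀ Aₖ; the only roots still to be extracted are
-- square roots. On a joint eigenspace of these operators with eigenvalues μ, Aₖᵀ Aₗ squares to the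
-- scalar μₖ μₗ, so its eigenvalues are the two roots of that number. The obstacle is μₗ = 0, where
-- they coincide and a nilpotent part could hide; equality of the ranks of Aₗ and Aₗᵀ Aₗ rules it
-- out. The rank of a combination M of slices is visible on the images M w, not on the eigenvectors
-- w. Independence therefore has to be transferred from the w to the vectors Aₖ w, and the operators
-- Aₖᵀ Aₗ do this once more. Real numbers are Cauchy sequences whose terms may change sign, so a
-- root is first built for the absolute value. All later choices of sign are made algebraically: a
-- product of two candidates vanishes, hence one of them does. Excluded middle decides equality with
-- 0 and provides maximal families and minimal ranks.

Null : (ℕ → ℚ) → Set
Null z = ∀ ε → 0ℚ ℚ.< ε → ∃[ N ] ∀ n → N ℕ.≤ n → ∣ z n ∣ ℚ.< ε

module _ where
  open +-*-Solver

  0<p*q : ∀ {p q} → 0ℚ ℚ.< p → 0ℚ ℚ.< q → 0ℚ ℚ.< p ℚ.* q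
  0<p*q {p} {q} 0<p 0<q = ≡.subst (ℚ._< p ℚ.* q) (ℚₚ.*-zeroʳ p)
    (ℚₚ.*-monoʳ-<-pos p {{ℚ.positive 0<p}} 0<q)

  0≤p*q : ∀ {p q} → 0ℚ ℚ.≤ p → 0ℚ ℚ.≤ q → 0ℚ ℚ.≤ p ℚ.* q
  0≤p*q {p} {q} 0≤p 0≤q = ≡.subst (ℚ._≤ p ℚ.* q) (ℚₚ.*-zeroʳ p)
    (ℚₚ.*-monoˡ-≤-nonNeg p {{ℚ.nonNegative 0≤p}} 0≤q)

  0<½*p : ∀ {p} → 0ℚ ℚ.< p → 0ℚ ℚ.< ½ ℚ.* p
  0<½*p = 0<p*q (ℚₚ.positive⁻¹ ½)

  *-mono-≤ : ∀ {p q r s} → 0ℚ ℚ.≤ r → 0ℚ ℚ.≤ q → p ℚ.≤ q → r ℚ.≤ s → p ℚ.* r ℚ.≤ q ℚ.* s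
  *-mono-≤ {p} {q} {r} 0≤r 0≤q p≤q r≤s = ℚₚ.≤-trans
    (ℚₚ.*-monoʳ-≤-nonNeg r {{ℚ.nonNegative 0≤r}} p≤q)
    (ℚₚ.*-monoˡ-≤-nonNeg q {{ℚ.nonNegative 0≤q}} r≤s)

  square-mono-≤ : ∀ {p q} → 0ℚ ℚ.≤ p → p ℚ.≤ q → p ℚ.* p ℚ.≤ q ℚ.* q
  square-mono-≤ 0≤p p≤q = *-mono-≤ 0≤p (ℚₚ.≤-trans 0≤p p≤q) p≤q p≤q

  ½p+½p≡p : ∀ p → ½ ℚ.* p ℚ.+ ½ ℚ.* p ≡ p
  ½p+½p≡p = solve 1 (λ p → con ½ :* p :+ con ½ :* p := p) ≡.refl

  p≤q+p : ∀ {p q} → 0ℚ ℚ.≤ q → p ℚ.≤ q ℚ.+ p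
  p≤q+p {p} {q} 0≤q = ≡.subst (ℚ._≤ q ℚ.+ p) (ℚₚ.+-identityˡ p) (ℚₚ.+-monoˡ-≤ p 0≤q)

  ≤-∣∣ : ∀ p → p ℚ.≤ ∣ p ∣
  ≤-∣∣ p with ℚₚ.≤-total 0ℚ p
  ... | inj₁ 0≤p = ℚₚ.≤-reflexive (≡.sym (ℚₚ.0≤p⇒∣p∣≡p 0≤p))
  ... | inj₂ p≤0 = ℚₚ.≤-trans p≤0 (ℚₚ.0≤∣p∣ p)

  ∣∣< : ∀ {p ε} → p ℚ.< ε → ℚ.- p ℚ.< ε → ∣ p ∣ ℚ.< ε
  ∣∣< {p} p<ε -p<ε with ℚₚ.∣p∣≡p∨∣p∣≡-p p
  ... | inj₁ eq = ≡.subst (ℚ._< _) (≡.sym eq) p<ε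
  ... | inj₂ eq = ≡.subst (ℚ._< _) (≡.sym eq) -p<ε

  ∣p∣*∣p∣≡p*p : ∀ p → ∣ p ∣ ℚ.* ∣ p ∣ ≡ p ℚ.* p
  ∣p∣*∣p∣≡p*p p with ℚₚ.∣p∣≡p∨∣p∣≡-p p
  ... | inj₁ eq = cong₂ ℚ._*_ eq eq
  ... | inj₂ eq = ≡.trans (cong₂ ℚ._*_ eq eq)
    (solve 1 (λ p → (:- p) :* (:- p) := p :* p) ≡.refl p)

  ∣∣p∣-∣q∣∣≤∣p-q∣ : ∀ p q → ∣ ∣ p ∣ ℚ.- ∣ q ∣ ∣ ℚ.≤ ∣ p ℚ.- q ∣
  ∣∣p∣-∣q∣∣≤∣p-q∣ p q with ℚₚ.∣p∣≡p∨∣p∣≡-p (∣ p ∣ ℚ.- ∣ q ∣)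
  ... | inj₁ eq = ≡.subst (ℚ._≤ ∣ p ℚ.- q ∣) (≡.sym eq) (half p q)
    where
    half : ∀ p q → ∣ p ∣ ℚ.- ∣ q ∣ ℚ.≤ ∣ p ℚ.- q ∣
    half p q = begin
      ∣ p ∣ ℚ.- ∣ q ∣
        ≡⟨ cong (λ r → ∣ r ∣ ℚ.- ∣ q ∣) (solve 2 (λ p q → p := (p :- q) :+ q) ≡.refl p q) ⟩
      ∣ (p ℚ.- q) ℚ.+ q ∣ ℚ.- ∣ q ∣
        ≤⟨ ℚₚ.+-monoˡ-≤ (ℚ.- ∣ q ∣) (ℚₚ.∣p+q∣≤∣p∣+∣q∣ (p ℚ.- q) q) ⟩
      (∣ p ℚ.- q ∣ ℚ.+ ∣ q ∣) ℚ.- ∣ q ∣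
        ≡⟨ solve 2 (λ a b → (a :+ b) :- b := a) ≡.refl ∣ p ℚ.- q ∣ ∣ q ∣ ⟩
      ∣ p ℚ.- q ∣ ∎
      where open ℚₚ.≤-Reasoning
  ... | inj₂ eq = ≡.subst (ℚ._≤ ∣ p ℚ.- q ∣) (≡.sym eq) (begin
      ℚ.- (∣ p ∣ ℚ.- ∣ q ∣)
        ≡⟨ solve 2 (λ a b → :- (a :- b) := b :- a) ≡.refl ∣ p ∣ ∣ q ∣ ⟩
      ∣ q ∣ ℚ.- ∣ p ∣
        ≡⟨ cong (λ r → ∣ r ∣ ℚ.- ∣ p ∣) (solve 2 (λ p q → q := (q :- p) :+ p) ≡.refl p q) ⟩
      ∣ (q ℚ.- p) ℚ.+ p ∣ ℚ.- ∣ p ∣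
        ≤⟨ ℚₚ.+-monoˡ-≤ (ℚ.- ∣ p ∣) (ℚₚ.∣p+q∣≤∣p∣+∣q∣ (q ℚ.- p) p) ⟩
      (∣ q ℚ.- p ∣ ℚ.+ ∣ p ∣) ℚ.- ∣ p ∣
        ≡⟨ solve 2 (λ a b → (a :+ b) :- b := a) ≡.refl ∣ q ℚ.- p ∣ ∣ p ∣ ⟩
      ∣ q ℚ.- p ∣
        ≡⟨ ≡.trans (cong ∣_∣ (solve 2 (λ p q → q :- p := :- (p :- q)) ≡.refl p q))
                 (ℚₚ.∣-p∣≡∣p∣ (p ℚ.- q)) ⟩
      ∣ p ℚ.- q ∣ ∎)
      where open ℚₚ.≤-Reasoning

abstract
  null-≗ : ∀ {z w} → (∀ n → w n ≡ z n) → Null z → Null w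
  null-≗ eq nz ε 0<ε with nz ε 0<ε
  ... | N , h = N , λ n N≤n → ≡.subst (λ q → ∣ q ∣ ℚ.< ε) (≡.sym (eq n)) (h n N≤n)

  null-0 : Null (λ _ → 0ℚ)
  null-0 ε 0<ε = 0 , λ _ _ → 0<ε

  null-neg : ∀ {z} → Null z → Null (λ n → ℚ.- z n)
  null-neg {z} nz ε 0<ε with nz ε 0<ε
  ... | N , h = N , λ n N≤n → ≡.subst (ℚ._< ε) (≡.sym (ℚₚ.∣-p∣≡∣p∣ (z n))) (h n N≤n)

  null-+ : ∀ {z w} → Null z → Null w → Null (λ n → z n ℚ.+ w n)
  null-+ {z} {w} nz nw ε 0<ε with nz _ (0<½*p 0<ε) | nw _ (0<½*p 0<ε)
  ... | M , hz | N , hw = M ℕ.⊔ N , λ n le → ℚₚ.≤-<-trans (ℚₚ.∣p+q∣≤∣p∣+∣q∣ (z n) (w n))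
    (≡.subst (_ ℚ.<_) (½p+½p≡p ε)
      (ℚₚ.+-mono-< (hz n (ℕₚ.m⊔n≤o⇒m≤o M N le)) (hw n (ℕₚ.m⊔n≤o⇒n≤o M N le))))

  null-dominated : ∀ {z w} N → (∀ n → N ℕ.≤ n → ∣ w n ∣ ℚ.≤ ∣ z n ∣) → Null z → Null w
  null-dominated N w≤z nz ε 0<ε with nz ε 0<ε
  ... | M , h = M ℕ.⊔ N , λ n le → ℚₚ.≤-<-trans (w≤z n (ℕₚ.m⊔n≤o⇒n≤o M N le))
    (h n (ℕₚ.m⊔n≤o⇒m≤o M N le))

  null-* : ∀ {x z} → Cauchy x → Null z → Null (λ n → x n ℚ.* z n)
  null-* {x} {z} cx nz ε 0<ε with cauchy-bounded {x} cx
  -- The tolerance satisfies Bδ + δ = ε: the product estimate only gives ≤ Bδ, and the spare δ makes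
  -- the final inequality strict.
  ... | B , 0<B , M , x≤B with divide B 1ℚ ε 0<B (ℚₚ.positive⁻¹ 1ℚ) 0<ε
  ... | δ , 0<δ , Bδ+δ≡ε with nz δ 0<δ
  ... | N , h = M ℕ.⊔ N , λ n le → begin-strict
    ∣ x n ℚ.* z n ∣        ≡⟨ ℚₚ.∣p*q∣≡∣p∣*∣q∣ (x n) (z n) ⟩
    ∣ x n ∣ ℚ.* ∣ z n ∣
      ≤⟨ *-mono-≤ (ℚₚ.0≤∣p∣ (z n)) (ℚₚ.<⇒≤ 0<B) (x≤B n (ℕₚ.m⊔n≤o⇒m≤o M N le))
           (ℚₚ.<⇒≤ (h n (ℕₚ.m⊔n≤o⇒n≤o M N le))) ⟩
    B ℚ.* δ                ≡⟨ ℚₚ.+-identityʳ (B ℚ.* δ) ⟨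
    B ℚ.* δ ℚ.+ 0ℚ
      <⟨ ℚₚ.+-monoʳ-< (B ℚ.* δ) (0<p*q (ℚₚ.positive⁻¹ 1ℚ) 0<δ) ⟩
    B ℚ.* δ ℚ.+ 1ℚ ℚ.* δ   ≡⟨ Bδ+δ≡ε ⟩
    ε                      ∎
    where open ℚₚ.≤-Reasoning

  null⇒cauchy : ∀ {z} → Null z → Cauchy z
  null⇒cauchy {z} nz ε 0<ε with nz _ (0<½*p 0<ε)
  ... | N , h = N , λ m n N≤m N≤n → ℚₚ.≤-<-trans (ℚₚ.∣p-q∣≤∣p∣+∣q∣ (z m) (z n))
    (≡.subst (_ ℚ.<_) (½p+½p≡p ε) (ℚₚ.+-mono-< (h m N≤m) (h n N≤n)))

module _ where
  open +-*-Solver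

  ≗⇒≈ℝ : ∀ {x y : ℝ} → (∀ n → seq x n ≡ seq y n) → x ≈ℝ y
  ≗⇒≈ℝ {x} {y} eq = null-≗ (λ n → ≡.trans (cong (ℚ._- seq y n) (eq n)) (ℚₚ.+-inverseʳ (seq y n))) null-0

  ≈ℝ-refl : ∀ {x} → x ≈ℝ x
  ≈ℝ-refl {x} = ≗⇒≈ℝ {x} {x} (λ _ → ≡.refl)

  ≈ℝ-sym : ∀ {x y} → x ≈ℝ y → y ≈ℝ x
  ≈ℝ-sym {x} {y} x≈y = null-≗
    (λ n → solve 2 (λ a b → b :- a := :- (a :- b)) ≡.refl (seq x n) (seq y n)) (null-neg x≈y)

  ≈ℝ-trans : ∀ {x y z} → x ≈ℝ y → y ≈ℝ z → x ≈ℝ z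
  ≈ℝ-trans {x} {y} {z} x≈y y≈z = null-≗
    (λ n → solve 3 (λ a b c → a :- c := (a :- b) :+ (b :- c)) ≡.refl (seq x n) (seq y n) (seq z n))
    (null-+ x≈y y≈z)

  +ℝ-cong : ∀ {x y u v} → x ≈ℝ y → u ≈ℝ v → (x +ℝ u) ≈ℝ (y +ℝ v)
  +ℝ-cong {x} {y} {u} {v} x≈y u≈v = null-≗
    (λ n → solve 4 (λ a b c d → (a :+ c) :- (b :+ d) := (a :- b) :+ (c :- d)) ≡.refl
      (seq x n) (seq y n) (seq u n) (seq v n))
    (null-+ x≈y u≈v)

  *ℝ-cong : ∀ {x y u v} → x ≈ℝ y → u ≈ℝ v → (x *ℝ u) ≈ℝ (y *ℝ v)
  *ℝ-cong {x} {y} {u} {v} x≈y u≈v = null-≗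
    (λ n → solve 4 (λ a b c d → a :* c :- b :* d := a :* (c :- d) :+ d :* (a :- b)) ≡.refl
      (seq x n) (seq y n) (seq u n) (seq v n))
    (null-+ {λ n → seq x n ℚ.* (seq u n ℚ.- seq v n)} {λ n → seq v n ℚ.* (seq x n ℚ.- seq y n)}
      (null-* {seq x} (cauchy x) u≈v) (null-* {seq v} (cauchy v) x≈y))

  -ℝ-cong : ∀ {x y} → x ≈ℝ y → (-ℝ x) ≈ℝ (-ℝ y)
  -ℝ-cong {x} {y} x≈y = null-≗
    (λ n → solve 2 (λ a b → (:- a) :- (:- b) := :- (a :- b)) ≡.refl (seq x n) (seq y n)) (null-neg x≈y)

ℝ-commutativeRing : CommutativeRing 0ℓ 0ℓ
ℝ-commutativeRing = record
  { Carrier = ℝ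
  ; _≈_ = _≈ℝ_
  ; _+_ = _+ℝ_
  ; _*_ = _*ℝ_
  ; -_ = -ℝ_
  ; 0# = fromℚ 0ℚ
  ; 1# = fromℚ 1ℚ
  ; isCommutativeRing = record
    { isRing = record
      { +-isAbelianGroup = record
        { isGroup = record
          { isMonoid = record
            { isSemigroup = record
              { isMagma = record
                { isEquivalence = record
                  { refl = λ {x} → ≈ℝ-refl {x}
                  ; sym = λ {x} {y} → ≈ℝ-sym {x} {y}
                  ; trans = λ {x} {y} {z} → ≈ℝ-trans {x} {y} {z}
                  }
                ; ∙-cong = λ {x} {y} {u} {v} → +ℝ-cong {x} {y} {u} {v}
                }
              ; assoc = λ x y z → ≗⇒≈ℝ {(x +ℝ y) +ℝ z} {x +ℝ (y +ℝ z)}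
                  λ n → ℚₚ.+-assoc (seq x n) (seq y n) (seq z n)
              }
            ; identity = (λ x → ≗⇒≈ℝ {fromℚ 0ℚ +ℝ x} {x} λ n → ℚₚ.+-identityˡ (seq x n))
                       , (λ x → ≗⇒≈ℝ {x +ℝ fromℚ 0ℚ} {x} λ n → ℚₚ.+-identityʳ (seq x n))
            }
          ; inverse = (λ x → ≗⇒≈ℝ {(-ℝ x) +ℝ x} {fromℚ 0ℚ} λ n → ℚₚ.+-inverseˡ (seq x n))
                    , (λ x → ≗⇒≈ℝ {x +ℝ (-ℝ x)} {fromℚ 0ℚ} λ n → ℚₚ.+-inverseʳ (seq x n))
          ; ⁻¹-cong = λ {x} {y} → -ℝ-cong {x} {y}
          }
        ; comm = λ x y → ≗⇒≈ℝ {x +ℝ y} {y +ℝ x} λ n → ℚₚ.+-comm (seq x n) (seq y n)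
        }
      ; *-cong = λ {x} {y} {u} {v} → *ℝ-cong {x} {y} {u} {v}
      ; *-assoc = λ x y z → ≗⇒≈ℝ {(x *ℝ y) *ℝ z} {x *ℝ (y *ℝ z)}
          λ n → ℚₚ.*-assoc (seq x n) (seq y n) (seq z n)
      ; *-identity = (λ x → ≗⇒≈ℝ {fromℚ 1ℚ *ℝ x} {x} λ n → ℚₚ.*-identityˡ (seq x n))
                   , (λ x → ≗⇒≈ℝ {x *ℝ fromℚ 1ℚ} {x} λ n → ℚₚ.*-identityʳ (seq x n))
      ; distrib = (λ x y z → ≗⇒≈ℝ {x *ℝ (y +ℝ z)} {(x *ℝ y) +ℝ (x *ℝ z)}
                    λ n → ℚₚ.*-distribˡ-+ (seq x n) (seq y n) (seq z n))
                , (λ x y z → ≗⇒≈ℝ {(y +ℝ z) *ℝ x} {(y *ℝ x) +ℝ (z *ℝ x)}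
                    λ n → ℚₚ.*-distribʳ-+ (seq x n) (seq y n) (seq z n))
      }
    ; *-comm = λ x y → ≗⇒≈ℝ {x *ℝ y} {y *ℝ x} λ n → ℚₚ.*-comm (seq x n) (seq y n)
    }
  }

-- Square roots and inverses of real numbers

ℕ→ℚ : ℕ → ℚ
ℕ→ℚ n = mkℚ (+ n) 0 (Coprime.sym (Coprime.1-coprimeTo n))

ℕ→ℚ-suc : ∀ n → ℕ→ℚ (suc n) ≡ 1ℚ ℚ.+ ℕ→ℚ n
ℕ→ℚ-suc n = ℚₚ.toℚᵘ-injective (ℚᵘₚ.≃-sym (ℚᵘₚ.≃-trans (ℚₚ.toℚᵘ-homo-+ 1ℚ (ℕ→ℚ n))
  (ℚᵘ.*≡* (cong (λ m → (+ 1 ℤ.+ m) ℤ.* + 1) (ℤₚ.*-identityʳ (+ n))))))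

-- Archimedean property: a denominator is at least 1, so a nonnegative fraction is bounded by its
-- numerator and a negative one by 0.
≤-ℕ→ℚ : ∀ q → ∃[ n ] q ℚ.≤ ℕ→ℚ n
≤-ℕ→ℚ q@(mkℚ (+ n) d _) = n , *≤* (ℤₚ.*-monoˡ-≤-nonNeg (+ n) (ℤ.+≤+ (ℕ.s≤s ℕ.z≤n)))
≤-ℕ→ℚ q@(mkℚ (-[1+ n ]) d _) = 0 , *≤* ℤ.-≤+

-- Totalised by 1/0 = 0.
infix 8 _⁻¹
_⁻¹ : ℚ → ℚ
p ⁻¹ with p ℚₚ.≟ 0ℚ
... | yes _  = 0ℚ
... | no p≢0 = (ℚ.1/ p) {{ℚ.≢-nonZero p≢0}}

*-⁻¹ : ∀ p → p ≢ 0ℚ → p ℚ.* p ⁻¹ ≡ 1ℚ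
*-⁻¹ p p≢0 with p ℚₚ.≟ 0ℚ
... | yes p≡0 = contradiction p≡0 p≢0
... | no p≢0 = ℚₚ.*-inverseʳ p {{ℚ.≢-nonZero p≢0}}

½^_ : ℕ → ℚ
½^ zero = 1ℚ
½^ suc n = ½ ℚ.* ½^ n

0<½^n : ∀ n → 0ℚ ℚ.< ½^ n
0<½^n zero = ℚₚ.positive⁻¹ 1ℚ
0<½^n (suc n) = 0<½*p (0<½^n n)

½*p≤p : ∀ {p} → 0ℚ ℚ.≤ p → ½ ℚ.* p ℚ.≤ p
½*p≤p {p} 0≤p = ≡.subst (½ ℚ.* p ℚ.≤_) (½p+½p≡p p) (p≤q+p (0≤p*q (ℚₚ.nonNegative⁻¹ ½) 0≤p))

½^-anti : ∀ {m n} → m ℕ.≤ n → ½^ n ℚ.≤ ½^ m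
½^-anti {m} m≤n = go (ℕₚ.≤⇒≤′ m≤n)
  where
  go : ∀ {n} → m ℕ.≤′ n → ½^ n ℚ.≤ ½^ m
  go ℕ.≤′-refl = ℚₚ.≤-refl
  go (ℕ.≤′-step {n} m≤′n) = ℚₚ.≤-trans (½*p≤p (ℚₚ.<⇒≤ (0<½^n n))) (go m≤′n)

-- The next value is the average of ½ⁿ and n ½ⁿ, both at most 1. This bound turns the Archimedean
-- property into ½ⁿ → 0.
n*½^n≤1 : ∀ n → ℕ→ℚ n ℚ.* ½^ n ℚ.≤ 1ℚ
n*½^n≤1 zero = ℚₚ.nonNegative⁻¹ 1ℚ
n*½^n≤1 (suc n) = begin
  ℕ→ℚ (suc n) ℚ.* (½ ℚ.* ½^ n)
    ≡⟨ cong (ℚ._* (½ ℚ.* ½^ n)) (ℕ→ℚ-suc n) ⟩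
  (1ℚ ℚ.+ ℕ→ℚ n) ℚ.* (½ ℚ.* ½^ n)
    ≡⟨ solve 2 (λ i h → (con 1ℚ :+ i) :* (con ½ :* h) := con ½ :* h :+ con ½ :* (i :* h)) ≡.refl (ℕ→ℚ n) (½^ n) ⟩
  ½ ℚ.* ½^ n ℚ.+ ½ ℚ.* (ℕ→ℚ n ℚ.* ½^ n)
    ≤⟨ ℚₚ.+-mono-≤ (ℚₚ.*-monoˡ-≤-nonNeg ½ (½^-anti {0} {n} ℕ.z≤n)) (ℚₚ.*-monoˡ-≤-nonNeg ½ (n*½^n≤1 n)) ⟩
  ½ ℚ.* 1ℚ ℚ.+ ½ ℚ.* 1ℚ  ≡⟨⟩
  1ℚ                     ∎
  where
  open ℚₚ.≤-Reasoning
  open +-*-Solver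

abstract
  null-½^ : Null ½^_
  -- The extra 1 gives N ε ≥ 1 + ε > 1, so ε ≤ ½^N would contradict N ½^N ≤ 1.
  null-½^ ε 0<ε with ≤-ℕ→ℚ (ε ⁻¹ ℚ.+ 1ℚ)
  ... | N , le = N , λ n N≤n → ≡.subst (ℚ._< ε) (≡.sym (ℚₚ.0≤p⇒∣p∣≡p (ℚₚ.<⇒≤ (0<½^n n))))
      (ℚₚ.≤-<-trans (½^-anti N≤n) (ℚₚ.≰⇒> λ ε≤½^N → ℚₚ.<-irrefl ≡.refl (begin-strict
        1ℚ                              ≡⟨ ℚₚ.+-identityʳ 1ℚ ⟨
        1ℚ ℚ.+ 0ℚ                       <⟨ ℚₚ.+-monoʳ-< 1ℚ 0<ε ⟩
        1ℚ ℚ.+ ε                        ≡⟨ cong (ℚ._+ ε) (*-⁻¹ ε (λ ε≡0 → ℚₚ.<-irrefl (≡.sym ε≡0) 0<ε)) ⟨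
        ε ℚ.* ε ⁻¹ ℚ.+ ε                ≡⟨ solve 2 (λ i e → e :* i :+ e := (i :+ con 1ℚ) :* e) ≡.refl (ε ⁻¹) ε ⟩
        (ε ⁻¹ ℚ.+ 1ℚ) ℚ.* ε             ≤⟨ ℚₚ.*-monoʳ-≤-nonNeg ε {{ℚ.nonNegative (ℚₚ.<⇒≤ 0<ε)}} le ⟩
        ℕ→ℚ N ℚ.* ε                     ≤⟨ ℚₚ.*-monoˡ-≤-nonNeg (ℕ→ℚ N) ε≤½^N ⟩
        ℕ→ℚ N ℚ.* ½^ N                  ≤⟨ n*½^n≤1 N ⟩
        1ℚ                              ∎)))
    where
    open ℚₚ.≤-Reasoning
    open +-*-Solver

absℝ : ℝ → ℝ
absℝ x = mkℝ (λ n → ∣ seq x n ∣) abs-cauchy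
  where
  abstract
    abs-cauchy : Cauchy (λ n → ∣ seq x n ∣)
    abs-cauchy ε 0<ε with cauchy x ε 0<ε
    ... | N , h = N , λ m n N≤m N≤n →
      ℚₚ.≤-<-trans (∣∣p∣-∣q∣∣≤∣p-q∣ (seq x m) (seq x n)) (h m n N≤m N≤n)

-- Bisection for √q on [0 , q + 1].
module Bisection (q : ℚ) (0≤q : 0ℚ ℚ.≤ q) where
  open +-*-Solver

  abstract
    width : ℕ → ℚ
    width n = (q ℚ.+ 1ℚ) ℚ.* ½^ n

    lower : ℕ → ℚ
    lower zero = 0ℚ
    lower (suc n) with (lower n ℚ.+ width (suc n)) ℚ.* (lower n ℚ.+ width (suc n)) ℚₚ.≤? q
    ... | yes _ = lower n ℚ.+ width (suc n)
    ... | no  _ = lower n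

    0<width : ∀ n → 0ℚ ℚ.< width n
    0<width n = 0<p*q (ℚₚ.+-mono-≤-< 0≤q (ℚₚ.positive⁻¹ 1ℚ)) (0<½^n n)

    0≤lower : ∀ n → 0ℚ ℚ.≤ lower n
    0≤lower zero = ℚₚ.≤-refl
    0≤lower (suc n) with (lower n ℚ.+ width (suc n)) ℚ.* (lower n ℚ.+ width (suc n)) ℚₚ.≤? q
    ... | yes _ = ℚₚ.+-mono-≤ (0≤lower n) (ℚₚ.<⇒≤ (0<width (suc n)))
    ... | no  _ = 0≤lower n

    lower²≤q : ∀ n → lower n ℚ.* lower n ℚ.≤ q
    lower²≤q zero = 0≤q
    lower²≤q (suc n) with (lower n ℚ.+ width (suc n)) ℚ.* (lower n ℚ.+ width (suc n)) ℚₚ.≤? q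
    ... | yes le = le
    ... | no  _  = lower²≤q n

    -- The other half of the bisection invariant. If the midpoint is accepted, the upper end stays
    -- where it was because the width halves; if it is rejected, it becomes the upper end. Initially
    -- (q + 1)² exceeds q.
    q<upper² : ∀ n → q ℚ.< (lower n ℚ.+ width n) ℚ.* (lower n ℚ.+ width n)
    q<upper² zero = begin-strict
      q             <⟨ ≡.subst (ℚ._< q ℚ.+ 1ℚ) (ℚₚ.+-identityʳ q) (ℚₚ.+-monoʳ-< q (ℚₚ.positive⁻¹ 1ℚ)) ⟩
      q ℚ.+ 1ℚ      ≤⟨ p≤q+p (ℚₚ.+-mono-≤ (0≤p*q 0≤q 0≤q) 0≤q) ⟩
      (q ℚ.* q ℚ.+ q) ℚ.+ (q ℚ.+ 1ℚ)
        ≡⟨ solve 1 (λ q → (q :* q :+ q) :+ (q :+ con 1ℚ) :=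
             (con 0ℚ :+ (q :+ con 1ℚ) :* con 1ℚ) :* (con 0ℚ :+ (q :+ con 1ℚ) :* con 1ℚ)) ≡.refl q ⟩
      (0ℚ ℚ.+ width 0) ℚ.* (0ℚ ℚ.+ width 0) ∎
      where open ℚₚ.≤-Reasoning
    q<upper² (suc n) with (lower n ℚ.+ width (suc n)) ℚ.* (lower n ℚ.+ width (suc n)) ℚₚ.≤? q
    ... | yes _ = ≡.subst (λ u → q ℚ.< u ℚ.* u)
      (solve 3 (λ l q h → l :+ (q :+ con 1ℚ) :* h :=
        (l :+ (q :+ con 1ℚ) :* (con ½ :* h)) :+ (q :+ con 1ℚ) :* (con ½ :* h)) ≡.refl (lower n) q (½^ n))
      (q<upper² n)
    ... | no ¬le = ℚₚ.≰⇒> ¬le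

    width≡ : ∀ n → width n ≡ (q ℚ.+ 1ℚ) ℚ.* ½^ n
    width≡ n = ≡.refl

module _ {a b s t w ε : ℚ} (0≤t : 0ℚ ℚ.≤ t) (0≤w : 0ℚ ℚ.≤ w)
         (s²≤a : s ℚ.* s ℚ.≤ a) (b<⟨t+w⟩² : b ℚ.< (t ℚ.+ w) ℚ.* (t ℚ.+ w)) where
  open +-*-Solver
  open ℚₚ.≤-Reasoning

  private
    e u : ℚ
    e = ½ ℚ.* ε
    u = t ℚ.+ w

  -- Uniform continuity of the square root with modulus (ε/2)². With e = ε/2, s ≥ t + ε and w < e
  -- would give s ≥ (t + w) + e, hence a ≥ s² ≥ (t + w)² + e² > b + e². No division by a root
  -- occurs, so roots near 0 are covered.
  lower-close : 0ℚ ℚ.< ε → w ℚ.< ½ ℚ.* ε → a ℚ.- b ℚ.< (½ ℚ.* ε) ℚ.* (½ ℚ.* ε) → s ℚ.- t ℚ.< ε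
  lower-close 0<ε w<e a-b<e² = ℚₚ.≰⇒> λ ε≤s-t → ℚₚ.<-irrefl ≡.refl (begin-strict
    e ℚ.* e
      ≡⟨ solve 2 (λ e b → e := (b :+ e) :- b) ≡.refl (e ℚ.* e) b ⟩
    (b ℚ.+ e ℚ.* e) ℚ.- b
      <⟨ ℚₚ.+-monoˡ-< (ℚ.- b) (ℚₚ.+-monoˡ-< (e ℚ.* e) b<⟨t+w⟩²) ⟩
    (u ℚ.* u ℚ.+ e ℚ.* e) ℚ.- b
      ≤⟨ ℚₚ.+-monoˡ-≤ (ℚ.- b) (p≤q+p {u ℚ.* u ℚ.+ e ℚ.* e} {u ℚ.* e ℚ.+ u ℚ.* e}
           (ℚₚ.+-mono-≤ (0≤p*q {u} {e} 0≤u 0≤e) (0≤p*q {u} {e} 0≤u 0≤e))) ⟩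
    ((u ℚ.* e ℚ.+ u ℚ.* e) ℚ.+ (u ℚ.* u ℚ.+ e ℚ.* e)) ℚ.- b
      ≡⟨ solve 3 (λ u e b → ((u :* e :+ u :* e) :+ (u :* u :+ e :* e)) :- b := (u :+ e) :* (u :+ e) :- b) ≡.refl u e b ⟩
    (u ℚ.+ e) ℚ.* (u ℚ.+ e) ℚ.- b
      ≤⟨ ℚₚ.+-monoˡ-≤ (ℚ.- b) (square-mono-≤ {u ℚ.+ e} {s} (ℚₚ.+-mono-≤ 0≤u 0≤e) (u+e≤s ε≤s-t)) ⟩
    s ℚ.* s ℚ.- b
      ≤⟨ ℚₚ.+-monoˡ-≤ (ℚ.- b) s²≤a ⟩
    a ℚ.- b
      <⟨ a-b<e² ⟩
    e ℚ.* e ∎)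
    where
    0≤e : 0ℚ ℚ.≤ e
    0≤e = ℚₚ.<⇒≤ (0<½*p {ε} 0<ε)
    0≤u : 0ℚ ℚ.≤ u
    0≤u = ℚₚ.+-mono-≤ 0≤t 0≤w
    u+e≤s : ε ℚ.≤ s ℚ.- t → u ℚ.+ e ℚ.≤ s
    u+e≤s ε≤s-t = begin
      (t ℚ.+ w) ℚ.+ e      ≤⟨ ℚₚ.+-monoˡ-≤ e (ℚₚ.+-monoʳ-≤ t (ℚₚ.<⇒≤ w<e)) ⟩
      (t ℚ.+ e) ℚ.+ e      ≡⟨ solve 2 (λ t ε → (t :+ con ½ :* ε) :+ con ½ :* ε := ε :+ t) ≡.refl t ε ⟩
      ε ℚ.+ t              ≤⟨ ℚₚ.+-monoˡ-≤ t ε≤s-t ⟩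
      (s ℚ.- t) ℚ.+ t      ≡⟨ solve 2 (λ s t → (s :- t) :+ t := s) ≡.refl s t ⟩
      s                    ∎

-- The gap a - s² is below (s + w)² - s² = (2s + w) w. A bounded factor times the width is null,
-- which is how the bound is used.
square-error : ∀ {a s w} → s ℚ.* s ℚ.≤ a → a ℚ.< (s ℚ.+ w) ℚ.* (s ℚ.+ w) →
  ∣ s ℚ.* s ℚ.- a ∣ ℚ.≤ ∣ ((s ℚ.+ s) ℚ.+ w) ℚ.* w ∣
square-error {a} {s} {w} s²≤a a<⟨s+w⟩² = begin
  ∣ s ℚ.* s ℚ.- a ∣
    ≡⟨ cong ∣_∣ (solve 2 (λ a b → a :- b := :- (b :- a)) ≡.refl (s ℚ.* s) a) ⟩
  ∣ ℚ.- (a ℚ.- s ℚ.* s) ∣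
    ≡⟨ ℚₚ.∣-p∣≡∣p∣ (a ℚ.- s ℚ.* s) ⟩
  ∣ a ℚ.- s ℚ.* s ∣
    ≡⟨ ℚₚ.0≤p⇒∣p∣≡p (≡.subst (ℚ._≤ a ℚ.- s ℚ.* s) (ℚₚ.+-inverseʳ (s ℚ.* s))
         (ℚₚ.+-monoˡ-≤ (ℚ.- (s ℚ.* s)) s²≤a)) ⟩
  a ℚ.- s ℚ.* s
    ≤⟨ ℚₚ.+-monoˡ-≤ (ℚ.- (s ℚ.* s)) (ℚₚ.<⇒≤ a<⟨s+w⟩²) ⟩
  (s ℚ.+ w) ℚ.* (s ℚ.+ w) ℚ.- s ℚ.* s
    ≡⟨ solve 2 (λ s w → (s :+ w) :* (s :+ w) :- s :* s := ((s :+ s) :+ w) :* w) ≡.refl s w ⟩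
  ((s ℚ.+ s) ℚ.+ w) ℚ.* w
    ≤⟨ ≤-∣∣ (((s ℚ.+ s) ℚ.+ w) ℚ.* w) ⟩
  ∣ ((s ℚ.+ s) ℚ.+ w) ℚ.* w ∣ ∎
  where
  open +-*-Solver
  open ℚₚ.≤-Reasoning

-‿flip : ∀ p q → p ℚ.- q ≡ ℚ.- (q ℚ.- p)
-‿flip = solve 2 (λ p q → p :- q := :- (q :- p)) ≡.refl
  where open +-*-Solver

-- Taking absolute values makes every term admissible for bisection without knowing the sign of x.
-- The root is a diagonal sequence: its n-th term is the n-th bisection step for the n-th term of
-- the absolute value.
module AbsSqrt (x : ℝ) where
  private
    a : ℕ → ℚ
    a n = ∣ seq x n ∣

    module B n = Bisection (a n) (ℚₚ.0≤∣p∣ (seq x n))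

    s w : ℕ → ℚ
    s n = B.lower n n
    w n = B.width n n

    abstract
      null-w : Null w
      null-w = null-≗ (λ n → B.width≡ n n) (null-* {λ n → a n ℚ.+ 1ℚ} {½^_}
        (cauchy-+ a (λ _ → 1ℚ) (cauchy (absℝ x)) (cauchy-const 1ℚ)) null-½^)

      close : ∀ {ε} m n → 0ℚ ℚ.< ε → ∣ a m ℚ.- a n ∣ ℚ.< (½ ℚ.* ε) ℚ.* (½ ℚ.* ε) →
        ∣ w n ∣ ℚ.< ½ ℚ.* ε → s m ℚ.- s n ℚ.< ε
      close {ε} m n 0<ε am-an wn<e = lower-close {a m} {a n} {s m} {s n} {w n} {ε}
        (B.0≤lower n n) (ℚₚ.<⇒≤ (B.0<width n n)) (B.lower²≤q m m) (B.q<upper² n n) 0<ε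
        (ℚₚ.≤-<-trans (≤-∣∣ (w n)) wn<e) (ℚₚ.≤-<-trans (≤-∣∣ (a m ℚ.- a n)) am-an)

      cauchy-s : Cauchy s
      cauchy-s ε 0<ε = cauchy-at
        (cauchy (absℝ x) ((½ ℚ.* ε) ℚ.* (½ ℚ.* ε))
          (0<p*q {½ ℚ.* ε} {½ ℚ.* ε} (0<½*p {ε} 0<ε) (0<½*p {ε} 0<ε)))
        (null-w (½ ℚ.* ε) (0<½*p {ε} 0<ε))
        where
        cauchy-at : ∃[ M ] (∀ m n → M ℕ.≤ m → M ℕ.≤ n → ∣ a m ℚ.- a n ∣ ℚ.< (½ ℚ.* ε) ℚ.* (½ ℚ.* ε)) →
          ∃[ N ] (∀ n → N ℕ.≤ n → ∣ w n ∣ ℚ.< ½ ℚ.* ε) →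
          ∃[ N ] ∀ m n → N ℕ.≤ m → N ℕ.≤ n → ∣ s m ℚ.- s n ∣ ℚ.< ε
        cauchy-at (M , ha) (N , hw) = M ℕ.⊔ N , λ m n le le′ → ∣∣< {s m ℚ.- s n}
          (close m n 0<ε (ha m n (M≤ le) (M≤ le′)) (hw n (N≤ le′)))
          (≡.subst (ℚ._< ε) (-‿flip (s n) (s m))
            (close n m 0<ε (ha n m (M≤ le′) (M≤ le)) (hw m (N≤ le))))
          where
          M≤ : ∀ {k} → M ℕ.⊔ N ℕ.≤ k → M ℕ.≤ k
          M≤ = ℕₚ.m⊔n≤o⇒m≤o M N
          N≤ : ∀ {k} → M ℕ.⊔ N ℕ.≤ k → N ℕ.≤ k
          N≤ = ℕₚ.m⊔n≤o⇒n≤o M N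

  √∣x∣ : ℝ
  √∣x∣ = mkℝ s cauchy-s

  abstract
    √∣x∣-square : (√∣x∣ *ℝ √∣x∣) ≈ℝ absℝ x
    √∣x∣-square = null-dominated {λ n → ((s n ℚ.+ s n) ℚ.+ w n) ℚ.* w n} {λ n → s n ℚ.* s n ℚ.- a n} 0
      (λ n _ → square-error {a n} {s n} {w n} (B.lower²≤q n n) (B.q<upper² n n))
      (null-* {λ n → (s n ℚ.+ s n) ℚ.+ w n} {w}
        (cauchy-+ (λ n → s n ℚ.+ s n) w (cauchy-+ s s cauchy-s cauchy-s) (null⇒cauchy null-w)) null-w)

-- Inverses of nonzero real numbers

module _ (em : ExcludedMiddle 0ℓ) (x : ℝ) (x≉0 : ¬ x ≈ℝ fromℚ 0ℚ) where
  open +-*-Solver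
  open ℚₚ.≤-Reasoning

  -- A sequence that is not null has, classically, terms of absolute value at least some ε
  -- arbitrarily far out. Beyond the point where terms differ by less than ε/2, one such term keeps
  -- all others above ε/2.
  bounded-away : ∃[ δ ] 0ℚ ℚ.< δ × ∃[ N ] ∀ n → N ℕ.≤ n → δ ℚ.≤ ∣ seq x n ∣
  bounded-away with em {∃[ ε ] 0ℚ ℚ.< ε × ∀ N → ∃[ n ] N ℕ.≤ n × ε ℚ.≤ ∣ seq x n ∣}
  ... | no ¬p = contradiction
    (λ ε 0<ε → eventually ε 0<ε) x≉0
    where
    eventually : ∀ ε → 0ℚ ℚ.< ε → ∃[ N ] ∀ n → N ℕ.≤ n → ∣ seq x n ℚ.- 0ℚ ∣ ℚ.< ε
    eventually ε 0<ε with em {∃[ N ] ∀ n → N ℕ.≤ n → ∣ seq x n ∣ ℚ.< ε}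
    ... | yes (N , h) = N , λ n N≤n → ≡.subst (λ q → ∣ q ∣ ℚ.< ε) (≡.sym (ℚₚ.+-identityʳ (seq x n))) (h n N≤n)
    ... | no ¬h = contradiction (ε , 0<ε , frequently) ¬p
      where
      frequently : ∀ N → ∃[ n ] N ℕ.≤ n × ε ℚ.≤ ∣ seq x n ∣
      frequently N with em {∃[ n ] N ℕ.≤ n × ε ℚ.≤ ∣ seq x n ∣}
      ... | yes p = p
      ... | no ¬q = contradiction (N , λ n N≤n → ℚₚ.≰⇒> λ ε≤ → ¬q (n , N≤n , ε≤)) ¬h
  ... | yes (ε , 0<ε , h) with cauchy x _ (0<½*p 0<ε)
  ... | N , hx with h N
  ... | m , N≤m , ε≤ = ½ ℚ.* ε , 0<½*p 0<ε , N , λ n N≤n → begin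
    ½ ℚ.* ε
      ≡⟨ solve 1 (λ e → con ½ :* e := e :- con ½ :* e) ≡.refl ε ⟩
    ε ℚ.- ½ ℚ.* ε
      ≤⟨ ℚₚ.+-mono-≤ ε≤ (ℚₚ.neg-antimono-≤ (ℚₚ.<⇒≤ (hx m n N≤m N≤n))) ⟩
    ∣ seq x m ∣ ℚ.- ∣ seq x m ℚ.- seq x n ∣
      ≤⟨ ℚₚ.+-monoʳ-≤ ∣ seq x m ∣ (ℚₚ.neg-antimono-≤ (ℚₚ.≤-trans (≤-∣∣ (∣ seq x m ∣ ℚ.- ∣ seq x n ∣)) (∣∣p∣-∣q∣∣≤∣p-q∣ (seq x m) (seq x n)))) ⟩
    ∣ seq x m ∣ ℚ.- (∣ seq x m ∣ ℚ.- ∣ seq x n ∣)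
      ≡⟨ solve 2 (λ a b → a :- (a :- b) := b) ≡.refl ∣ seq x m ∣ ∣ seq x n ∣ ⟩
    ∣ seq x n ∣ ∎

∣p∣≥δ⇒p≢0 : ∀ {δ p} → 0ℚ ℚ.< δ → δ ℚ.≤ ∣ p ∣ → p ≢ 0ℚ
∣p∣≥δ⇒p≢0 0<δ δ≤ ≡.refl = ℚₚ.<-irrefl ≡.refl (ℚₚ.<-≤-trans 0<δ δ≤)

∣p⁻¹∣≤ : ∀ {δ p} → 0ℚ ℚ.< δ → δ ℚ.≤ ∣ p ∣ → ∣ p ⁻¹ ∣ ℚ.≤ δ ⁻¹
∣p⁻¹∣≤ {δ} {p} 0<δ δ≤ = ℚₚ.*-cancelˡ-≤-pos δ {{ℚ.positive 0<δ}} (begin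
  δ ℚ.* ∣ p ⁻¹ ∣        ≤⟨ ℚₚ.*-monoʳ-≤-nonNeg ∣ p ⁻¹ ∣ {{ℚₚ.∣-∣-nonNeg (p ⁻¹)}} δ≤ ⟩
  ∣ p ∣ ℚ.* ∣ p ⁻¹ ∣    ≡⟨ ℚₚ.∣p*q∣≡∣p∣*∣q∣ p (p ⁻¹) ⟨
  ∣ p ℚ.* p ⁻¹ ∣        ≡⟨ cong ∣_∣ (*-⁻¹ p (∣p∣≥δ⇒p≢0 0<δ δ≤)) ⟩
  1ℚ                    ≡⟨ *-⁻¹ δ (λ δ≡0 → ℚₚ.<-irrefl (≡.sym δ≡0) 0<δ) ⟨
  δ ℚ.* δ ⁻¹            ∎)
  where open ℚₚ.≤-Reasoning

ℝ-inverse : ExcludedMiddle 0ℓ → ∀ (x : ℝ) → ¬ x ≈ℝ fromℚ 0ℚ → ∃[ y ] (x *ℝ y) ≈ℝ fromℚ 1ℚ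
ℝ-inverse em x x≉0 with bounded-away em x x≉0
-- Terms before `N` may be 0, where `⁻¹` returns 0; only the tail enters the Cauchy condition and
-- the product.
... | δ , 0<δ , N , δ≤ = mkℝ (λ n → seq x n ⁻¹) cauchy-⁻¹ , inverse
  where
  open +-*-Solver
  open ℚₚ.≤-Reasoning
  d : ℚ
  d = δ ⁻¹

  0<d : 0ℚ ℚ.< d
  0<d = ℚₚ.≰⇒> λ d≤0 → ℚₚ.<-irrefl ≡.refl (begin-strict
    0ℚ                  <⟨ ℚₚ.positive⁻¹ 1ℚ ⟩
    1ℚ                  ≡⟨ *-⁻¹ δ (λ δ≡0 → ℚₚ.<-irrefl (≡.sym δ≡0) 0<δ) ⟨
    δ ℚ.* δ ⁻¹          ≤⟨ ℚₚ.*-monoˡ-≤-nonNeg δ {{ℚ.nonNegative (ℚₚ.<⇒≤ 0<δ)}} d≤0 ⟩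
    δ ℚ.* 0ℚ            ≡⟨ ℚₚ.*-zeroʳ δ ⟩
    0ℚ                  ∎)

  abstract
    cauchy-⁻¹ : Cauchy (λ n → seq x n ⁻¹)
    -- The factor δ² compensates for 1/p - 1/q = (q - p)/(pq) with ∣p∣ and ∣q∣ at least δ.
    cauchy-⁻¹ ε 0<ε with cauchy x _ (0<p*q 0<ε (0<p*q 0<δ 0<δ))
    ... | M , h = M ℕ.⊔ N , λ m n le le′ → bound m n
          (h m n (ℕₚ.m⊔n≤o⇒m≤o M N le) (ℕₚ.m⊔n≤o⇒m≤o M N le′))
          (δ≤ m (ℕₚ.m⊔n≤o⇒n≤o M N le)) (δ≤ n (ℕₚ.m⊔n≤o⇒n≤o M N le′))
      where
      bound : ∀ m n → ∣ seq x m ℚ.- seq x n ∣ ℚ.< ε ℚ.* (δ ℚ.* δ) →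
        δ ℚ.≤ ∣ seq x m ∣ → δ ℚ.≤ ∣ seq x n ∣ → ∣ seq x m ⁻¹ ℚ.- seq x n ⁻¹ ∣ ℚ.< ε
      bound m n lt δ≤p δ≤q = begin-strict
        ∣ p ⁻¹ ℚ.- q ⁻¹ ∣
          ≡⟨ cong ∣_∣ (begin-equality
            p ⁻¹ ℚ.- q ⁻¹
              ≡⟨ cong₂ ℚ._-_ (ℚₚ.*-identityʳ (p ⁻¹)) (ℚₚ.*-identityʳ (q ⁻¹)) ⟨
            p ⁻¹ ℚ.* 1ℚ ℚ.- q ⁻¹ ℚ.* 1ℚ
              ≡⟨ cong₂ (λ a b → p ⁻¹ ℚ.* a ℚ.- q ⁻¹ ℚ.* b)
                   (*-⁻¹ q (∣p∣≥δ⇒p≢0 0<δ δ≤q)) (*-⁻¹ p (∣p∣≥δ⇒p≢0 0<δ δ≤p)) ⟨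
            p ⁻¹ ℚ.* (q ℚ.* q ⁻¹) ℚ.- q ⁻¹ ℚ.* (p ℚ.* p ⁻¹)
              ≡⟨ solve 4 (λ p q i j → i :* (q :* j) :- j :* (p :* i) := (:- (p :- q)) :* (i :* j)) ≡.refl p q (p ⁻¹) (q ⁻¹) ⟩
            ℚ.- (p ℚ.- q) ℚ.* (p ⁻¹ ℚ.* q ⁻¹) ∎) ⟩
        ∣ ℚ.- (p ℚ.- q) ℚ.* (p ⁻¹ ℚ.* q ⁻¹) ∣
          ≡⟨ ≡.trans (ℚₚ.∣p*q∣≡∣p∣*∣q∣ (ℚ.- (p ℚ.- q)) (p ⁻¹ ℚ.* q ⁻¹))
               (cong₂ ℚ._*_ (ℚₚ.∣-p∣≡∣p∣ (p ℚ.- q)) (ℚₚ.∣p*q∣≡∣p∣*∣q∣ (p ⁻¹) (q ⁻¹))) ⟩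
        ∣ p ℚ.- q ∣ ℚ.* (∣ p ⁻¹ ∣ ℚ.* ∣ q ⁻¹ ∣)
          ≤⟨ ℚₚ.*-monoˡ-≤-nonNeg ∣ p ℚ.- q ∣ {{ℚₚ.∣-∣-nonNeg (p ℚ.- q)}}
               (*-mono-≤ (ℚₚ.0≤∣p∣ (q ⁻¹)) (ℚₚ.<⇒≤ 0<d) (∣p⁻¹∣≤ 0<δ δ≤p) (∣p⁻¹∣≤ 0<δ δ≤q)) ⟩
        ∣ p ℚ.- q ∣ ℚ.* (d ℚ.* d)
          <⟨ ℚₚ.*-monoˡ-<-pos (d ℚ.* d) {{ℚ.positive (0<p*q 0<d 0<d)}} lt ⟩
        ε ℚ.* (δ ℚ.* δ) ℚ.* (d ℚ.* d)
          ≡⟨ solve 3 (λ e s d → e :* (s :* s) :* (d :* d) := e :* ((s :* d) :* (s :* d))) ≡.refl ε δ d ⟩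
        ε ℚ.* ((δ ℚ.* d) ℚ.* (δ ℚ.* d))
          ≡⟨ cong (λ r → ε ℚ.* (r ℚ.* r)) (*-⁻¹ δ (λ δ≡0 → ℚₚ.<-irrefl (≡.sym δ≡0) 0<δ)) ⟩
        ε ℚ.* 1ℚ
          ≡⟨ ℚₚ.*-identityʳ ε ⟩
        ε ∎
        where
        p q : ℚ
        p = seq x m
        q = seq x n

    inverse : (x *ℝ mkℝ (λ n → seq x n ⁻¹) cauchy-⁻¹) ≈ℝ fromℚ 1ℚ
    inverse = null-dominated {λ _ → 0ℚ} N
      (λ n N≤n → ℚₚ.≤-reflexive (cong (λ r → ∣ r ℚ.- 1ℚ ∣) (*-⁻¹ (seq x n) (∣p∣≥δ⇒p≢0 0<δ (δ≤ n N≤n))))) null-0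

-- Fields of characteristic zero, and the field of complex numbers

-- Characteristic zero is encoded as a homomorphism from the rationals. It supplies ½ and infinitely
-- many distinct elements, and is the coefficient map of the ring solver.
record ℚ-Field : Set₁ where
  field
    commutativeRing : CommutativeRing 0ℓ 0ℓ
  open CommutativeRing commutativeRing public
  field
    ℚ-homomorphism : ℚₚ.+-*-rawRing -Raw-AlmostCommutative⟶ fromCommutativeRing commutativeRing
    1≉0 : ¬ 1# ≈ 0#
    invertible : ∀ x → ¬ x ≈ 0# → ∃[ y ] x * y ≈ 1#
    _≈0? : ∀ x → Dec (x ≈ 0#)
  open _-Raw-AlmostCommutative⟶_ ℚ-homomorphism public using ()
    renaming (⟦_⟧ to fromℚ′; 0-homo to fromℚ-0; 1-homo to fromℚ-1; +-homo to fromℚ-+; *-homo to fromℚ-*; -‿homo to fromℚ-neg)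

module FieldProperties (K : ℚ-Field) where
  open ℚ-Field K public
  open Relation.Binary.Reasoning.Setoid setoid public

  private
    coefficient≟ : (p q : ℚ) → Maybe (fromℚ′ p ≈ fromℚ′ q)
    coefficient≟ p q with p ℚₚ.≟ q
    ... | yes ≡.refl = just refl
    ... | no  _      = nothing

  module Solver = Algebra.Solver.Ring
    ℚₚ.+-*-rawRing (fromCommutativeRing commutativeRing) ℚ-homomorphism coefficient≟
  open Solver public using (solve; _:=_; _:+_; _:*_; _:-_; :-_; con)

  x*y≈0⇒y≈0 : ∀ {x y} → ¬ x ≈ 0# → x * y ≈ 0# → y ≈ 0#
  x*y≈0⇒y≈0 {x} {y} x≉0 xy≈0 with invertible x x≉0
  ... | x⁻¹ , xx⁻¹≈1 = begin
    y                ≈⟨ *-identityˡ y ⟨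
    1# * y           ≈⟨ *-congʳ xx⁻¹≈1 ⟨
    x * x⁻¹ * y      ≈⟨ solve 3 (λ x i y → x :* i :* y := i :* (x :* y)) refl x x⁻¹ y ⟩
    x⁻¹ * (x * y)    ≈⟨ *-congˡ xy≈0 ⟩
    x⁻¹ * 0#         ≈⟨ zeroʳ x⁻¹ ⟩
    0#               ∎

  x*y≈0⇒x≈0∨y≈0 : ∀ {x y} → x * y ≈ 0# → x ≈ 0# ⊎ y ≈ 0#
  x*y≈0⇒x≈0∨y≈0 {x} xy≈0 with x ≈0?
  ... | yes x≈0 = inj₁ x≈0
  ... | no  x≉0 = inj₂ (x*y≈0⇒y≈0 x≉0 xy≈0)

  x²≈0⇒x≈0 : ∀ {x} → x * x ≈ 0# → x ≈ 0#
  x²≈0⇒x≈0 xx≈0 = [ (λ p → p) , (λ p → p) ]′ (x*y≈0⇒x≈0∨y≈0 xx≈0)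

  x-y≈0⇒x≈y : ∀ {x y} → x - y ≈ 0# → x ≈ y
  x-y≈0⇒x≈y {x} {y} x-y≈0 = begin
    x              ≈⟨ solve 2 (λ x y → x := (x :- y) :+ y) refl x y ⟩
    (x - y) + y    ≈⟨ +-congʳ x-y≈0 ⟩
    0# + y         ≈⟨ +-identityˡ y ⟩
    y              ∎

  x≈y⇒x-y≈0 : ∀ {x y} → x ≈ y → x - y ≈ 0#
  x≈y⇒x-y≈0 {x} {y} x≈y = trans (+-congʳ x≈y) (-‿inverseʳ y)

  fromℚ-nonZero : ∀ {q} → q ≢ 0ℚ → ¬ fromℚ′ q ≈ 0#
  fromℚ-nonZero {q} q≢0 q≈0 = 1≉0 (begin
    1#                        ≈⟨ fromℚ-1 ⟨
    fromℚ′ 1ℚ                 ≡⟨ cong fromℚ′ (*-⁻¹ q q≢0) ⟨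
    fromℚ′ (q ℚ.* q ⁻¹)       ≈⟨ fromℚ-* q (q ⁻¹) ⟩
    fromℚ′ q * fromℚ′ (q ⁻¹)  ≈⟨ *-congʳ q≈0 ⟩
    0# * fromℚ′ (q ⁻¹)        ≈⟨ zeroˡ _ ⟩
    0#                        ∎)

-- Square roots and inverses of complex numbers, given by their real and
-- imaginary parts.
module FormallyReal (R : ℚ-Field) where
  open FieldProperties R hiding (zero)

  -- The order of the reals enters only through these three properties. In particular `√±` yields a
  -- root of x or of -x without saying which.
  module _
    (x²+y²≈0⇒x≈0 : ∀ x y → x * x + y * y ≈ 0# → x ≈ 0#)
    (√± : ∀ x → ∃[ s ] (s * s ≈ x ⊎ s * s ≈ - x))
    (√⟨x²+y²⟩ : ∀ x y → ∃[ s ] s * s ≈ x * x + y * y)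
    where

    x²+y²≈0⇒y≈0 : ∀ {x y} → x * x + y * y ≈ 0# → y ≈ 0#
    x²+y²≈0⇒y≈0 {x} {y} h = x²+y²≈0⇒x≈0 y x (trans (+-comm (y * y) (x * x)) h)

    complex-inverse : ∀ a b → ¬ (a ≈ 0# × b ≈ 0#) →
      ∃[ p ] ∃[ q ] (a * p + - (b * q) ≈ 1# × a * q + b * p ≈ 0#)
    complex-inverse a b ab≉0
      with invertible (a * a + b * b) (λ h → ab≉0 (x²+y²≈0⇒x≈0 a b h , x²+y²≈0⇒y≈0 h))
    ... | d , hd = a * d , - (b * d)
      , trans (solve 3 (λ a b d → a :* (a :* d) :+ :- (b :* :- (b :* d)) := (a :* a :+ b :* b) :* d) refl a b d) hd
      , trans (solve 3 (λ a b d → a :* :- (b :* d) :+ b :* (a :* d) := con 0ℚ) refl a b d) fromℚ-0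


    private
      2# ½# : Carrier
      2# = fromℚ′ (1ℚ ℚ.+ 1ℚ)
      ½# = fromℚ′ ½

      -- A square root p + qi of a + bi up to the sign of the imaginary part: only (2pq)² = b² is
      -- demanded, and `adjust-sign` settles the rest.
      Root : Carrier → Carrier → Set
      Root a b = ∃[ p ] ∃[ q ] (p * p - q * q ≈ a × (2# * (p * q)) * (2# * (p * q)) ≈ b * b)

      -- As 4 u v = b² and u, - v are squares, 4 u v is both ≥ 0 and ≤ 0.
      mixed : ∀ {p q u v b} → p * p ≈ u → q * q ≈ - v → (2# * 2#) * (u * v) ≈ b * b →
        u ≈ 0# ⊎ v ≈ 0#
      mixed {p} {q} {u} {v} {b} p²≈u q²≈-v 4uv≈b² =
        [ (λ p≈0 → inj₁ (trans (sym p²≈u) (trans (*-congʳ p≈0) (zeroˡ p))))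
        , (λ q≈0 → inj₂ (begin
            v           ≈⟨ solve 1 (λ v → v := :- (:- v)) refl v ⟩
            - - v       ≈⟨ -‿cong q²≈-v ⟨
            - (q * q)   ≈⟨ -‿cong (trans (*-congʳ q≈0) (zeroˡ q)) ⟩
            - 0#        ≈⟨ -‿cong fromℚ-0 ⟨
            - fromℚ′ 0ℚ ≈⟨ solve 0 (:- con 0ℚ := con 0ℚ) refl ⟩
            fromℚ′ 0ℚ   ≈⟨ fromℚ-0 ⟩
            0#          ∎))
        ]′
          (x*y≈0⇒x≈0∨y≈0 (x*y≈0⇒y≈0 (fromℚ-nonZero {1ℚ ℚ.+ 1ℚ} λ ()) (x²+y²≈0⇒x≈0 _ _ sum≈0)))
        where
        sum≈0 : (2# * (p * q)) * (2# * (p * q)) + b * b ≈ 0#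
        sum≈0 = begin
          (2# * (p * q)) * (2# * (p * q)) + b * b
            ≈⟨ solve 3 (λ p q b → (con (1ℚ ℚ.+ 1ℚ) :* (p :* q)) :* (con (1ℚ ℚ.+ 1ℚ) :* (p :* q)) :+ b :* b :=
                 (con (1ℚ ℚ.+ 1ℚ) :* con (1ℚ ℚ.+ 1ℚ)) :* ((p :* p) :* (q :* q)) :+ b :* b) refl p q b ⟩
          (2# * 2#) * ((p * p) * (q * q)) + b * b
            ≈⟨ +-cong (*-congˡ (*-cong p²≈u q²≈-v)) (sym 4uv≈b²) ⟩
          (2# * 2#) * (u * - v) + (2# * 2#) * (u * v)
            ≈⟨ solve 2 (λ u v → (con (1ℚ ℚ.+ 1ℚ) :* con (1ℚ ℚ.+ 1ℚ)) :* (u :* :- v) :+ (con (1ℚ ℚ.+ 1ℚ) :* con (1ℚ ℚ.+ 1ℚ)) :* (u :* v) := con 0ℚ) refl u v ⟩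
          fromℚ′ 0ℚ
            ≈⟨ fromℚ-0 ⟩
          0# ∎

      same : ∀ {p q u v b} → p * p ≈ u → q * q ≈ v → (2# * 2#) * (u * v) ≈ b * b → Root (u - v) b
      same {p} {q} {u} {v} {b} p²≈u q²≈v 4uv≈b² = p , q , +-cong p²≈u (-‿cong q²≈v) , (begin
        (2# * (p * q)) * (2# * (p * q))
          ≈⟨ solve 2 (λ p q → (con (1ℚ ℚ.+ 1ℚ) :* (p :* q)) :* (con (1ℚ ℚ.+ 1ℚ) :* (p :* q)) :=
               (con (1ℚ ℚ.+ 1ℚ) :* con (1ℚ ℚ.+ 1ℚ)) :* ((p :* p) :* (q :* q))) refl p q ⟩
        (2# * 2#) * ((p * p) * (q * q))
          ≈⟨ *-congˡ (*-cong p²≈u q²≈v) ⟩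
        (2# * 2#) * (u * v)
          ≈⟨ 4uv≈b² ⟩
        b * b ∎)

      swap : ∀ {u v b} → (2# * 2#) * (u * v) ≈ b * b → (2# * 2#) * (- v * - u) ≈ b * b
      swap {u} {v} h = trans (solve 2 (λ u v → (con (1ℚ ℚ.+ 1ℚ) :* con (1ℚ ℚ.+ 1ℚ)) :* (:- v :* :- u) :=
        (con (1ℚ ℚ.+ 1ℚ) :* con (1ℚ ℚ.+ 1ℚ)) :* (u :* v)) refl u v) h

      Root-resp : ∀ {a a′ b} → a ≈ a′ → Root a b → Root a′ b
      Root-resp a≈a′ (p , q , h , h′) = p , q , trans h a≈a′ , h′

      u-v≈-v--u : ∀ u v → - v - - u ≈ u - v
      u-v≈-v--u = solve 2 (λ u v → :- v :- :- u := u :- v) refl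

      x≈0⇒-x≈0 : ∀ {x} → x ≈ 0# → - x ≈ 0#
      x≈0⇒-x≈0 x≈0 = trans (-‿cong (trans x≈0 (sym fromℚ-0)))
        (trans (solve 0 (:- con 0ℚ := con 0ℚ) refl) fromℚ-0)

      0²≈ : ∀ {x} → x ≈ 0# → 0# * 0# ≈ x
      0²≈ x≈0 = trans (zeroˡ 0#) (sym x≈0)

      -- Roots of u and v are what is wanted, but `√±` may return roots of their negatives. If both
      -- are negated, the pair (-v, -u) has the same difference and product as (u, v). If exactly
      -- one is, `mixed` makes u or v zero, and 0 is a root of either sign.
      root : ∀ u v b → (2# * 2#) * (u * v) ≈ b * b → Root (u - v) b
      root u v b h = cases (√± u) (√± v)
        where
        swapped : ∀ {p q} → p * p ≈ - v → q * q ≈ - u → Root (u - v) b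
        swapped {p} {q} hp hq = Root-resp {b = b} (u-v≈-v--u u v)
          (same {p} {q} { - v} { - u} {b} hp hq (swap {u} {v} {b} h))

        cases : ∃[ p ] (p * p ≈ u ⊎ p * p ≈ - u) → ∃[ q ] (q * q ≈ v ⊎ q * q ≈ - v) → Root (u - v) b
        cases (p , inj₁ hp) (q , inj₁ hq) = same {p} {q} {u} {v} {b} hp hq h
        cases (p , inj₂ hp) (q , inj₂ hq) = swapped hq hp
        cases (p , inj₁ hp) (q , inj₂ hq) =
          [ (λ u≈0 → swapped hq (0²≈ (x≈0⇒-x≈0 u≈0)))
          , (λ v≈0 → same {p} {0#} {u} {v} {b} hp (0²≈ v≈0) h)
          ]′ (mixed {p} {q} {u} {v} {b} hp hq h)
        cases (p , inj₂ hp) (q , inj₁ hq) =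
          [ (λ v≈0 → swapped (0²≈ (x≈0⇒-x≈0 v≈0)) hp)
          , (λ u≈0 → same {0#} {q} {u} {v} {b} (0²≈ u≈0) hq h)
          ]′ (mixed {q} {p} {v} {u} {b} hq hp (trans (*-congˡ (*-comm v u)) h))

      -- Since (2pq - b)(2pq + b) = 0, one factor vanishes; in the second case q is replaced by -q.
      adjust-sign : ∀ a b → Root a b → ∃[ p ] ∃[ q ] (p * p + - (q * q) ≈ a × p * q + q * p ≈ b)
      adjust-sign a b (p , q , p²-q²≈a , ⟨2pq⟩²≈b²) =
        [ (λ 2pq-b≈0 → p , q , p²-q²≈a
            , trans (solve 2 (λ p q → p :* q :+ q :* p := con (1ℚ ℚ.+ 1ℚ) :* (p :* q)) refl p q) (x-y≈0⇒x≈y 2pq-b≈0))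
        , (λ 2pq+b≈0 → p , - q
            , trans (+-congˡ (-‿cong (solve 1 (λ q → :- q :* :- q := q :* q) refl q))) p²-q²≈a
            , (begin
              p * - q + - q * p
                ≈⟨ solve 3 (λ p q b → p :* :- q :+ :- q :* p := b :- (con (1ℚ ℚ.+ 1ℚ) :* (p :* q) :+ b)) refl p q b ⟩
              b - (2# * (p * q) + b)
                ≈⟨ +-congˡ (x≈0⇒-x≈0 2pq+b≈0) ⟩
              b + 0#
                ≈⟨ +-identityʳ b ⟩
              b ∎))
        ]′ (x*y≈0⇒x≈0∨y≈0 {2# * (p * q) - b} {2# * (p * q) + b} (begin
            (2# * (p * q) - b) * (2# * (p * q) + b)
              ≈⟨ solve 2 (λ x b → (x :- b) :* (x :+ b) := x :* x :- b :* b) refl (2# * (p * q)) b ⟩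
            (2# * (p * q)) * (2# * (p * q)) - b * b
              ≈⟨ +-congʳ ⟨2pq⟩²≈b² ⟩
            b * b - b * b
              ≈⟨ -‿inverseʳ (b * b) ⟩
            0# ∎))

    abstract
      complex-sqrt : ∀ a b → ∃[ p ] ∃[ q ] (p * p + - (q * q) ≈ a × p * q + q * p ≈ b)
      complex-sqrt a b = adjust-sign a b
        (Root-resp {b = b} (solve 2 (λ a c → con ½ :* (c :+ a) :- con ½ :* (c :- a) := a) refl a c)
          -- The half-angle formulas: with c² = a² + b², the numbers u = (c + a)/2 and v = (c - a)/2
          -- satisfy u - v = a and 4uv = c² - a² = b². Either root c serves.
          (root (½# * (c + a)) (½# * (c - a)) b (begin
            (2# * 2#) * ((½# * (c + a)) * (½# * (c - a)))
              ≈⟨ solve 2 (λ a c → (con (1ℚ ℚ.+ 1ℚ) :* con (1ℚ ℚ.+ 1ℚ)) :* ((con ½ :* (c :+ a)) :* (con ½ :* (c :- a))) :=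
                   c :* c :- a :* a) refl a c ⟩
            c * c - a * a
              ≈⟨ +-congʳ (proj₂ (√⟨x²+y²⟩ a b)) ⟩
            (a * a + b * b) - a * a
              ≈⟨ solve 2 (λ a b → (a :* a :+ b :* b) :- a :* a := b :* b) refl a b ⟩
            b * b ∎)))
        where
        c : Carrier
        c = proj₁ (√⟨x²+y²⟩ a b)

0≤p² : ∀ p → 0ℚ ℚ.≤ p ℚ.* p
0≤p² p = ≡.subst (0ℚ ℚ.≤_) (∣p∣*∣p∣≡p*p p) (0≤p*q {∣ p ∣} {∣ p ∣} (ℚₚ.0≤∣p∣ p) (ℚₚ.0≤∣p∣ p))

-- The field of complex numbers and its square roots

module Complex (em : ExcludedMiddle 0ℓ) where

  ℝ-field : ℚ-Field
  ℝ-field = record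
    { commutativeRing = ℝ-commutativeRing
    ; ℚ-homomorphism = record
      { ⟦_⟧ = fromℚ
      ; +-homo = λ p q → ≈ℝ-refl {fromℚ (p ℚ.+ q)}
      ; *-homo = λ p q → ≈ℝ-refl {fromℚ (p ℚ.* q)}
      ; -‿homo = λ p → ≈ℝ-refl {fromℚ (ℚ.- p)}
      ; 0-homo = ≈ℝ-refl {fromℚ 0ℚ}
      ; 1-homo = ≈ℝ-refl {fromℚ 1ℚ}
      }
    ; 1≉0 = λ 1≈0 → let N , h = 1≈0 ½ (ℚₚ.positive⁻¹ ½) in
        ℚₚ.<-asym (h N (ℕₚ.≤-refl)) (ℚ.*<* (ℤ.+<+ (ℕ.s≤s (ℕ.s≤s ℕ.z≤n))))
    ; invertible = ℝ-inverse em
    ; _≈0? = λ _ → em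
    }

  module ℝ-Properties = FieldProperties ℝ-field

  -- The identity (∣x∣ - x)(∣x∣ + x) = 0 holds term by term, so in the field ∣x∣ is x or -x, and the
  -- root of ∣x∣ is a root of one of these.
  ℝ-√± : ∀ x → ∃[ s ] ((s *ℝ s) ≈ℝ x ⊎ (s *ℝ s) ≈ℝ (-ℝ x))
  ℝ-√± x = √∣x∣ ,
    [ (λ h → inj₁ (≈ℝ-trans {√∣x∣ *ℝ √∣x∣} {absℝ x} {x} √∣x∣-square (ℝ-Properties.x-y≈0⇒x≈y {absℝ x} {x} h)))
    , (λ h → inj₂ (≈ℝ-trans {√∣x∣ *ℝ √∣x∣} {absℝ x} { -ℝ x} √∣x∣-square
        (null-≗ {λ n → (∣ seq x n ∣ ℚ.+ seq x n) ℚ.- 0ℚ} {λ n → ∣ seq x n ∣ ℚ.- (ℚ.- seq x n)}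
          (λ n → solve 2 (λ a x → a :- (:- x) := (a :+ x) :- con 0ℚ) ≡.refl ∣ seq x n ∣ (seq x n)) h)))
    ]′ (ℝ-Properties.x*y≈0⇒x≈0∨y≈0 {absℝ x +ℝ (-ℝ x)} {absℝ x +ℝ x}
      (≗⇒≈ℝ {(absℝ x +ℝ (-ℝ x)) *ℝ (absℝ x +ℝ x)} {fromℚ 0ℚ} λ n → ≡.trans
        (solve 2 (λ a x → (a :- x) :* (a :+ x) := a :* a :- x :* x) ≡.refl ∣ seq x n ∣ (seq x n))
        (≡.trans (cong (ℚ._- seq x n ℚ.* seq x n) (∣p∣*∣p∣≡p*p (seq x n))) (ℚₚ.+-inverseʳ (seq x n ℚ.* seq x n)))))
    where
    open AbsSqrt x
    open +-*-Solver

  ℝ-√⟨x²+y²⟩ : ∀ x y → ∃[ s ] (s *ℝ s) ≈ℝ ((x *ℝ x) +ℝ (y *ℝ y))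
  ℝ-√⟨x²+y²⟩ x y = √∣x∣ , ≈ℝ-trans {√∣x∣ *ℝ √∣x∣} {absℝ z} {z} √∣x∣-square
    (≗⇒≈ℝ {absℝ z} {z} λ n → ℚₚ.0≤p⇒∣p∣≡p (ℚₚ.+-mono-≤ (0≤p² (seq x n)) (0≤p² (seq y n))))
    where
    z = (x *ℝ x) +ℝ (y *ℝ y)
    open AbsSqrt z

  -- Term by term 0 ≤ x² ≤ x² + y², so x² is null along with the sum.
  ℝ-x²+y²≈0⇒x≈0 : ∀ x y → ((x *ℝ x) +ℝ (y *ℝ y)) ≈ℝ fromℚ 0ℚ → x ≈ℝ fromℚ 0ℚ
  ℝ-x²+y²≈0⇒x≈0 x y h = ℝ-Properties.x²≈0⇒x≈0 {x} (null-dominated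
    {λ n → (seq x n ℚ.* seq x n ℚ.+ seq y n ℚ.* seq y n) ℚ.- 0ℚ} {λ n → seq x n ℚ.* seq x n ℚ.- 0ℚ} 0
    (λ n _ → bound (0≤p² (seq x n)) (0≤p² (seq y n))) h)
    where
    bound : ∀ {a b} → 0ℚ ℚ.≤ a → 0ℚ ℚ.≤ b → ∣ a ℚ.- 0ℚ ∣ ℚ.≤ ∣ (a ℚ.+ b) ℚ.- 0ℚ ∣
    bound {a} {b} 0≤a 0≤b = begin
      ∣ a ℚ.- 0ℚ ∣         ≡⟨ cong ∣_∣ (ℚₚ.+-identityʳ a) ⟩
      ∣ a ∣                ≡⟨ ℚₚ.0≤p⇒∣p∣≡p 0≤a ⟩
      a                    ≡⟨ ℚₚ.+-identityʳ a ⟨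
      a ℚ.+ 0ℚ             ≤⟨ ℚₚ.+-monoʳ-≤ a 0≤b ⟩
      a ℚ.+ b              ≡⟨ ℚₚ.+-identityʳ (a ℚ.+ b) ⟨
      (a ℚ.+ b) ℚ.- 0ℚ     ≤⟨ ≤-∣∣ ((a ℚ.+ b) ℚ.- 0ℚ) ⟩
      ∣ (a ℚ.+ b) ℚ.- 0ℚ ∣ ∎
      where open ℚₚ.≤-Reasoning

  module ℝ-Complex = FormallyReal ℝ-field

  private
    module C = RawRing ℂ-rawRing

    ≗⇒≈ : ∀ z w → (∀ n → seq (re z) n ≡ seq (re w) n) → (∀ n → seq (im z) n ≡ seq (im w) n) → z C.≈ w
    ≗⇒≈ z w eq eq′ = ≗⇒≈ℝ {re z} {re w} eq , ≗⇒≈ℝ {im z} {im w} eq′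

    abstract
      *-assoc : ∀ x y z → (x C.* y) C.* z C.≈ x C.* (y C.* z)
      *-assoc x y z = ≗⇒≈ ((x C.* y) C.* z) (x C.* (y C.* z))
        (λ n → solve 6 (λ a b c d e f →
          (a :* c :+ :- (b :* d)) :* e :+ :- ((a :* d :+ b :* c) :* f) :=
          a :* (c :* e :+ :- (d :* f)) :+ :- (b :* (c :* f :+ d :* e))) ≡.refl
          (seq (re x) n) (seq (im x) n) (seq (re y) n) (seq (im y) n) (seq (re z) n) (seq (im z) n))
        (λ n → solve 6 (λ a b c d e f →
          (a :* c :+ :- (b :* d)) :* f :+ (a :* d :+ b :* c) :* e :=
          a :* (c :* f :+ d :* e) :+ b :* (c :* e :+ :- (d :* f))) ≡.refl
          (seq (re x) n) (seq (im x) n) (seq (re y) n) (seq (im y) n) (seq (re z) n) (seq (im z) n))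
        where open +-*-Solver

      *-comm : ∀ x y → x C.* y C.≈ y C.* x
      *-comm x y = ≗⇒≈ (x C.* y) (y C.* x)
        (λ n → solve 4 (λ a b c d → a :* c :+ :- (b :* d) := c :* a :+ :- (d :* b)) ≡.refl
          (seq (re x) n) (seq (im x) n) (seq (re y) n) (seq (im y) n))
        (λ n → solve 4 (λ a b c d → a :* d :+ b :* c := c :* b :+ d :* a) ≡.refl
          (seq (re x) n) (seq (im x) n) (seq (re y) n) (seq (im y) n))
        where open +-*-Solver

      *-identityˡ : ∀ x → C.1# C.* x C.≈ x
      *-identityˡ x = ≗⇒≈ (C.1# C.* x) x
        (λ n → solve 2 (λ a b → con 1ℚ :* a :+ :- (con 0ℚ :* b) := a) ≡.refl (seq (re x) n) (seq (im x) n))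
        (λ n → solve 2 (λ a b → con 1ℚ :* b :+ con 0ℚ :* a := b) ≡.refl (seq (re x) n) (seq (im x) n))
        where open +-*-Solver

      *-distribˡ-+ : ∀ x y z → x C.* (y C.+ z) C.≈ x C.* y C.+ x C.* z
      *-distribˡ-+ x y z = ≗⇒≈ (x C.* (y C.+ z)) (x C.* y C.+ x C.* z)
        (λ n → solve 6 (λ a b c d e f → a :* (c :+ e) :+ :- (b :* (d :+ f)) :=
          (a :* c :+ :- (b :* d)) :+ (a :* e :+ :- (b :* f))) ≡.refl
          (seq (re x) n) (seq (im x) n) (seq (re y) n) (seq (im y) n) (seq (re z) n) (seq (im z) n))
        (λ n → solve 6 (λ a b c d e f → a :* (d :+ f) :+ b :* (c :+ e) :=
          (a :* d :+ b :* c) :+ (a :* f :+ b :* e)) ≡.refl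
          (seq (re x) n) (seq (im x) n) (seq (re y) n) (seq (im y) n) (seq (re z) n) (seq (im z) n))
        where open +-*-Solver

    *-cong : ∀ x y z w → x C.≈ y → z C.≈ w → x C.* z C.≈ y C.* w
    *-cong x y z w (p , p′) (q , q′) =
        +ℝ-cong {re x *ℝ re z} {re y *ℝ re w} { -ℝ (im x *ℝ im z)} { -ℝ (im y *ℝ im w)}
          (*ℝ-cong {re x} {re y} {re z} {re w} p q)
          (-ℝ-cong {im x *ℝ im z} {im y *ℝ im w} (*ℝ-cong {im x} {im y} {im z} {im w} p′ q′))
      , +ℝ-cong {re x *ℝ im z} {re y *ℝ im w} {im x *ℝ re z} {im y *ℝ re w}
          (*ℝ-cong {re x} {re y} {im z} {im w} p q′)
          (*ℝ-cong {im x} {im y} {re z} {re w} p′ q)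

    isEquivalence : IsEquivalence C._≈_
    isEquivalence = record
      { refl = λ {x} → ≈ℝ-refl {re x} , ≈ℝ-refl {im x}
      ; sym = λ {x} {y} (p , q) → ≈ℝ-sym {re x} {re y} p , ≈ℝ-sym {im x} {im y} q
      ; trans = λ {x} {y} {z} (p , q) (p′ , q′) →
          ≈ℝ-trans {re x} {re y} {re z} p p′ , ≈ℝ-trans {im x} {im y} {im z} q q′
      }

    ≈-trans : ∀ x y z → x C.≈ y → y C.≈ z → x C.≈ z
    ≈-trans x y z p q = IsEquivalence.trans isEquivalence {x} {y} {z} p q

    +-cong : ∀ x y z w → x C.≈ y → z C.≈ w → x C.+ z C.≈ y C.+ w
    +-cong x y z w (p , p′) (q , q′) =
      +ℝ-cong {re x} {re y} {re z} {re w} p q , +ℝ-cong {im x} {im y} {im z} {im w} p′ q′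

    *-identityʳ : ∀ x → x C.* C.1# C.≈ x
    *-identityʳ x = ≈-trans (x C.* C.1#) (C.1# C.* x) x (*-comm x C.1#) (*-identityˡ x)

    *-distribʳ-+ : ∀ x y z → (y C.+ z) C.* x C.≈ y C.* x C.+ z C.* x
    *-distribʳ-+ x y z = ≈-trans ((y C.+ z) C.* x) (x C.* (y C.+ z)) (y C.* x C.+ z C.* x)
      (*-comm (y C.+ z) x)
      (≈-trans (x C.* (y C.+ z)) (x C.* y C.+ x C.* z) (y C.* x C.+ z C.* x)
        (*-distribˡ-+ x y z) (+-cong (x C.* y) (y C.* x) (x C.* z) (z C.* x) (*-comm x y) (*-comm x z)))

  ℂ-commutativeRing : CommutativeRing 0ℓ 0ℓ
  ℂ-commutativeRing = record
    { Carrier = C.Carrier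
    ; _≈_ = C._≈_
    ; _+_ = C._+_
    ; _*_ = C._*_
    ; -_ = C.-_
    ; 0# = C.0#
    ; 1# = C.1#
    ; isCommutativeRing = record
      { isRing = record
        { +-isAbelianGroup = record
          { isGroup = record
            { isMonoid = record
              { isSemigroup = record
                { isMagma = record
                  { isEquivalence = isEquivalence
                  ; ∙-cong = λ {x} {y} {z} {w} → +-cong x y z w
                  }
                ; assoc = λ x y z → ≗⇒≈ ((x C.+ y) C.+ z) (x C.+ (y C.+ z))
                    (λ n → ℚₚ.+-assoc (seq (re x) n) (seq (re y) n) (seq (re z) n))
                    (λ n → ℚₚ.+-assoc (seq (im x) n) (seq (im y) n) (seq (im z) n))
                }
              ; identity = (λ x → ≗⇒≈ (C.0# C.+ x) x
                    (λ n → ℚₚ.+-identityˡ (seq (re x) n)) (λ n → ℚₚ.+-identityˡ (seq (im x) n)))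
                , (λ x → ≗⇒≈ (x C.+ C.0#) x
                    (λ n → ℚₚ.+-identityʳ (seq (re x) n)) (λ n → ℚₚ.+-identityʳ (seq (im x) n)))
              }
            ; inverse = (λ x → ≗⇒≈ ((C.- x) C.+ x) C.0#
                  (λ n → ℚₚ.+-inverseˡ (seq (re x) n)) (λ n → ℚₚ.+-inverseˡ (seq (im x) n)))
              , (λ x → ≗⇒≈ (x C.+ (C.- x)) C.0#
                  (λ n → ℚₚ.+-inverseʳ (seq (re x) n)) (λ n → ℚₚ.+-inverseʳ (seq (im x) n)))
            ; ⁻¹-cong = λ {x} {y} (p , q) → -ℝ-cong {re x} {re y} p , -ℝ-cong {im x} {im y} q
            }
          ; comm = λ x y → ≗⇒≈ (x C.+ y) (y C.+ x)
              (λ n → ℚₚ.+-comm (seq (re x) n) (seq (re y) n)) (λ n → ℚₚ.+-comm (seq (im x) n) (seq (im y) n))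
          }
        ; *-cong = λ {x} {y} {z} {w} → *-cong x y z w
        ; *-assoc = *-assoc
        ; *-identity = *-identityˡ , *-identityʳ
        ; distrib = *-distribˡ-+ , *-distribʳ-+
        }
      ; *-comm = *-comm
      }
    }

  private
    toℂ : ℚ → ℂ
    toℂ q = fromℚ q +i fromℚ 0ℚ

  ℂ-field : ℚ-Field
  ℂ-field = record
    { commutativeRing = ℂ-commutativeRing
    ; ℚ-homomorphism = record
      { ⟦_⟧ = toℂ
      ; +-homo = λ p q → ≗⇒≈ (toℂ (p ℚ.+ q)) (toℂ p C.+ toℂ q) (λ _ → ≡.refl) (λ _ → ≡.refl)
      ; *-homo = λ p q → ≗⇒≈ (toℂ (p ℚ.* q)) (toℂ p C.* toℂ q)
          (λ _ → solve 2 (λ p q → p :* q := p :* q :+ :- (con 0ℚ :* con 0ℚ)) ≡.refl p q)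
          (λ _ → solve 2 (λ p q → con 0ℚ := p :* con 0ℚ :+ con 0ℚ :* q) ≡.refl p q)
      ; -‿homo = λ p → ≗⇒≈ (toℂ (ℚ.- p)) (C.- toℂ p) (λ _ → ≡.refl) (λ _ → ≡.refl)
      ; 0-homo = ≗⇒≈ C.0# C.0# (λ _ → ≡.refl) (λ _ → ≡.refl)
      ; 1-homo = ≗⇒≈ C.1# C.1# (λ _ → ≡.refl) (λ _ → ≡.refl)
      }
    ; 1≉0 = λ 1≈0 → ℚ-Field.1≉0 ℝ-field (proj₁ 1≈0)
    ; invertible = λ z z≉0 → let p , q , h = ℝ-Complex.complex-inverse ℝ-x²+y²≈0⇒x≈0 ℝ-√± ℝ-√⟨x²+y²⟩ (re z) (im z) z≉0 in p +i q , h
    ; _≈0? = λ _ → em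
    }
    where open +-*-Solver

  ℂ-sqrt : ∀ z → ∃[ s ] s C.* s C.≈ z
  ℂ-sqrt z = let p , q , h = ℝ-Complex.complex-sqrt ℝ-x²+y²≈0⇒x≈0 ℝ-√± ℝ-√⟨x²+y²⟩ (re z) (im z) in p +i q , h

-- Independence, linear maps and eigenvectors over a field of characteristic zero

module LinearAlgebraProperties (K : ℚ-Field) (em : ExcludedMiddle 0ℓ) where
  open FieldProperties K hiding (zero)
  open LinearAlgebra rawRing
  open Algebra.Properties.Semiring.Sum semiring

  fromℚ-injective : ∀ p q → fromℚ′ p ≈ fromℚ′ q → p ≡ q
  fromℚ-injective p q h = decidable-stable (p ℚₚ.≟ q) λ p≢q →
    fromℚ-nonZero {p ℚ.- q} (λ p-q≡0 → p≢q (p-q≡0⇒p≡q p-q≡0))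
      (trans (fromℚ-+ p (ℚ.- q)) (trans (+-congˡ (fromℚ-neg q)) (x≈y⇒x-y≈0 h)))
    where
    p-q≡0⇒p≡q : p ℚ.- q ≡ 0ℚ → p ≡ q
    p-q≡0⇒p≡q e = ≡.trans (≡.sym (ℚₚ.+-identityʳ p)) (≡.trans (cong (p ℚ.+_) (≡.sym (ℚₚ.+-inverseˡ q)))
      (≡.trans (≡.sym (ℚₚ.+-assoc p (ℚ.- q) q)) (≡.trans (cong (ℚ._+ q) e) (ℚₚ.+-identityˡ q))))

  -- The m + 1 images of 0, ..., m are distinct in characteristic zero. If each of them were one of
  -- the m given values, two would be equal.
  avoid : ∀ {m} (f : Vector Carrier m) → ∃[ x ] ∀ t → ¬ x ≈ f t
  avoid {m} f with em {∃[ x ] ∀ t → ¬ x ≈ f t}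
  ... | yes p = p
  ... | no ¬p = contradiction (Finₚ.pigeonhole (ℕₚ.n<1+n m) (proj₁ ∘ hit)) λ (i , j , i<j , eq) →
    ℕₚ.<⇒≢ i<j (cong (ℤ→ℕ ∘ ℚ.numerator) (fromℚ-injective (n i) (n j)
      (trans (proj₂ (hit i)) (trans (reflexive (cong f eq)) (sym (proj₂ (hit j)))))))
    where
    n : Fin (suc m) → ℚ
    n i = ℕ→ℚ (Fin.toℕ i)
    ℤ→ℕ = ℤ.∣_∣
    hit : ∀ i → ∃[ t ] fromℚ′ (n i) ≈ f t
    hit i = decidable-stable em λ ¬hit → ¬p (fromℚ′ (n i) , λ t eq → ¬hit (t , eq))

  sum-0 : ∀ {n} {f : Vector Carrier n} → (∀ i → f i ≈ 0#) → sum f ≈ 0#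
  sum-0 {n} h = trans (sum-cong-≋ h) (sum-replicate-zero n)

  sum-1ᴹ : ∀ {n} (x : Vector Carrier n) i → sum (λ j → x j * 1ᴹ j i) ≈ x i
  sum-1ᴹ x zero = trans (+-cong (*-identityʳ _) (sum-0 λ j → zeroʳ (x (suc j)))) (+-identityʳ _)
  sum-1ᴹ x (suc i) = trans (+-cong (zeroʳ _) (sum-1ᴹ (x ∘ suc) i)) (+-identityˡ _)

  1ᴹ-sym : ∀ {n} (s t : Fin n) → 1ᴹ s t ≡ 1ᴹ t s
  1ᴹ-sym zero zero = ≡.refl
  1ᴹ-sym zero (suc t) = ≡.refl
  1ᴹ-sym (suc s) zero = ≡.refl
  1ᴹ-sym (suc s) (suc t) = 1ᴹ-sym s t

  module _ {I : Set} where

    infix 4 _≈ᵛ_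
    _≈ᵛ_ : (u v : I → Carrier) → Set
    u ≈ᵛ v = ∀ i → u i ≈ v i

    combination : ∀ {k} → Vector Carrier k → Vector (I → Carrier) k → I → Carrier
    combination a b i = sum λ t → a t * b t i

    combination-assoc : ∀ {k m} (x : Vector Carrier k) (a : Fin k → Vector Carrier m) (c : Vector (I → Carrier) m) →
      combination x (λ t → combination (a t) c) ≈ᵛ combination (λ j → sum λ t → x t * a t j) c
    combination-assoc x a c i = begin
      sum (λ t → x t * sum λ j → a t j * c j i)
        ≈⟨ sum-cong-≋ (λ t → *-distribˡ-sum (x t) λ j → a t j * c j i) ⟩
      sum (λ t → sum λ j → x t * (a t j * c j i))
        ≈⟨ ∑-comm (λ t j → x t * (a t j * c j i)) ⟩
      sum (λ j → sum λ t → x t * (a t j * c j i))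
        ≈⟨ sum-cong-≋ (λ j → sum-cong-≋ λ t → sym (*-assoc (x t) (a t j) (c j i))) ⟩
      sum (λ j → sum λ t → x t * a t j * c j i)
        ≈⟨ sum-cong-≋ (λ j → *-distribʳ-sum (c j i) λ t → x t * a t j) ⟨
      sum (λ j → sum (λ t → x t * a t j) * c j i) ∎

    -- Subspaces are predicates so that "v is a sum of eigenvectors" can be phrased as "v lies in
    -- every subspace containing the eigenvectors". Decompositions are then inductions on
    -- membership, with no families of summands to carry along.
    record Subspace : Set₁ where
      infix 4 _∈
      field
        _∈ : (I → Carrier) → Set
        ∈-resp : ∀ {u v} → u ≈ᵛ v → u ∈ → v ∈
        0∈ : (λ _ → 0#) ∈
        +∈ : ∀ {u v} → u ∈ → v ∈ → (λ i → u i + v i) ∈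
        *∈ : ∀ {u} x → u ∈ → (λ i → x * u i) ∈

      combination∈ : ∀ {k} a (b : Vector (I → Carrier) k) → (∀ t → b t ∈) → combination a b ∈
      combination∈ {zero} a b b∈ = 0∈
      combination∈ {suc k} a b b∈ = +∈ (*∈ (a zero) (b∈ zero)) (combination∈ (a ∘ suc) (b ∘ suc) (b∈ ∘ suc))

    span : ∀ {k} → Vector (I → Carrier) k → Subspace
    span b = record
      { _∈ = _∈Span b
      ; ∈-resp = λ u≈v (a , h) → a , λ i → trans (sym (u≈v i)) (h i)
      ; 0∈ = (λ _ → 0#) , λ i → sym (sum-0 λ t → zeroˡ (b t i))
      ; +∈ = λ (a , h) (a′ , h′) → (λ t → a t + a′ t) , λ i → trans (+-cong (h i) (h′ i))
          (trans (sym (∑-distrib-+ (λ t → a t * b t i) (λ t → a′ t * b t i)))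
            (sum-cong-≋ λ t → sym (distribʳ (b t i) (a t) (a′ t))))
      ; *∈ = λ x (a , h) → (λ t → x * a t) , λ i → trans (*-congˡ (h i))
          (trans (*-distribˡ-sum x λ t → a t * b t i) (sum-cong-≋ λ t → sym (*-assoc x (a t) (b t i))))
      }

    ∈span : ∀ {k} (b : Vector (I → Carrier) k) t → b t ∈Span b
    ∈span b t = 1ᴹ t , λ i → sym (trans (sum-cong-≋ λ s → *-comm (1ᴹ t s) (b s i))
      (trans (sum-cong-≋ λ s → *-congˡ {b s i} (reflexive (1ᴹ-sym t s))) (sum-1ᴹ (λ s → b s i) t)))

    span-minimal : ∀ {k} {b : Vector (I → Carrier) k} (X : Subspace) → (∀ t → Subspace._∈ X (b t)) →
      ∀ {v} → v ∈Span b → Subspace._∈ X v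
    span-minimal {b = b} X b∈X (a , h) = Subspace.∈-resp X (λ i → sym (h i)) (Subspace.combination∈ X a b b∈X)

    independent-∷ : ∀ {k} {b : Vector (I → Carrier) k} {v} → LinearlyIndependent b → ¬ v ∈Span b →
      LinearlyIndependent (v Vec.∷ b)
    independent-∷ {k} {b} {v} ind v∉ a h with a zero ≈0?
    ... | no a₀≉0 = let y , a₀y≈1 = invertible (a zero) a₀≉0 in contradiction
      ((λ t → - y * a (suc t)) , λ i → begin
        v i
          ≈⟨ *-identityˡ (v i) ⟨
        1# * v i
          ≈⟨ *-congʳ a₀y≈1 ⟨
        a zero * y * v i
          ≈⟨ solve 4 (λ a y v s → a :* y :* v := y :* (a :* v :+ s) :+ (:- y) :* s) refl
               (a zero) y (v i) (combination (a ∘ suc) b i) ⟩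
        y * (a zero * v i + combination (a ∘ suc) b i) + - y * combination (a ∘ suc) b i
          ≈⟨ +-congʳ (trans (*-congˡ (h i)) (zeroʳ y)) ⟩
        0# + - y * combination (a ∘ suc) b i
          ≈⟨ +-identityˡ _ ⟩
        - y * combination (a ∘ suc) b i
          ≈⟨ *-distribˡ-sum (- y) (λ t → a (suc t) * b t i) ⟩
        sum (λ t → - y * (a (suc t) * b t i))
          ≈⟨ sum-cong-≋ (λ t → *-assoc (- y) (a (suc t)) (b t i)) ⟨
        sum (λ t → - y * a (suc t) * b t i) ∎) v∉
    ... | yes a₀≈0 = λ where
      zero → a₀≈0
      (suc t) → ind (a ∘ suc) (λ i → begin
        combination (a ∘ suc) b i
          ≈⟨ +-identityˡ _ ⟨
        0# + combination (a ∘ suc) b i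
          ≈⟨ +-congʳ (trans (*-congʳ a₀≈0) (zeroˡ (v i))) ⟨
        a zero * v i + combination (a ∘ suc) b i
          ≈⟨ h i ⟩
        0# ∎) t

  -- Linear dependence and dimension

  Dependency : ∀ {k m} → (Fin k → Vector Carrier m) → Set
  Dependency {k} a = Σ (Vector Carrier k) λ x → (∃[ t ] ¬ x t ≈ 0#) × (∀ j → sum (λ t → x t * a t j) ≈ 0#)

  -- Gaussian elimination on the rows of `a`. With a pivot in row zero, its column is cleared from
  -- the other rows and dropped. A relation among the reduced rows lifts by giving row zero the
  -- coefficient that cancels the pivot column.
  dependency : ∀ {k m} → m ℕ.< k → (a : Fin k → Vector Carrier m) → Dependency a
  dependency {suc k} {zero} m<k a = (λ _ → 1#) , (zero , 1≉0) , λ ()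
  dependency {suc k} {suc m} (ℕ.s≤s m<k) a with em {∃[ j ] ¬ a zero j ≈ 0#}
  ... | no ¬p = 1ᴹ zero , (zero , 1≉0) , λ j → trans
    (+-cong (trans (*-identityˡ (a zero j)) (decidable-stable (a zero j ≈0?) λ h → ¬p (j , h)))
      (sum-0 λ t → zeroˡ (a (suc t) j))) (+-identityˡ 0#)
  ... | yes (j₀ , a₀≉0) with invertible (a zero j₀) a₀≉0
  ... | y , a₀y≈1 with dependency m<k (λ t j → a (suc t) (punchIn j₀ j) - a (suc t) j₀ * y * a zero (punchIn j₀ j))
  ... | x , (t , xt≉0) , h = x′ , (suc t , xt≉0) , relation
    where
    s : Carrier
    s = sum λ t → x t * a (suc t) j₀
    x′ : Vector Carrier (suc k)
    x′ = (- (s * y)) Vec.∷ x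
    relation : ∀ j → sum (λ t → x′ t * a t j) ≈ 0#
    relation j with j Finₚ.≟ j₀
    ... | yes ≡.refl = begin
      - (s * y) * a zero j₀ + s
        ≈⟨ solve 3 (λ s y a → :- (s :* y) :* a :+ s := :- (s :* (a :* y)) :+ s) refl s y (a zero j₀) ⟩
      - (s * (a zero j₀ * y)) + s
        ≈⟨ +-congʳ (-‿cong (trans (*-congˡ a₀y≈1) (*-identityʳ s))) ⟩
      - s + s
        ≈⟨ -‿inverseˡ s ⟩
      0# ∎
    ... | no j≢j₀ = ≡.subst (λ j → sum (λ t → x′ t * a t j) ≈ 0#) (Finₚ.punchIn-punchOut (j≢j₀ ∘ ≡.sym)) (begin
      - (s * y) * a₀ + sum (λ t → x t * a (suc t) j′)
        ≈⟨ solve 4 (λ s y a r → :- (s :* y) :* a :+ r := r :+ s :* :- (y :* a)) refl s y a₀ (sum λ t → x t * a (suc t) j′) ⟩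
      sum (λ t → x t * a (suc t) j′) + s * - (y * a₀)
        ≈⟨ +-congˡ (*-distribʳ-sum (- (y * a₀)) λ t → x t * a (suc t) j₀) ⟩
      sum (λ t → x t * a (suc t) j′) + sum (λ t → x t * a (suc t) j₀ * - (y * a₀))
        ≈⟨ ∑-distrib-+ (λ t → x t * a (suc t) j′) (λ t → x t * a (suc t) j₀ * - (y * a₀)) ⟨
      sum (λ t → x t * a (suc t) j′ + x t * a (suc t) j₀ * - (y * a₀))
        ≈⟨ sum-cong-≋ (λ t → solve 5 (λ x b c y a → x :* b :+ x :* c :* :- (y :* a) := x :* (b :- c :* y :* a)) refl
             (x t) (a (suc t) j′) (a (suc t) j₀) y a₀) ⟩
      sum (λ t → x t * (a (suc t) j′ - a (suc t) j₀ * y * a₀))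
        ≈⟨ h (punchOut (j≢j₀ ∘ ≡.sym)) ⟩
      0# ∎)
      where
      j′ = punchIn j₀ (punchOut (j≢j₀ ∘ ≡.sym))
      a₀ = a zero j′

  -- With k > m the coordinate rows of the `b t` with respect to `c` would be dependent, and the
  -- same coefficients would relate the `b t`.
  independent⇒≤ : ∀ {I : Set} {k m} {b : Vector (I → Carrier) k} {c : Vector (I → Carrier) m} →
    LinearlyIndependent b → (∀ t → b t ∈Span c) → k ℕ.≤ m
  independent⇒≤ {k = k} {m} {b} {c} ind b∈ = ℕₚ.≮⇒≥ (no-dependency ∘ λ m<k → dependency m<k a)
    where
    a : Fin k → Vector Carrier m
    a = proj₁ ∘ b∈
    no-dependency : ¬ Dependency a
    no-dependency (x , (t , xt≉0) , h) = xt≉0 (ind x (λ i → begin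
      sum (λ t → x t * b t i)
        ≈⟨ sum-cong-≋ (λ t → *-congˡ (proj₂ (b∈ t) i)) ⟩
      combination x (λ t → combination (a t) c) i
        ≈⟨ combination-assoc x a c i ⟩
      sum (λ j → sum (λ t → x t * a t j) * c j i)
        ≈⟨ sum-0 (λ j → trans (*-congʳ (h j)) (zeroˡ (c j i))) ⟩
      0# ∎) t)

  -- `P` is any predicate, closed under nothing. The family therefore consists of vectors that
  -- satisfy it, such as eigenvectors, while spanning all such vectors.
  maximalIndependent : ∀ {n} (P : (Fin n → Carrier) → Set) →
    ∃[ k ] Σ (Vector (Fin n → Carrier) k) λ b →
      LinearlyIndependent b × (∀ t → P (b t)) × (∀ {v} → P v → v ∈Span b)
  maximalIndependent {n} P = extend (suc n) 0 (λ ()) (λ _ _ ()) (λ ()) (ℕₚ.+-identityʳ (suc n))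
    where
    extend : ∀ fuel k (b : Vector (Fin n → Carrier) k) → LinearlyIndependent b → (∀ t → P (b t)) →
      fuel ℕ.+ k ≡ suc n → ∃[ k ] Σ (Vector (Fin n → Carrier) k) λ b →
      LinearlyIndependent b × (∀ t → P (b t)) × (∀ {v} → P v → v ∈Span b)
    -- Fuel runs out only at k = n + 1, and n + 1 independent vectors do not fit into dimension n.
    extend zero k b ind Pb eq = contradiction
      (independent⇒≤ ind (λ t → b t , λ i → sym (sum-1ᴹ (b t) i))) (ℕₚ.<⇒≱ (ℕₚ.≤-reflexive (≡.sym eq)))
    extend (suc fuel) k b ind Pb eq with em {∃[ v ] P v × ¬ v ∈Span b}
    ... | yes (v , Pv , v∉) = extend fuel (suc k) (v Vec.∷ b) (independent-∷ ind v∉)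
      (λ { zero → Pv ; (suc t) → Pb t }) (≡.trans (ℕₚ.+-suc fuel k) eq)
    ... | no ¬p = k , b , ind , Pb , λ {v} Pv → decidable-stable em λ v∉ → ¬p (v , Pv , v∉)

  1ᴹ-diagonal : ∀ {n} → Diagonal (1ᴹ {n})
  1ᴹ-diagonal i j i≢j with i Finₚ.≟ j
  ... | yes i≡j = contradiction i≡j i≢j
  ... | no _ = refl

  independent-1ᴹ : ∀ {n} → LinearlyIndependent (1ᴹ {n})
  independent-1ᴹ a h t = trans (sym (sum-1ᴹ a t)) (h t)

  combination-unique : ∀ {I : Set} {k} {b : Vector (I → Carrier) k} → LinearlyIndependent b →
    ∀ {a a′} → combination a b ≈ᵛ combination a′ b → a ≈ᵛ a′
  combination-unique {b = b} ind {a} {a′} h t = x-y≈0⇒x≈y (ind (λ t → a t - a′ t) (λ i → begin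
    sum (λ t → (a t - a′ t) * b t i)
      ≈⟨ sum-cong-≋ (λ t → solve 3 (λ a a′ b → (a :- a′) :* b := a :* b :+ con (ℚ.- 1ℚ) :* (a′ :* b)) refl (a t) (a′ t) (b t i)) ⟩
    sum (λ t → a t * b t i + fromℚ′ (ℚ.- 1ℚ) * (a′ t * b t i))
      ≈⟨ ∑-distrib-+ (λ t → a t * b t i) (λ t → fromℚ′ (ℚ.- 1ℚ) * (a′ t * b t i)) ⟩
    combination a b i + sum (λ t → fromℚ′ (ℚ.- 1ℚ) * (a′ t * b t i))
      ≈⟨ +-cong (h i) (sym (*-distribˡ-sum (fromℚ′ (ℚ.- 1ℚ)) λ t → a′ t * b t i)) ⟩
    combination a′ b i + fromℚ′ (ℚ.- 1ℚ) * combination a′ b i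
      ≈⟨ solve 1 (λ s → s :+ con (ℚ.- 1ℚ) :* s := con 0ℚ) refl (combination a′ b i) ⟩
    fromℚ′ 0ℚ
      ≈⟨ fromℚ-0 ⟩
    0# ∎) t)

  -- Linear maps, the action of matrices, and column rank

  infix 4 _≈0ᵛ
  _≈0ᵛ : ∀ {I : Set} → (I → Carrier) → Set
  v ≈0ᵛ = ∀ i → v i ≈ 0#

  record Linear {I J : Set} (f : (I → Carrier) → J → Carrier) : Set where
    field
      f-cong : ∀ {u v} → u ≈ᵛ v → f u ≈ᵛ f v
      f-+ : ∀ u v → f (λ i → u i + v i) ≈ᵛ (λ j → f u j + f v j)
      f-* : ∀ x u → f (λ i → x * u i) ≈ᵛ (λ j → x * f u j)

    f-0 : ∀ {u} → u ≈0ᵛ → f u ≈0ᵛ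
    f-0 {u} u≈0 j = trans (f-cong (λ i → trans (u≈0 i) (sym (zeroˡ (u i)))) j)
      (trans (f-* 0# u j) (zeroˡ _))

    f-combination : ∀ {k} a (b : Vector (I → Carrier) k) → f (combination a b) ≈ᵛ combination a (f ∘ b)
    f-combination {zero} a b = f-0 λ _ → refl
    f-combination {suc k} a b j = trans (f-+ (λ i → a zero * b zero i) (combination (a ∘ suc) (b ∘ suc)) j)
      (+-cong (f-* (a zero) (b zero) j) (f-combination (a ∘ suc) (b ∘ suc) j))

  open Linear

  ∘-linear : ∀ {I J L : Set} {f : (I → Carrier) → J → Carrier} {g : (L → Carrier) → I → Carrier} →
    Linear f → Linear g → Linear (f ∘ g)
  ∘-linear lf lg = record
    { f-cong = f-cong lf ∘ f-cong lg
    ; f-+ = λ u v j → trans (f-cong lf (f-+ lg u v) j) (f-+ lf _ _ j)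
    ; f-* = λ x u j → trans (f-cong lf (f-* lg x u) j) (f-* lf x _ j)
    }

  infixr 8 _·_
  _·_ : ∀ {m n} → Matrix m n → Vector Carrier n → Vector Carrier m
  (A · x) i = sum λ j → A i j * x j

  ·-linear : ∀ {m n} (A : Matrix m n) → Linear (A ·_)
  ·-linear A = record
    { f-cong = λ u≈v i → sum-cong-≋ λ j → *-congˡ (u≈v j)
    ; f-+ = λ u v i → trans (sum-cong-≋ λ j → distribˡ (A i j) (u j) (v j))
        (∑-distrib-+ (λ j → A i j * u j) (λ j → A i j * v j))
    ; f-* = λ x u i → trans
        (sum-cong-≋ λ j → solve 3 (λ a x u → a :* (x :* u) := x :* (a :* u)) refl (A i j) x (u j))
        (sym (*-distribˡ-sum x λ j → A i j * u j))
    }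

  ·-assoc : ∀ {m n p} (A : Matrix m n) (B : Matrix n p) x → (A *ᴹ B) · x ≈ᵛ A · B · x
  -- A vector is read as a family of vectors indexed over `Fin 1`, which makes this a case of
  -- `combination-assoc`.
  ·-assoc A B x i = sym (combination-assoc (A i) B (λ k (_ : Fin 1) → x k) zero)

  ·-cong : ∀ {m n} {A B : Matrix m n} → A ≈ᴹ B → ∀ x → A · x ≈ᵛ B · x
  ·-cong A≈B x i = sum-cong-≋ λ j → *-congʳ (A≈B i j)

  ·-1ᴹ : ∀ {m n} (A : Matrix m n) j → A · 1ᴹ j ≈ᵛ (A ᵀ) j
  ·-1ᴹ A j i = trans (sum-cong-≋ λ k → *-congˡ (reflexive (1ᴹ-sym j k))) (sum-1ᴹ (A i) j)

  ∈Span-ᵀ⇒· : ∀ {m n} {A : Matrix m n} {v} → v ∈Span (A ᵀ) → ∃[ x ] v ≈ᵛ A · x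
  ∈Span-ᵀ⇒· {A = A} (x , h) = x , λ i → trans (h i) (sum-cong-≋ λ j → *-comm (x j) (A i j))

  ·⇒∈Span-ᵀ : ∀ {m n} {A : Matrix m n} {v} x → v ≈ᵛ A · x → v ∈Span (A ᵀ)
  ·⇒∈Span-ᵀ {A = A} x h = x , λ i → trans (h i) (sum-cong-≋ λ j → *-comm (A i j) (x j))

  rank-exists : ∀ {m n} (A : Matrix m n) → ∃[ ρ ] HasRank A ρ
  rank-exists A = let ρ , b , ind , b∈ , ∈b = maximalIndependent (_∈Span (A ᵀ)) in
    ρ , b , ind , λ v → mk⇔ (span-minimal (span (A ᵀ)) b∈) ∈b

  -- The hypothesis says that Aᵀ is injective on the column space of A. It maps that space onto the
  -- column space of AᵀA, so it carries a basis to a basis.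
  kernel-ᵀ*ᴹ⇒sameRank : ∀ {m n} (A : Matrix m n) →
    (∀ x → A ᵀ · A · x ≈0ᵛ → A · x ≈0ᵛ) → SameRank A (A ᵀ *ᴹ A)
  kernel-ᵀ*ᴹ⇒sameRank {m} {n} A ker with rank-exists A
  ... | ρ , b , ind , col = ρ , (b , ind , col) , c , ind-c , λ v → mk⇔ (to v) (from v)
    where
    c : Vector (Fin n → Carrier) ρ
    c t = A ᵀ · b t
    preimage : ∀ {v} → v ∈Span b → ∃[ x ] v ≈ᵛ A · x
    preimage {v} v∈ = ∈Span-ᵀ⇒· {A = A} (Equivalence.to (col v) v∈)
    ind-c : LinearlyIndependent c
    ind-c a h with preimage (a , λ _ → refl)
    ... | x , ab≈Ax = ind a λ i → trans (ab≈Ax i) (ker x (λ j → begin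
      (A ᵀ · A · x) j                 ≈⟨ f-cong (·-linear (A ᵀ)) ab≈Ax j ⟨
      (A ᵀ · combination a b) j       ≈⟨ f-combination (·-linear (A ᵀ)) a b j ⟩
      combination a c j               ≈⟨ h j ⟩
      0#                              ∎) i)
    to : ∀ v → v ∈Span c → v ∈Span ((A ᵀ *ᴹ A) ᵀ)
    to v (a , h) with preimage (a , λ _ → refl)
    ... | x , ab≈Ax = ·⇒∈Span-ᵀ {A = A ᵀ *ᴹ A} x λ j → begin
      v j                             ≈⟨ h j ⟩
      combination a c j               ≈⟨ f-combination (·-linear (A ᵀ)) a b j ⟨
      (A ᵀ · combination a b) j       ≈⟨ f-cong (·-linear (A ᵀ)) ab≈Ax j ⟩
      (A ᵀ · A · x) j                 ≈⟨ ·-assoc (A ᵀ) A x j ⟨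
      ((A ᵀ *ᴹ A) · x) j              ∎
    from : ∀ v → v ∈Span ((A ᵀ *ᴹ A) ᵀ) → v ∈Span c
    from v v∈ with ∈Span-ᵀ⇒· {A = A ᵀ *ᴹ A} v∈
    ... | x , h with Equivalence.from (col (A · x)) (·⇒∈Span-ᵀ {A = A} x λ _ → refl)
    ... | a , Ax≈ab = a , λ j → begin
      v j                             ≈⟨ h j ⟩
      ((A ᵀ *ᴹ A) · x) j              ≈⟨ ·-assoc (A ᵀ) A x j ⟩
      (A ᵀ · A · x) j                 ≈⟨ f-cong (·-linear (A ᵀ)) Ax≈ab j ⟩
      (A ᵀ · combination a b) j       ≈⟨ f-combination (·-linear (A ᵀ)) a b j ⟩
      combination a c j               ∎

  -- Writing a basis of the column space of AᵀA as AᵀA zₜ, the ρ + 1 vectors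
  -- A x, A zₜ would be independent in the column space of A if A x ≠ 0.
  sameRank⇒kernel-ᵀ*ᴹ : ∀ {m n} (A : Matrix m n) → SameRank A (A ᵀ *ᴹ A) →
    ∀ x → A ᵀ · A · x ≈0ᵛ → A · x ≈0ᵛ
  sameRank⇒kernel-ᵀ*ᴹ {m} {n} A (ρ , (b , ind-b , col-b) , (c , ind-c , col-c)) x AᵀAx≈0 =
    decidable-stable em λ Ax≉0 → ℕₚ.<-irrefl ≡.refl
      (independent⇒≤ {b = (A · x) Vec.∷ λ t → A · z t} (independent-∷ ind-Az (∉ Ax≉0)) λ where
        zero → ∈b x
        (suc t) → ∈b (z t))
    where
    z : Fin ρ → Vector Carrier n
    z t = proj₁ (∈Span-ᵀ⇒· {A = A ᵀ *ᴹ A} (Equivalence.to (col-c (c t)) (∈span c t)))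
    AᵀAz≈c : ∀ t → A ᵀ · A · z t ≈ᵛ c t
    AᵀAz≈c t j = trans (sym (·-assoc (A ᵀ) A (z t) j))
      (sym (proj₂ (∈Span-ᵀ⇒· {A = A ᵀ *ᴹ A} (Equivalence.to (col-c (c t)) (∈span c t))) j))
    Aᵀ-combination : ∀ a → A ᵀ · combination a (λ t → A · z t) ≈ᵛ combination a c
    Aᵀ-combination a j = trans (f-combination (·-linear (A ᵀ)) a (λ t → A · z t) j)
      (sum-cong-≋ λ t → *-congˡ (AᵀAz≈c t j))
    ind-Az : LinearlyIndependent (λ t → A · z t)
    ind-Az a h = ind-c a λ j → trans (sym (Aᵀ-combination a j)) (f-0 (·-linear (A ᵀ)) h j)
    ∉ : ¬ (A · x ≈0ᵛ) → ¬ (A · x) ∈Span (λ t → A · z t)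
    ∉ Ax≉0 (a , h) = Ax≉0 λ i → trans (h i) (sum-0 λ t → trans
      (*-congʳ (ind-c a (λ j → trans (sym (Aᵀ-combination a j))
        (trans (f-cong (·-linear (A ᵀ)) (λ i → sym (h i)) j) (AᵀAx≈0 j))) t))
      (zeroˡ _))
    ∈b : ∀ y → (A · y) ∈Span b
    ∈b y = Equivalence.from (col-b (A · y)) (·⇒∈Span-ᵀ {A = A} y λ _ → refl)

  -- Eigenvectors, diagonalizability and joint splitting

  Eigenvector : ∀ {I : Set} → ((I → Carrier) → I → Carrier) → Carrier → (I → Carrier) → Set
  Eigenvector f α w = f w ≈ᵛ λ i → α * w i

  -- A maximal independent family of eigenvectors spans, hence has n members. They are the columns
  -- of `P`, and the coordinates of the standard basis are the columns of `P⁻¹`.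
  eigenvectorsSpan⇒diagonalizable : ∀ {n} (A : Matrix n n) →
    (∀ (X : Subspace) → (∀ {w α} → Eigenvector (A ·_) α w → Subspace._∈ X w) → ∀ v → Subspace._∈ X v) →
    Diagonalizable A
  eigenvectorsSpan⇒diagonalizable {n} A spanned
    with maximalIndependent (λ w → ∃[ α ] Eigenvector (A ·_) α w)
  ... | k , b , ind , eig , ∈b = diagonalize b ind eig ∈Spanb k≡n
    where
    ∈Spanb : ∀ v → v ∈Span b
    ∈Spanb = spanned (span b) λ {w} {α} h → ∈b (α , h)
    k≡n : k ≡ n
    k≡n = ℕₚ.≤-antisym (independent⇒≤ ind λ t → b t , λ i → sym (sum-1ᴹ (b t) i))
      (independent⇒≤ independent-1ᴹ λ t → ∈Spanb (1ᴹ t))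
    diagonalize : ∀ {k} (b : Vector (Fin n → Carrier) k) → LinearlyIndependent b →
      (∀ t → ∃[ α ] Eigenvector (A ·_) α (b t)) → (∀ v → v ∈Span b) → k ≡ n → Diagonalizable A
    diagonalize b ind eig ∈b ≡.refl = P , P⁻¹ , D , PP⁻¹≈1 , P⁻¹P≈1
      , (λ i j i≢j → trans (*-congˡ (1ᴹ-diagonal i j i≢j)) (zeroʳ _)) , A≈PDP⁻¹
      where
      P P⁻¹ D : Matrix n n
      P = b ᵀ
      P⁻¹ t j = proj₁ (∈b (1ᴹ j)) t
      D s t = proj₁ (eig s) * 1ᴹ s t
      1≈combination : ∀ j i → 1ᴹ j i ≈ combination (λ t → P⁻¹ t j) b i
      1≈combination j = proj₂ (∈b (1ᴹ j))
      PP⁻¹≈1 : P *ᴹ P⁻¹ ≈ᴹ 1ᴹ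
      PP⁻¹≈1 i j = begin
        sum (λ t → b t i * P⁻¹ t j)         ≈⟨ sum-cong-≋ (λ t → *-comm (b t i) (P⁻¹ t j)) ⟩
        combination (λ t → P⁻¹ t j) b i     ≈⟨ 1≈combination j i ⟨
        1ᴹ j i                              ≡⟨ 1ᴹ-sym j i ⟩
        1ᴹ i j                              ∎
      P⁻¹P≈1 : P⁻¹ *ᴹ P ≈ᴹ 1ᴹ
      P⁻¹P≈1 s j = combination-unique ind {λ s → (P⁻¹ *ᴹ P) s j} {λ s → 1ᴹ s j} (λ i → begin
        combination (λ s → sum λ t → P⁻¹ s t * b j t) b i
          ≈⟨ sum-cong-≋ (λ s → *-congʳ {b s i} (sum-cong-≋ λ t → *-comm (P⁻¹ s t) (b j t))) ⟩
        combination (λ s → sum λ t → b j t * P⁻¹ s t) b i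
          ≈⟨ combination-assoc (b j) (λ t s → P⁻¹ s t) b i ⟨
        combination (b j) (λ t → combination (λ s → P⁻¹ s t) b) i
          ≈⟨ sum-cong-≋ (λ t → *-congˡ (1≈combination t i)) ⟨
        combination (b j) 1ᴹ i
          ≈⟨ sum-1ᴹ (b j) i ⟩
        b j i
          ≈⟨ sum-1ᴹ (λ s → b s i) j ⟨
        sum (λ s → b s i * 1ᴹ s j)
          ≈⟨ sum-cong-≋ (λ s → *-comm (b s i) (1ᴹ s j)) ⟩
        combination (λ s → 1ᴹ s j) b i ∎) s
      A≈PDP⁻¹ : A ≈ᴹ (P *ᴹ D) *ᴹ P⁻¹
      A≈PDP⁻¹ i j = begin
        A i j
          ≈⟨ ·-1ᴹ A j i ⟨
        (A · 1ᴹ j) i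
          ≈⟨ f-cong (·-linear A) (1≈combination j) i ⟩
        (A · combination (λ t → P⁻¹ t j) b) i
          ≈⟨ f-combination (·-linear A) (λ t → P⁻¹ t j) b i ⟩
        combination (λ t → P⁻¹ t j) (λ t → A · b t) i
          ≈⟨ sum-cong-≋ (λ t → *-congˡ (proj₂ (eig t) i)) ⟩
        sum (λ t → P⁻¹ t j * (proj₁ (eig t) * b t i))
          ≈⟨ sum-cong-≋ (λ t → solve 3 (λ p α b → p :* (α :* b) := (b :* α) :* p) refl (P⁻¹ t j) (proj₁ (eig t)) (b t i)) ⟩
        sum (λ t → (b t i * proj₁ (eig t)) * P⁻¹ t j)
          ≈⟨ sum-cong-≋ (λ t → *-congʳ (sum-1ᴹ (λ s → b s i * proj₁ (eig s)) t)) ⟨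
        sum (λ t → sum (λ s → b s i * proj₁ (eig s) * 1ᴹ s t) * P⁻¹ t j)
          ≈⟨ sum-cong-≋ (λ t → *-congʳ (sum-cong-≋ λ s → *-assoc (b s i) (proj₁ (eig s)) (1ᴹ s t))) ⟩
        ((P *ᴹ D) *ᴹ P⁻¹) i j ∎

  Distinct : List Carrier → Set
  Distinct = AllPairs λ α β → ¬ α ≈ β

  -- Repetitions are removed because splitting into eigenvectors divides by the differences of the
  -- listed values.
  distinctValues : ∀ {n} (d : Vector Carrier n) → ∃[ αs ] Distinct αs × ∀ i → Any (d i ≈_) αs
  distinctValues {zero} d = [] , [] , λ ()
  distinctValues {suc n} d with distinctValues (d ∘ suc)
  ... | αs , distinct , d∈ with em {Any (d zero ≈_) αs}
  ...   | yes d₀∈ = αs , distinct , λ { zero → d₀∈ ; (suc i) → d∈ i }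
  ...   | no d₀∉ = d zero ∷ αs , ¬Any⇒All¬ αs d₀∉ ∷ distinct , λ { zero → here refl ; (suc i) → there (d∈ i) }

  module _ {I : Set} {f : (I → Carrier) → I → Carrier} (lf : Linear f) where

    -- The product of the factors f - α over the list kills v. This plays the part of a minimal
    -- polynomial, for one vector at a time.
    Annihilated : List Carrier → (I → Carrier) → Set
    Annihilated [] v = v ≈0ᵛ
    Annihilated (α ∷ αs) v = Annihilated αs λ i → f v i - α * v i

    annihilatedSubspace : List Carrier → Subspace {I}
    annihilatedSubspace αs = record
      { _∈ = Annihilated αs
      ; ∈-resp = resp αs
      ; 0∈ = zero∈ αs λ _ → refl
      ; +∈ = plus αs
      ; *∈ = times αs
      }
      where
      resp : ∀ αs {u v} → u ≈ᵛ v → Annihilated αs u → Annihilated αs v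
      resp [] u≈v u≈0 i = trans (sym (u≈v i)) (u≈0 i)
      resp (α ∷ αs) u≈v = resp αs λ i → +-cong (f-cong lf u≈v i) (-‿cong (*-congˡ (u≈v i)))
      zero∈ : ∀ αs {u} → u ≈0ᵛ → Annihilated αs u
      zero∈ [] u≈0 = u≈0
      zero∈ (α ∷ αs) {u} u≈0 = zero∈ αs λ i → x≈y⇒x-y≈0 (trans (f-0 lf u≈0 i)
        (sym (trans (*-congˡ (u≈0 i)) (zeroʳ α))))
      plus : ∀ αs {u v} → Annihilated αs u → Annihilated αs v → Annihilated αs λ i → u i + v i
      plus [] u≈0 v≈0 i = trans (+-cong (u≈0 i) (v≈0 i)) (+-identityˡ 0#)
      plus (α ∷ αs) {u} {v} hu hv = resp αs (λ i → trans
        (solve 5 (λ p q α u v → (p :- α :* u) :+ (q :- α :* v) := (p :+ q) :- α :* (u :+ v)) refl (f u i) (f v i) α (u i) (v i))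
        (+-congʳ (sym (f-+ lf u v i)))) (plus αs hu hv)
      times : ∀ αs {u} x → Annihilated αs u → Annihilated αs λ i → x * u i
      times [] x u≈0 i = trans (*-congˡ (u≈0 i)) (zeroʳ x)
      times (α ∷ αs) {u} x hu = resp αs (λ i → trans
        (solve 4 (λ p x α u → x :* (p :- α :* u) := x :* p :- α :* (x :* u)) refl (f u i) x α (u i))
        (+-congʳ (sym (f-* lf x u i)))) (times αs x hu)

    -- On w the factor f - β is multiplication by α - β, and one of these scalars is 0.
    eigenvector-annihilated : ∀ {αs α w} → Any (α ≈_) αs → Eigenvector f α w → Annihilated αs w
    eigenvector-annihilated {β ∷ αs} {α} {w} (here α≈β) h = ∈-resp (λ i → sym (x≈y⇒x-y≈0
      (trans (h i) (*-congʳ α≈β)))) 0∈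
      where open Subspace (annihilatedSubspace αs)
    eigenvector-annihilated {β ∷ αs} {α} {w} (there α∈) h = ∈-resp (λ i → trans
      (solve 3 (λ α β w → (α :- β) :* w := α :* w :- β :* w) refl α β (w i)) (+-congʳ (sym (h i))))
      (*∈ (α - β) (eigenvector-annihilated α∈ h))
      where open Subspace (annihilatedSubspace αs)

    -- With u = f v - α v, the eigenvector components of u outside the
    -- α-eigenspace lift to some v′ with f v′ - α v′ = u, so v - v′ lies in the
    -- α-eigenspace.
    annihilated⇒∈ : (W : Subspace {I}) → (∀ {v} → Subspace._∈ W v → Subspace._∈ W (f v)) →
      ∀ αs → Distinct αs → (X : Subspace {I}) →
      (∀ {α} → α ∈ αs → ∀ {w} → Subspace._∈ W w → Eigenvector f α w → Subspace._∈ X w) →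
      ∀ {v} → Subspace._∈ W v → Annihilated αs v → Subspace._∈ X v
    annihilated⇒∈ W stable [] _ X _ _ v≈0 = Subspace.∈-resp X (λ i → sym (v≈0 i)) (Subspace.0∈ X)
    annihilated⇒∈ W stable (α ∷ αs) (α∉αs ∷ distinct) X eig⊆X {v} v∈W ann =
      split (annihilated⇒∈ W stable αs distinct X′ eig⊆X′ u∈W ann)
      where
      module W = Subspace W
      module X = Subspace X
      u : I → Carrier
      u i = f v i - α * v i
      u∈W : W._∈ u
      u∈W = W.∈-resp (λ i → solve 3 (λ p α v → p :+ (:- α) :* v := p :- α :* v) refl (f v i) α (v i))
        (W.+∈ (stable v∈W) (W.*∈ (- α) v∈W))
      -- The image of W ∩ X under f - α, which is the target given to the induction hypothesis.
      X′ : Subspace {I}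
      X′ = record
        { _∈ = λ u → ∃[ v ] W._∈ v × X._∈ v × (∀ i → f v i - α * v i ≈ u i)
        ; ∈-resp = λ u≈u′ (v , v∈W , v∈X , h) → v , v∈W , v∈X , λ i → trans (h i) (u≈u′ i)
        ; 0∈ = (λ _ → 0#) , W.0∈ , X.0∈ , λ i → x≈y⇒x-y≈0 (trans (f-0 lf (λ _ → refl) i) (sym (zeroʳ α)))
        ; +∈ = λ (v , v∈W , v∈X , h) (v′ , v′∈W , v′∈X , h′) → _ , W.+∈ v∈W v′∈W , X.+∈ v∈X v′∈X , λ i → trans
            (+-congʳ (f-+ lf v v′ i))
            (trans (solve 5 (λ p q α u v → (p :+ q) :- α :* (u :+ v) := (p :- α :* u) :+ (q :- α :* v)) refl
              (f v i) (f v′ i) α (v i) (v′ i)) (+-cong (h i) (h′ i)))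
        ; *∈ = λ x (v , v∈W , v∈X , h) → _ , W.*∈ x v∈W , X.*∈ x v∈X , λ i → trans
            (+-congʳ (f-* lf x v i))
            (trans (solve 4 (λ p x α u → x :* p :- α :* (x :* u) := x :* (p :- α :* u)) refl (f v i) x α (v i))
              (*-congˡ (h i)))
        }
      eig⊆X′ : ∀ {β} → β ∈ αs → ∀ {w} → W._∈ w → Eigenvector f β w → Subspace._∈ X′ w
      eig⊆X′ {β} β∈αs {w} w∈W h = lift (invertible (β - α) (All.lookup α∉αs β∈αs ∘ sym ∘ x-y≈0⇒x≈y))
        where
        lift : ∃[ y ] (β - α) * y ≈ 1# → Subspace._∈ X′ w
        lift (y , ⟨β-α⟩y≈1) = (λ i → y * w i) , W.*∈ y w∈W , X.*∈ y (eig⊆X (there β∈αs) w∈W h) , λ i → begin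
          f (λ i → y * w i) i - α * (y * w i)
            ≈⟨ +-congʳ (trans (f-* lf y w i) (*-congˡ (h i))) ⟩
          y * (β * w i) - α * (y * w i)
            ≈⟨ solve 4 (λ y β α w → y :* (β :* w) :- α :* (y :* w) := ((β :- α) :* y) :* w) refl y β α (w i) ⟩
          (β - α) * y * w i
            ≈⟨ trans (*-congʳ ⟨β-α⟩y≈1) (*-identityˡ (w i)) ⟩
          w i ∎
      split : Subspace._∈ X′ u → X._∈ v
      split (v′ , v′∈W , v′∈X , h) = X.∈-resp
        (λ i → solve 2 (λ v v′ → (v :+ con (ℚ.- 1ℚ) :* v′) :+ v′ := v) refl (v i) (v′ i))
        (X.+∈ (eig⊆X (here ≡.refl) (W.+∈ v∈W (W.*∈ (fromℚ′ (ℚ.- 1ℚ)) v′∈W)) λ i → begin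
          f (λ i → v i + fromℚ′ (ℚ.- 1ℚ) * v′ i) i
            ≈⟨ trans (f-+ lf v _ i) (+-congˡ (f-* lf (fromℚ′ (ℚ.- 1ℚ)) v′ i)) ⟩
          f v i + fromℚ′ (ℚ.- 1ℚ) * f v′ i
            ≈⟨ solve 5 (λ p q α v v′ → p :+ con (ℚ.- 1ℚ) :* q :=
                 (α :* (v :+ con (ℚ.- 1ℚ) :* v′)) :+ ((p :- α :* v) :- (q :- α :* v′))) refl (f v i) (f v′ i) α (v i) (v′ i) ⟩
          α * (v i + fromℚ′ (ℚ.- 1ℚ) * v′ i) + (u i - (f v′ i - α * v′ i))
            ≈⟨ trans (+-congˡ (x≈y⇒x-y≈0 (sym (h i)))) (+-identityʳ _) ⟩
          α * (v i + fromℚ′ (ℚ.- 1ℚ) * v′ i) ∎) v′∈X)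

  -- The columns of `P` are eigenvectors for the diagonal entries of `D`, and every vector is a
  -- combination of them.
  diagonalizable⇒annihilated : ∀ {n} (A : Matrix n n) → Diagonalizable A →
    ∃[ αs ] Distinct αs × ∀ v → Annihilated (·-linear A) αs v
  diagonalizable⇒annihilated {n} A (P , P⁻¹ , D , PP⁻¹≈1 , P⁻¹P≈1 , diagonal , A≈PDP⁻¹)
    with distinctValues (λ t → D t t)
  ... | αs , distinct , D∈ = αs , distinct , λ v → ∈-resp (λ i → sym (v≈ v i))
      (combination∈ (P⁻¹ · v) (P ᵀ) (λ t → eigenvector-annihilated (·-linear A) (D∈ t) (eigenvector t)))
    where
    open Subspace (annihilatedSubspace (·-linear A) αs)
    v≈ : ∀ v → v ≈ᵛ combination (P⁻¹ · v) (P ᵀ)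
    v≈ v i = begin
      v i                            ≈⟨ sum-1ᴹ v i ⟨
      sum (λ j → v j * 1ᴹ j i)       ≈⟨ sum-cong-≋ (λ j → trans (*-comm (v j) (1ᴹ j i)) (*-congʳ (reflexive (1ᴹ-sym j i)))) ⟩
      (1ᴹ · v) i                     ≈⟨ ·-cong PP⁻¹≈1 v i ⟨
      ((P *ᴹ P⁻¹) · v) i             ≈⟨ ·-assoc P P⁻¹ v i ⟩
      (P · P⁻¹ · v) i                ≈⟨ sum-cong-≋ (λ t → *-comm (P i t) ((P⁻¹ · v) t)) ⟩
      combination (P⁻¹ · v) (P ᵀ) i  ∎
    D-column : ∀ s t → D s t ≈ D t t * 1ᴹ t s
    D-column s t with t Finₚ.≟ s
    ... | yes ≡.refl = sym (*-identityʳ (D t t))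
    ... | no t≢s = trans (diagonal s t (t≢s ∘ ≡.sym)) (sym (zeroʳ (D t t)))
    eigenvector : ∀ t → Eigenvector (A ·_) (D t t) ((P ᵀ) t)
    eigenvector t i = begin
      (A · (P ᵀ) t) i
        ≈⟨ ·-cong A≈PDP⁻¹ ((P ᵀ) t) i ⟩
      (((P *ᴹ D) *ᴹ P⁻¹) · (P ᵀ) t) i
        ≈⟨ ·-assoc (P *ᴹ D) P⁻¹ ((P ᵀ) t) i ⟩
      ((P *ᴹ D) · P⁻¹ · (P ᵀ) t) i
        ≈⟨ sum-cong-≋ (λ s → *-congˡ (P⁻¹P≈1 s t)) ⟩
      sum (λ s → (P *ᴹ D) i s * 1ᴹ s t)
        ≈⟨ sum-1ᴹ ((P *ᴹ D) i) t ⟩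
      sum (λ s → P i s * D s t)
        ≈⟨ sum-cong-≋ (λ s → trans (*-congˡ (trans (D-column s t) (*-congˡ (reflexive (1ᴹ-sym t s)))))
             (solve 3 (λ p d e → p :* (d :* e) := (d :* p) :* e) refl (P i s) (D t t) (1ᴹ s t))) ⟩
      sum (λ s → D t t * P i s * 1ᴹ s t)
        ≈⟨ sum-1ᴹ (λ s → D t t * P i s) t ⟩
      D t t * P i t ∎

  -- Induction on the number of operators: v is split into eigenvectors of the first one inside W.
  -- Each of its eigenspaces in W is stable under the remaining operators because they commute with
  -- it, so it serves as the next W.
  jointEigenvectors⇒∈ : ∀ {I : Set} {q} (f : Fin q → (I → Carrier) → I → Carrier) (lf : ∀ t → Linear (f t)) →
    (∀ s t v → f s (f t v) ≈ᵛ f t (f s v)) →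
    (W : Subspace {I}) → (∀ t {v} → Subspace._∈ W v → Subspace._∈ W (f t v)) →
    (∀ t {v} → Subspace._∈ W v → ∃[ αs ] Distinct αs × Annihilated (lf t) αs v) →
    (X : Subspace {I}) → (∀ {w} → Subspace._∈ W w → (∀ t → ∃[ α ] Eigenvector (f t) α w) → Subspace._∈ X w) →
    ∀ {v} → Subspace._∈ W v → Subspace._∈ X v
  jointEigenvectors⇒∈ {q = zero} f lf comm W stable ann X eig⊆X v∈W = eig⊆X v∈W λ ()
  jointEigenvectors⇒∈ {I} {suc q} f lf comm W stable ann X eig⊆X {v} v∈W =
    annihilated⇒∈ (lf zero) W (stable zero) αs distinct X (λ {α} _ → eigenspace⊆X α) v∈W annihilated
    where
    module W = Subspace W
    αs : List Carrier
    αs = proj₁ (ann zero v∈W)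
    distinct : Distinct αs
    distinct = proj₁ (proj₂ (ann zero v∈W))
    annihilated : Annihilated (lf zero) αs v
    annihilated = proj₂ (proj₂ (ann zero v∈W))
    f₀ : (I → Carrier) → I → Carrier
    f₀ = f zero
    lf₀ : Linear f₀
    lf₀ = lf zero
    eigenspace : Carrier → Subspace {I}
    eigenspace α = record
      { _∈ = λ w → W._∈ w × Eigenvector f₀ α w
      ; ∈-resp = λ u≈v (u∈W , h) → W.∈-resp u≈v u∈W , λ i →
          trans (f-cong lf₀ (λ i → sym (u≈v i)) i) (trans (h i) (*-congˡ (u≈v i)))
      ; 0∈ = W.0∈ , λ i → trans (f-0 lf₀ (λ _ → refl) i) (sym (zeroʳ α))
      ; +∈ = λ {u} {v} (u∈W , h) (v∈W , h′) → W.+∈ u∈W v∈W , λ i →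
          trans (f-+ lf₀ u v i) (trans (+-cong (h i) (h′ i)) (sym (distribˡ α (u i) (v i))))
      ; *∈ = λ {u} x (u∈W , h) → W.*∈ x u∈W , λ i → trans (f-* lf₀ x u i) (trans (*-congˡ (h i))
          (solve 3 (λ x α u → x :* (α :* u) := α :* (x :* u)) refl x α (u i)))
      }
    eigenspace⊆X : ∀ α {w} → W._∈ w → Eigenvector f₀ α w → Subspace._∈ X w
    eigenspace⊆X α w∈W h = jointEigenvectors⇒∈ (f ∘ suc) (λ t → lf (suc t)) (λ s t → comm (suc s) (suc t))
      (eigenspace α)
      (λ t {v} (v∈W , h) → stable (suc t) v∈W , λ i →
        trans (comm zero (suc t) v i) (trans (f-cong (lf (suc t)) h i) (f-* (lf (suc t)) α v i)))
      (λ t (v∈W , _) → ann (suc t) v∈W) X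
      (λ (w∈W , h) eig → eig⊆X w∈W λ { zero → α , h ; (suc t) → eig t })
      (w∈W , h)

  -- From the slice conditions to a decomposition

  -- A vector off finitely many hyperplanes. The solution for the later `d t` is moved along a
  -- coordinate k in which `d zero` is nonzero. Each t with `d t k` nonzero forbids a single step
  -- size z, and the other values do not change.
  generic : ∀ {m N} (d : Fin m → Vector Carrier N) → (∀ t → ∃[ k ] ¬ d t k ≈ 0#) →
    Σ (Vector Carrier N) λ x → ∀ t → ¬ sum (λ k → x k * d t k) ≈ 0#
  generic {zero} d d≉0 = (λ _ → 0#) , λ ()
  generic {suc m} {N} d d≉0 = perturb (generic (d ∘ suc) (d≉0 ∘ suc))
    where
    k : Fin N
    k = proj₁ (d≉0 zero)
    value : Vector Carrier N → Fin (suc m) → Carrier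
    value x t = sum λ k → x k * d t k
    perturb : (Σ (Vector Carrier N) λ x → ∀ t → ¬ value x (suc t) ≈ 0#) →
      Σ (Vector Carrier N) λ x → ∀ t → ¬ value x t ≈ 0#
    perturb (x , h) = x′ , x′-generic
      where
      bad : ∀ t → ∃[ y ] (¬ d t k ≈ 0# → ∀ z → value x t + z * d t k ≈ 0# → z ≈ y)
      bad t with d t k ≈0?
      ... | yes dtk≈0 = 0# , λ dtk≉0 → contradiction dtk≈0 dtk≉0
      ... | no dtk≉0 = let i , dtk*i≈1 = invertible (d t k) dtk≉0 in - (value x t * i) , λ _ z h → begin
        z
          ≈⟨ trans (sym (*-identityʳ z)) (*-congˡ (sym dtk*i≈1)) ⟩
        z * (d t k * i)
          ≈⟨ solve 4 (λ z d i v → z :* (d :* i) := (v :+ z :* d) :* i :+ :- (v :* i)) refl z (d t k) i (value x t) ⟩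
        (value x t + z * d t k) * i + - (value x t * i)
          ≈⟨ trans (+-congʳ (trans (*-congʳ h) (zeroˡ i))) (+-identityˡ _) ⟩
        - (value x t * i) ∎
      z : Carrier
      z = proj₁ (avoid (proj₁ ∘ bad))
      z≉ : ∀ t → ¬ z ≈ proj₁ (bad t)
      z≉ = proj₂ (avoid (proj₁ ∘ bad))
      x′ : Vector Carrier N
      x′ j = x j + z * 1ᴹ j k
      value-x′ : ∀ t → value x′ t ≈ value x t + z * d t k
      value-x′ t = begin
        sum (λ j → (x j + z * 1ᴹ j k) * d t j)
          ≈⟨ sum-cong-≋ (λ j → solve 4 (λ x z e d → (x :+ z :* e) :* d := x :* d :+ z :* d :* e) refl (x j) z (1ᴹ j k) (d t j)) ⟩
        sum (λ j → x j * d t j + z * d t j * 1ᴹ j k)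
          ≈⟨ ∑-distrib-+ (λ j → x j * d t j) (λ j → z * d t j * 1ᴹ j k) ⟩
        value x t + sum (λ j → z * d t j * 1ᴹ j k)
          ≈⟨ +-congˡ (sum-1ᴹ (λ j → z * d t j) k) ⟩
        value x t + z * d t k ∎
      x′-generic : ∀ t → ¬ value x′ t ≈ 0#
      x′-generic t v≈0 with d t k ≈0?
      ... | no dtk≉0 = z≉ t (proj₂ (bad t) dtk≉0 z (trans (sym (value-x′ t)) v≈0))
      x′-generic zero v≈0 | yes dtk≈0 = proj₂ (d≉0 zero) dtk≈0
      x′-generic (suc t) v≈0 | yes dtk≈0 = h t (begin
        value x (suc t)                    ≈⟨ +-identityʳ _ ⟨
        value x (suc t) + 0#               ≈⟨ +-congˡ (trans (*-congˡ dtk≈0) (zeroʳ z)) ⟨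
        value x (suc t) + z * d (suc t) k  ≈⟨ value-x′ (suc t) ⟨
        value x′ (suc t)                   ≈⟨ v≈0 ⟩
        0#                                 ∎)

  module _ (√ : ∀ x → ∃[ s ] s * s ≈ x) {N} (A : Vector (Matrix N N) N) (conditions : SliceConditions A) where

    private
      C : Fin N → Fin N → Vector Carrier N → Vector Carrier N
      C k l v = A k ᵀ · A l · v

      C-linear : ∀ k l → Linear (C k l)
      C-linear k l = ∘-linear (·-linear (A k ᵀ)) (·-linear (A l))

      AAᵀ-sym : ∀ k l v → A k · A l ᵀ · v ≈ᵛ A l · A k ᵀ · v
      AAᵀ-sym k l v i = begin
        (A k · A l ᵀ · v) i           ≈⟨ ·-assoc (A k) (A l ᵀ) v i ⟨
        ((A k *ᴹ A l ᵀ) · v) i        ≈⟨ ·-cong (proj₁ (proj₂ conditions k l)) v i ⟨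
        ((A k *ᴹ A l ᵀ) ᵀ · v) i
          ≈⟨ ·-cong {B = A l *ᴹ A k ᵀ} (λ i j → sum-cong-≋ λ p → *-comm (A k j p) (A l i p)) v i ⟩
        ((A l *ᴹ A k ᵀ) · v) i        ≈⟨ ·-assoc (A l) (A k ᵀ) v i ⟩
        (A l · A k ᵀ · v) i           ∎

      C-sym : ∀ k l v → C k l v ≈ᵛ C l k v
      C-sym k l v i = begin
        (A k ᵀ · A l · v) i           ≈⟨ ·-assoc (A k ᵀ) (A l) v i ⟨
        ((A k ᵀ *ᴹ A l) · v) i        ≈⟨ ·-cong (proj₂ (proj₂ conditions k l)) v i ⟨
        ((A k ᵀ *ᴹ A l) ᵀ · v) i
          ≈⟨ ·-cong {B = A l ᵀ *ᴹ A k} (λ i j → sum-cong-≋ λ p → *-comm (A k p j) (A l p i)) v i ⟩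
        ((A l ᵀ *ᴹ A k) · v) i        ≈⟨ ·-assoc (A l ᵀ) (A k) v i ⟩
        (A l ᵀ · A k · v) i           ∎

      -- In Aₖᵀ Aₗ Aₚᵀ A_q any two neighbouring indices may be exchanged: the middle pair by
      -- symmetry of the A Aᵀ, the outer pairs by symmetry of the Aᵀ A. The steps are klpq, kplq,
      -- pklq, pkql, pqkl.
      C-comm : ∀ k l p q v → C k l (C p q v) ≈ᵛ C p q (C k l v)
      C-comm k l p q v i = begin
        C k l (C p q v) i             ≈⟨ f-cong (·-linear (A k ᵀ)) (AAᵀ-sym l p (A q · v)) i ⟩
        C k p (C l q v) i             ≈⟨ C-sym k p (C l q v) i ⟩
        C p k (C l q v) i             ≈⟨ f-cong (C-linear p k) (C-sym l q v) i ⟩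
        C p k (C q l v) i             ≈⟨ f-cong (·-linear (A p ᵀ)) (AAᵀ-sym k q (A l · v)) i ⟩
        C p q (C k l v) i             ∎

      kernel : ∀ k {v} → C k k v ≈0ᵛ → A k · v ≈0ᵛ
      kernel k {v} = sameRank⇒kernel-ᵀ*ᴹ (A k) (proj₂ (proj₁ conditions k)) v

      Active Dead : Vector Carrier N → Set
      Active w = ∃[ k ] Σ (Vector Carrier N) λ c → ¬ c k ≈ 0# × ∀ l → Eigenvector (C k l) (c l) w
      Dead w = ∀ l → A l · w ≈0ᵛ

      module _ (μ : Vector Carrier N) (k : Fin N) (μk≉0 : ¬ μ k ≈ 0#) where

        W : Subspace {Fin N}
        W = record
          { _∈ = λ v → ∀ l → Eigenvector (C l l) (μ l) v
          ; ∈-resp = λ u≈v h l i → trans (f-cong (C-linear l l) (λ i → sym (u≈v i)) i)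
              (trans (h l i) (*-congˡ (u≈v i)))
          ; 0∈ = λ l i → trans (f-0 (C-linear l l) (λ _ → refl) i) (sym (zeroʳ (μ l)))
          ; +∈ = λ {u} {v} hu hv l i → trans (f-+ (C-linear l l) u v i)
              (trans (+-cong (hu l i) (hv l i)) (sym (distribˡ (μ l) (u i) (v i))))
          ; *∈ = λ {u} x hu l i → trans (f-* (C-linear l l) x u i) (trans (*-congˡ (hu l i))
              (solve 3 (λ x α u → x :* (α :* u) := α :* (x :* u)) refl x (μ l) (u i)))
          }

        C-stable : ∀ l {v} → Subspace._∈ W v → Subspace._∈ W (C k l v)
        C-stable l {v} h m i = trans (C-comm m m k l v i)
          (trans (f-cong (C-linear k l) (h m) i) (f-* (C-linear k l) (μ m) v i))

        C²≈ : ∀ l {v} → Subspace._∈ W v → Eigenvector (λ v → C k l (C k l v)) (μ k * μ l) v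
        C²≈ l {v} h i = begin
          C k l (C k l v) i       ≈⟨ f-cong (·-linear (A k ᵀ)) (AAᵀ-sym l k (A l · v)) i ⟩
          C k k (C l l v) i       ≈⟨ f-cong (C-linear k k) (h l) i ⟩
          C k k (λ i → μ l * v i) i ≈⟨ f-* (C-linear k k) (μ l) v i ⟩
          μ l * C k k v i         ≈⟨ *-congˡ (h k i) ⟩
          μ l * (μ k * v i)       ≈⟨ solve 3 (λ a b v → a :* (b :* v) := b :* a :* v) refl (μ l) (μ k) (v i) ⟩
          μ k * μ l * v i         ∎

        -- If μₗ = 0, the rank condition on Aₗ gives Aₗ v = 0, so the single root 0 suffices.
        -- Otherwise μₖ μₗ is nonzero and has two distinct roots s and -s.
        C-annihilated : ∀ l {v} → Subspace._∈ W v → ∃[ αs ] Distinct αs × Annihilated (C-linear k l) αs v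
        C-annihilated l {v} h with μ l ≈0?
        ... | yes μl≈0 = 0# ∷ [] , [] ∷ [] , λ i → x≈y⇒x-y≈0 (trans
          (f-0 (·-linear (A k ᵀ)) (kernel l λ i → trans (h l i) (trans (*-congʳ μl≈0) (zeroˡ (v i)))) i)
          (sym (zeroˡ (v i))))
        ... | no μl≉0 = s ∷ - s ∷ [] , (s≉-s ∷ []) ∷ [] ∷ [] , λ i → begin
          C k l (λ i → C k l v i - s * v i) i - - s * (C k l v i - s * v i)
            ≈⟨ +-congʳ (f-cong (C-linear k l)
                 (λ i → solve 3 (λ c s v → c :- s :* v := c :+ (:- s) :* v) refl (C k l v i) s (v i)) i) ⟩
          C k l (λ i → C k l v i + - s * v i) i - - s * (C k l v i - s * v i)
            ≈⟨ +-congʳ (trans (f-+ (C-linear k l) (C k l v) (λ i → - s * v i) i)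
                 (+-cong (C²≈ l h i) (f-* (C-linear k l) (- s) v i))) ⟩
          (μ k * μ l * v i + - s * C k l v i) - - s * (C k l v i - s * v i)
            ≈⟨ solve 4 (λ m v s c → (m :* v :+ :- s :* c) :- :- s :* (c :- s :* v) := (m :- s :* s) :* v) refl
                 (μ k * μ l) (v i) s (C k l v i) ⟩
          (μ k * μ l - s * s) * v i
            ≈⟨ trans (*-congʳ (x≈y⇒x-y≈0 (sym s²≈))) (zeroˡ (v i)) ⟩
          0# ∎
          where
          s : Carrier
          s = proj₁ (√ (μ k * μ l))
          s²≈ : s * s ≈ μ k * μ l
          s²≈ = proj₂ (√ (μ k * μ l))
          s≉-s : ¬ s ≈ - s
          s≉-s s≈-s = μl≉0 (x*y≈0⇒y≈0 μk≉0 (trans (sym s²≈) (trans (*-congʳ s≈0) (zeroˡ s))))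
            where
            s≈0 : s ≈ 0#
            s≈0 = x*y≈0⇒y≈0 (fromℚ-nonZero {1ℚ ℚ.+ 1ℚ} λ ())
              (trans (solve 1 (λ s → con (1ℚ ℚ.+ 1ℚ) :* s := s :- (:- s)) refl s) (x≈y⇒x-y≈0 s≈-s))

        jointEigenvector∈ : (X : Subspace {Fin N}) → (∀ {w} → Active w → Subspace._∈ X w) →
          (∀ {w} → Dead w → Subspace._∈ X w) → ∀ {w} → Subspace._∈ W w → Subspace._∈ X w
        jointEigenvector∈ X active∈ dead∈ = jointEigenvectors⇒∈ (C k) (C-linear k)
          (λ l m v → C-comm k l k m v) W C-stable C-annihilated X eigenvector∈
          where
          eigenvector∈ : ∀ {w} → Subspace._∈ W w → (∀ l → ∃[ α ] Eigenvector (C k l) α w) → Subspace._∈ X w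
          eigenvector∈ {w} w∈W eig with proj₁ (eig k) ≈0?
          ... | no ck≉0 = active∈ (k , proj₁ ∘ eig , ck≉0 , proj₂ ∘ eig)
          -- Such a w is 0: `C k k` acts on it both as 0 and as μₖ, which is nonzero.
          ... | yes ck≈0 = dead∈ λ l → f-0 (·-linear (A l)) λ i → x*y≈0⇒y≈0 μk≉0 (begin
            μ k * w i                ≈⟨ w∈W k i ⟨
            C k k w i                ≈⟨ proj₂ (eig k) i ⟩
            proj₁ (eig k) * w i      ≈⟨ trans (*-congʳ ck≈0) (zeroˡ (w i)) ⟩
            0#                       ∎)

      -- Two rounds of splitting. The Aₖᵀ Aₖ are split first; then, in a joint eigenspace where some
      -- μₖ is nonzero, the Aₖᵀ Aₗ for that k. Where all μₖ vanish, the rank conditions put the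
      -- vector into the common kernel.
      active-dead-span : (X : Subspace {Fin N}) → (∀ {w} → Active w → Subspace._∈ X w) →
        (∀ {w} → Dead w → Subspace._∈ X w) → ∀ v → Subspace._∈ X v
      active-dead-span X active∈ dead∈ v = jointEigenvectors⇒∈ H (λ k → ·-linear (A k ᵀ *ᴹ A k))
        (λ k l v i → trans (H≈C k (H l v) i) (trans (f-cong (C-linear k k) (H≈C l v) i)
          (trans (C-comm k k l l v i)
          (trans (f-cong (C-linear l l) (λ i → sym (H≈C k v i)) i) (sym (H≈C l (H k v) i))))))
        everything (λ _ _ → _)
        (λ k {v} _ → let αs , distinct , ann = diagonalizable⇒annihilated (A k ᵀ *ᴹ A k) (proj₁ (proj₁ conditions k)) in
          αs , distinct , ann v)
        X (λ _ eig → eigenvector∈ eig) {v} _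
        where
        H : Fin N → Vector Carrier N → Vector Carrier N
        H k v = (A k ᵀ *ᴹ A k) · v
        H≈C : ∀ k v → H k v ≈ᵛ C k k v
        H≈C k = ·-assoc (A k ᵀ) (A k)
        everything : Subspace {Fin N}
        everything = record { _∈ = λ _ → ⊤ ; ∈-resp = λ _ _ → _ ; 0∈ = _ ; +∈ = λ _ _ → _ ; *∈ = λ _ _ → _ }
        eigenvector∈ : ∀ {w} → (∀ k → ∃[ μ ] Eigenvector (H k) μ w) → Subspace._∈ X w
        eigenvector∈ {w} eig with em {∃[ k ] ¬ proj₁ (eig k) ≈ 0#}
        ... | yes (k , μk≉0) = jointEigenvector∈ (proj₁ ∘ eig) k μk≉0 X active∈ dead∈
          λ l i → trans (sym (H≈C l w i)) (proj₂ (eig l) i)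
        ... | no ¬p = dead∈ λ l → kernel l λ i → begin
          C l l w i                ≈⟨ H≈C l w i ⟨
          H l w i                  ≈⟨ proj₂ (eig l) i ⟩
          proj₁ (eig l) * w i      ≈⟨ *-congʳ (decidable-stable (_ ≈0?) λ h → ¬p (l , h)) ⟩
          0# * w i                 ≈⟨ zeroˡ (w i) ⟩
          0#                       ∎

    sliceDecomposition : ∀ r → SpanRank≤ A r → ∃[ m ] Σ (Fin m → Vector Carrier N) λ y → Σ (Fin m → Vector Carrier N) λ p →
      Σ (Fin m → Vector Carrier N) λ d → (∀ l i j → A l i j ≈ sum λ t → y t i * p t j * d t l) × ℤ.+ m ℤ.≤ r
    sliceDecomposition r spanRank≤ with maximalIndependent Active
    ... | m , b , ind-b , active , active∈ = m , y , p , d , A≈ , ℤₚ.≤-trans (ℤ.+≤+ m≤ρ) (proj₂ (proj₂ rank-M))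
      where
      k : Fin m → Fin N
      k = proj₁ ∘ active
      c : Fin m → Vector Carrier N
      c t = proj₁ (proj₂ (active t))
      ck≉0 : ∀ t → ¬ c t (k t) ≈ 0#
      ck≉0 t = proj₁ (proj₂ (proj₂ (active t)))
      C-b : ∀ t l → Eigenvector (C (k t) l) (c t l) (b t)
      C-b t = proj₂ (proj₂ (proj₂ (active t)))
      ck⁻¹ : Fin m → Carrier
      ck⁻¹ t = proj₁ (invertible (c t (k t)) (ck≉0 t))
      ck*ck⁻¹≈1 : ∀ t → c t (k t) * ck⁻¹ t ≈ 1#
      ck*ck⁻¹≈1 t = proj₂ (invertible (c t (k t)) (ck≉0 t))
      y d : Fin m → Vector Carrier N
      y t = A (k t) · b t
      d t l = c t l * ck⁻¹ t

      -- For b = `b t` and k = `k t`: cₖ Aₗ b = Aₗ Aₖᵀ Aₖ b = Aₖ Aₗᵀ Aₖ b = cₗ Aₖ b, and cₖ can be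
      -- divided out.
      A-b : ∀ t l → A l · b t ≈ᵛ λ i → d t l * y t i
      A-b t l i = begin
        (A l · b t) i
          ≈⟨ trans (*-congʳ (ck*ck⁻¹≈1 t)) (*-identityˡ _) ⟨
        c t (k t) * ck⁻¹ t * (A l · b t) i
          ≈⟨ solve 3 (λ c e a → c :* e :* a := e :* (c :* a)) refl (c t (k t)) (ck⁻¹ t) ((A l · b t) i) ⟩
        ck⁻¹ t * (c t (k t) * (A l · b t) i)
          ≈⟨ *-congˡ (begin
            c t (k t) * (A l · b t) i
              ≈⟨ f-* (·-linear (A l)) (c t (k t)) (b t) i ⟨
            (A l · λ i → c t (k t) * b t i) i
              ≈⟨ f-cong (·-linear (A l)) (C-b t (k t)) i ⟨
            (A l · C (k t) (k t) (b t)) i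
              ≈⟨ AAᵀ-sym l (k t) (A (k t) · b t) i ⟩
            (A (k t) · C l (k t) (b t)) i
              ≈⟨ f-cong (·-linear (A (k t))) (λ i → trans (C-sym l (k t) (b t) i) (C-b t l i)) i ⟩
            (A (k t) · λ i → c t l * b t i) i
              ≈⟨ f-* (·-linear (A (k t))) (c t l) (b t) i ⟩
            c t l * y t i ∎) ⟩
        ck⁻¹ t * (c t l * y t i)
          ≈⟨ solve 3 (λ e c y → e :* (c :* y) := c :* e :* y) refl (ck⁻¹ t) (c t l) (y t i) ⟩
        d t l * y t i ∎

      -- The span of `b` plus the common kernel of the slices: one combination of `b` has to imitate
      -- v under all slices at once.
      X : Subspace {Fin N}
      X = record
        { _∈ = λ v → Σ (Vector Carrier m) λ a → ∀ l → A l · v ≈ᵛ A l · combination a b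
        ; ∈-resp = λ u≈v (a , h) → a , λ l i → trans (f-cong (·-linear (A l)) (λ i → sym (u≈v i)) i) (h l i)
        ; 0∈ = (λ _ → 0#) , λ l → f-cong (·-linear (A l)) λ i → sym (sum-0 λ t → zeroˡ (b t i))
        ; +∈ = λ {u} {v} (a , h) (a′ , h′) → (λ t → a t + a′ t) , λ l i → trans (f-+ (·-linear (A l)) u v i)
            (trans (+-cong (h l i) (h′ l i)) (trans (sym (f-+ (·-linear (A l)) (combination a b) (combination a′ b) i))
            (f-cong (·-linear (A l)) (λ i → trans (sym (∑-distrib-+ (λ t → a t * b t i) (λ t → a′ t * b t i)))
              (sum-cong-≋ λ t → sym (distribʳ (b t i) (a t) (a′ t)))) i)))
        ; *∈ = λ {u} x (a , h) → (λ t → x * a t) , λ l i → trans (f-* (·-linear (A l)) x u i)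
            (trans (*-congˡ (h l i)) (trans (sym (f-* (·-linear (A l)) x (combination a b) i))
            (f-cong (·-linear (A l)) (λ i → trans (*-distribˡ-sum x λ t → a t * b t i)
              (sum-cong-≋ λ t → sym (*-assoc x (a t) (b t i)))) i)))
        }
      ∈X : ∀ v → Subspace._∈ X v
      ∈X = active-dead-span X
        (λ act → proj₁ (active∈ act) , λ l → f-cong (·-linear (A l)) (proj₂ (active∈ act)))
        (λ dead → (λ _ → 0#) , λ l i → trans (dead l i)
          (sym (f-0 (·-linear (A l)) (λ i → sum-0 λ t → zeroˡ (b t i)) i)))

      p : Fin m → Vector Carrier N
      p t j = proj₁ (∈X (1ᴹ j)) t
      A≈ : ∀ l i j → A l i j ≈ sum λ t → y t i * p t j * d t l
      A≈ l i j = begin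
        A l i j
          ≈⟨ ·-1ᴹ (A l) j i ⟨
        (A l · 1ᴹ j) i
          ≈⟨ proj₂ (∈X (1ᴹ j)) l i ⟩
        (A l · combination (λ t → p t j) b) i
          ≈⟨ f-combination (·-linear (A l)) (λ t → p t j) b i ⟩
        sum (λ t → p t j * (A l · b t) i)
          ≈⟨ sum-cong-≋ (λ t → trans (*-congˡ (A-b t l i))
               (solve 3 (λ p d y → p :* (d :* y) := y :* p :* d) refl (p t j) (d t l) (y t i))) ⟩
        sum (λ t → y t i * p t j * d t l) ∎

      -- Applying the transpose of A at `k t` to a relation among the `y s` multiplies each
      -- coefficient by `c s (k t)` and replaces `y s` by `b s`. Independence of `b`, read at s = t,
      -- leaves a multiple of `a t` by a nonzero number.
      ind-y : LinearlyIndependent y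
      ind-y a h t = x*y≈0⇒y≈0 (ck≉0 t) (trans (*-comm _ _) (ind-b (λ s → a s * c s (k t)) (λ i → begin
        sum (λ s → a s * c s (k t) * b s i)
          ≈⟨ sum-cong-≋ (λ s → trans (*-assoc (a s) (c s (k t)) (b s i))
               (*-congˡ (trans (sym (C-b s (k t) i)) (C-sym (k s) (k t) (b s) i)))) ⟩
        combination a (λ s → A (k t) ᵀ · y s) i
          ≈⟨ f-combination (·-linear (A (k t) ᵀ)) a y i ⟨
        (A (k t) ᵀ · combination a y) i
          ≈⟨ f-0 (·-linear (A (k t) ᵀ)) h i ⟩
        0# ∎) t))

      d≉0 : ∀ t → ∃[ l ] ¬ d t l ≈ 0#
      d≉0 t = k t , λ dk≈0 → 1≉0 (trans (sym (ck*ck⁻¹≈1 t)) dk≈0)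
      -- No `x·d t` vanishes for this choice, so `M` sends `b t` to a nonzero multiple of `y t`. The
      -- independent `y t` then lie in the column space of `M`, whose dimension is at most r.
      x : Vector Carrier N
      x = proj₁ (generic d d≉0)
      x·d : Fin m → Carrier
      x·d t = sum λ l → x l * d t l
      M : Matrix N N
      M i j = sum λ l → x l * A l i j
      rank-M : Rank≤ M r
      rank-M = spanRank≤ M (x , λ _ → refl)
      ρ : ℕ
      ρ = proj₁ rank-M
      M-b : ∀ t → M · b t ≈ᵛ λ i → x·d t * y t i
      M-b t i = begin
        sum (λ j → sum (λ l → x l * A l i j) * b t j)
          ≈⟨ combination-assoc x (λ l j → A l i j) (λ j (_ : Fin 1) → b t j) zero ⟨
        sum (λ l → x l * (A l · b t) i)
          ≈⟨ sum-cong-≋ (λ l → trans (*-congˡ (A-b t l i)) (sym (*-assoc (x l) (d t l) (y t i)))) ⟩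
        sum (λ l → x l * d t l * y t i)
          ≈⟨ *-distribʳ-sum (y t i) (λ l → x l * d t l) ⟨
        x·d t * y t i ∎
      y∈column : ∀ t → y t ∈Span (M ᵀ)
      y∈column t = let e , x·d*e≈1 = invertible (x·d t) (proj₂ (generic d d≉0) t) in
        ·⇒∈Span-ᵀ {A = M} (λ i → e * b t i) λ i → begin
          y t i
            ≈⟨ trans (*-congʳ x·d*e≈1) (*-identityˡ (y t i)) ⟨
          x·d t * e * y t i
            ≈⟨ solve 3 (λ x e y → x :* e :* y := e :* (x :* y)) refl (x·d t) e (y t i) ⟩
          e * (x·d t * y t i)
            ≈⟨ *-congˡ (M-b t i) ⟨
          e * (M · b t) i
            ≈⟨ f-* (·-linear M) e (b t) i ⟨
          (M · λ i → e * b t i) i ∎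
      m≤ρ : m ℕ.≤ ρ
      m≤ρ = let _ , (_ , _ , column) , _ = rank-M in
        independent⇒≤ ind-y λ t → Equivalence.from (column (y t)) (y∈column t)

  -- From a decomposition to an orthogonal one

  dot : ∀ {N} (u v : Vector Carrier N) → Carrier
  dot u v = sum λ i → u i * v i

  dot-comm : ∀ {N} (u v : Vector Carrier N) → dot u v ≈ dot v u
  dot-comm u v = sum-cong-≋ λ i → *-comm (u i) (v i)

  dot-combination : ∀ {N k} (u : Vector Carrier N) (a : Vector Carrier k) b →
    dot u (combination a b) ≈ sum λ t → a t * dot u (b t)
  dot-combination u a b = begin
    sum (λ i → u i * combination a b i)
      ≈⟨ sum-cong-≋ (λ i → *-distribˡ-sum (u i) λ t → a t * b t i) ⟩
    sum (λ i → sum λ t → u i * (a t * b t i))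
      ≈⟨ ∑-comm (λ i t → u i * (a t * b t i)) ⟩
    sum (λ t → sum λ i → u i * (a t * b t i))
      ≈⟨ sum-cong-≋ (λ t → sum-cong-≋ λ i → solve 3 (λ u a b → u :* (a :* b) := a :* (u :* b)) refl (u i) (a t) (b t i)) ⟩
    sum (λ t → sum λ i → a t * (u i * b t i))
      ≈⟨ sum-cong-≋ (λ t → *-distribˡ-sum (a t) λ i → u i * b t i) ⟨
    sum (λ t → a t * dot u (b t)) ∎

  -- The form is bilinear, without conjugation, to match the transpose. Nonzero vectors may be
  -- isotropic, so ⟨a , a⟩ ≠ 0 is demanded separately.
  Orthogonal : ∀ {N ρ} → Vector (Vector Carrier N) ρ → Set
  Orthogonal a = (∀ s t → s ≢ t → dot (a s) (a t) ≈ 0#) × (∀ t → ¬ dot (a t) (a t) ≈ 0#)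

  module _ (√ : ∀ x → ∃[ s ] s * s ≈ x) where

    -- The e₀-coordinate d of u₀ is chosen with d ≠ 0 and ⟨u₀ , u₀⟩ + d² ≠ 0; the
    -- e₀-coordinates of the other vectors are then forced by orthogonality to u₀.
    extendOrthogonal : ∀ {N} ρ n → n ℕ.+ ρ ℕ.≤ N → (u : Vector (Vector Carrier N) ρ) →
      (∀ t i → n ℕ.≤ Fin.toℕ i → u t i ≈ 0#) →
      Σ (Vector (Vector Carrier N) ρ) λ û → (∀ t i → Fin.toℕ i ℕ.< n → û t i ≈ u t i) × Orthogonal û
    extendOrthogonal zero n le u supported = (λ ()) , (λ ()) , (λ ()) , (λ ())
    extendOrthogonal {N} (suc ρ) n le u supported =
      prepend (extendOrthogonal ρ (suc n) (ℕₚ.≤-trans (ℕₚ.≤-reflexive (≡.sym (ℕₚ.+-suc n ρ))) le) u′ supported′)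
      where
      n<N : n ℕ.< N
      n<N = ℕₚ.≤-trans (ℕₚ.≤-trans (ℕₚ.m≤m+n (suc n) ρ) (ℕₚ.≤-reflexive (≡.sym (ℕₚ.+-suc n ρ)))) le
      i₀ : Fin N
      i₀ = Fin.fromℕ< n<N
      toℕ-i₀ : Fin.toℕ i₀ ≡ n
      toℕ-i₀ = Finₚ.toℕ-fromℕ< n<N
      e₀ : Vector Carrier N
      e₀ i = 1ᴹ i i₀
      e₀≈0 : ∀ i → Fin.toℕ i ≢ n → e₀ i ≈ 0#
      e₀≈0 i i≢n = 1ᴹ-diagonal i i₀ λ { ≡.refl → i≢n toℕ-i₀ }
      u≈0 : ∀ t → u t i₀ ≈ 0#
      u≈0 t = supported t i₀ (ℕₚ.≤-reflexive (≡.sym toℕ-i₀))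
      e₀₀≈1 : e₀ i₀ ≈ 1#
      e₀₀≈1 = begin
        1ᴹ i₀ i₀                       ≈⟨ sum-1ᴹ (λ j → 1ᴹ i₀ j) i₀ ⟨
        sum (λ j → 1ᴹ i₀ j * 1ᴹ j i₀)  ≈⟨ sum-cong-≋ (λ j → trans (*-congʳ (reflexive (1ᴹ-sym i₀ j))) (1ᴹ-idem j)) ⟩
        sum (λ j → 1# * 1ᴹ j i₀)       ≈⟨ sum-1ᴹ (λ _ → 1#) i₀ ⟩
        1#                             ∎
        where
        1ᴹ-idem : ∀ j → 1ᴹ j i₀ * 1ᴹ j i₀ ≈ 1# * 1ᴹ j i₀
        1ᴹ-idem j with j Finₚ.≟ i₀
        ... | yes _ = refl
        ... | no _ = trans (zeroˡ 0#) (sym (zeroʳ 1#))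

      dot-e₀ : ∀ s t c c′ → dot (λ i → u s i + c * e₀ i) (λ i → u t i + c′ * e₀ i) ≈ dot (u s) (u t) + c * c′
      dot-e₀ s t c c′ = begin
        sum (λ i → (u s i + c * e₀ i) * (u t i + c′ * e₀ i))
          ≈⟨ sum-cong-≋ (λ i → solve 5 (λ u v c c′ e → (u :+ c :* e) :* (v :+ c′ :* e) :=
               u :* v :+ (u :* c′ :+ c :* v :+ c :* c′ :* e) :* e) refl (u s i) (u t i) c c′ (e₀ i)) ⟩
        sum (λ i → u s i * u t i + (u s i * c′ + c * u t i + c * c′ * e₀ i) * e₀ i)
          ≈⟨ ∑-distrib-+ (λ i → u s i * u t i) (λ i → (u s i * c′ + c * u t i + c * c′ * e₀ i) * e₀ i) ⟩
        dot (u s) (u t) + sum (λ i → (u s i * c′ + c * u t i + c * c′ * e₀ i) * e₀ i)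
          ≈⟨ +-congˡ (sum-1ᴹ (λ i → u s i * c′ + c * u t i + c * c′ * e₀ i) i₀) ⟩
        dot (u s) (u t) + (u s i₀ * c′ + c * u t i₀ + c * c′ * e₀ i₀)
          ≈⟨ +-congˡ (+-cong (+-cong (trans (*-congʳ (u≈0 s)) (zeroˡ c′)) (trans (*-congˡ (u≈0 t)) (zeroʳ c)))
               (trans (*-congˡ e₀₀≈1) (*-identityʳ (c * c′)))) ⟩
        dot (u s) (u t) + (0# + 0# + c * c′)
          ≈⟨ +-congˡ (trans (+-congʳ (+-identityˡ 0#)) (+-identityˡ (c * c′))) ⟩
        dot (u s) (u t) + c * c′ ∎

      g d d⁻¹ : Carrier
      g = dot (u zero) (u zero)
      -- Both requirements on d concern only d², so the square is chosen first and d is a root of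
      -- it.
      d²≉ : ∃[ x ] ∀ (t : Fin 2) → ¬ x ≈ (0# Vec.∷ λ _ → - g) t
      d²≉ = avoid (0# Vec.∷ λ _ → - g)
      d = proj₁ (√ (proj₁ d²≉))
      d² : d * d ≈ proj₁ d²≉
      d² = proj₂ (√ (proj₁ d²≉))
      d≉0 : ¬ d ≈ 0#
      d≉0 d≈0 = proj₂ d²≉ zero (trans (sym d²) (trans (*-congʳ d≈0) (zeroˡ d)))
      d⁻¹ = proj₁ (invertible d d≉0)
      d*d⁻¹≈1 : d * d⁻¹ ≈ 1#
      d*d⁻¹≈1 = proj₂ (invertible d d≉0)

      c : Fin ρ → Carrier
      c t = - (dot (u zero) (u (suc t)) * d⁻¹)
      u₀ : Vector Carrier N
      u₀ i = u zero i + d * e₀ i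
      u′ : Vector (Vector Carrier N) ρ
      u′ t i = u (suc t) i + c t * e₀ i

      add-e₀-supported : ∀ t x i → suc n ℕ.≤ Fin.toℕ i → u t i + x * e₀ i ≈ 0#
      add-e₀-supported t x i n<i = begin
        u t i + x * e₀ i  ≈⟨ +-cong (supported t i (ℕₚ.<⇒≤ n<i)) (*-congˡ (e₀≈0 i (ℕₚ.<⇒≢ n<i ∘ ≡.sym))) ⟩
        0# + x * 0#       ≈⟨ trans (+-identityˡ _) (zeroʳ x) ⟩
        0#                ∎
      add-e₀-agrees : ∀ t x i → Fin.toℕ i ℕ.< n → u t i + x * e₀ i ≈ u t i
      add-e₀-agrees t x i i<n = begin
        u t i + x * e₀ i  ≈⟨ +-congˡ (trans (*-congˡ (e₀≈0 i (ℕₚ.<⇒≢ i<n))) (zeroʳ x)) ⟩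
        u t i + 0#        ≈⟨ +-identityʳ (u t i) ⟩
        u t i             ∎
      supported′ : ∀ t i → suc n ℕ.≤ Fin.toℕ i → u′ t i ≈ 0#
      supported′ t = add-e₀-supported (suc t) (c t)

      u₀⊥u′ : ∀ t → dot u₀ (u′ t) ≈ 0#
      u₀⊥u′ t = begin
        dot u₀ (u′ t)
          ≈⟨ dot-e₀ zero (suc t) d (c t) ⟩
        h + d * - (h * d⁻¹)
          ≈⟨ solve 3 (λ h d i → h :+ d :* :- (h :* i) := h :- h :* (d :* i)) refl h d d⁻¹ ⟩
        h - h * (d * d⁻¹)
          ≈⟨ x≈y⇒x-y≈0 (sym (trans (*-congˡ d*d⁻¹≈1) (*-identityʳ h))) ⟩
        0# ∎
        where
        h : Carrier
        h = dot (u zero) (u (suc t))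
      u₀-nonIsotropic : ¬ dot u₀ u₀ ≈ 0#
      u₀-nonIsotropic h = proj₂ d²≉ (suc zero) (begin
        proj₁ d²≉              ≈⟨ d² ⟨
        d * d                  ≈⟨ solve 2 (λ g x → x := (g :+ x) :+ :- g) refl g (d * d) ⟩
        (g + d * d) + - g      ≈⟨ +-congʳ (trans (sym (dot-e₀ zero zero d d)) h) ⟩
        0# + - g               ≈⟨ +-identityˡ (- g) ⟩
        - g                    ∎)

      prepend : (Σ (Vector (Vector Carrier N) ρ) λ û → (∀ t i → Fin.toℕ i ℕ.< suc n → û t i ≈ u′ t i) × Orthogonal û) →
        Σ (Vector (Vector Carrier N) (suc ρ)) λ û → (∀ t i → Fin.toℕ i ℕ.< n → û t i ≈ u t i) × Orthogonal û
      prepend (û , agrees , orthogonal , nonIsotropic) = û₊ , agrees₊ , orthogonal₊ , nonIsotropic₊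
        where
        û₊ : Vector (Vector Carrier N) (suc ρ)
        û₊ = u₀ Vec.∷ û
        agrees₊ : ∀ t i → Fin.toℕ i ℕ.< n → û₊ t i ≈ u t i
        agrees₊ zero i i<n = add-e₀-agrees zero d i i<n
        agrees₊ (suc t) i i<n = trans (agrees t i (ℕₚ.m<n⇒m<1+n i<n)) (add-e₀-agrees (suc t) (c t) i i<n)
        -- Later stages alter only coordinates of index above n, where `u₀` vanishes, so the
        -- products already arranged persist.
        u₀⊥û : ∀ t → dot u₀ (û t) ≈ 0#
        u₀⊥û t = trans (sum-cong-≋ termwise) (u₀⊥u′ t)
          where
          termwise : ∀ i → u₀ i * û t i ≈ u₀ i * u′ t i
          termwise i with Fin.toℕ i ℕₚ.<? suc n
          ... | yes i≤n = *-congˡ (agrees t i i≤n)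
          ... | no i≰n = trans (trans (*-congʳ u₀i≈0) (zeroˡ _)) (sym (trans (*-congʳ u₀i≈0) (zeroˡ _)))
            where
            u₀i≈0 : u₀ i ≈ 0#
            u₀i≈0 = add-e₀-supported zero d i (ℕₚ.≮⇒≥ i≰n)
        orthogonal₊ : ∀ s t → s ≢ t → dot (û₊ s) (û₊ t) ≈ 0#
        orthogonal₊ zero zero s≢t = contradiction ≡.refl s≢t
        orthogonal₊ zero (suc t) _ = u₀⊥û t
        orthogonal₊ (suc s) zero _ = trans (dot-comm (û s) u₀) (u₀⊥û s)
        orthogonal₊ (suc s) (suc t) s≢t = orthogonal s t (s≢t ∘ cong suc)
        nonIsotropic₊ : ∀ t → ¬ dot (û₊ t) (û₊ t) ≈ 0#
        nonIsotropic₊ zero = u₀-nonIsotropic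
        nonIsotropic₊ (suc t) = nonIsotropic t

  dot-orthogonal : ∀ {N ρ} (a : Vector (Vector Carrier N) ρ) → Orthogonal a → ∀ x s →
    dot (a s) (combination x a) ≈ x s * dot (a s) (a s)
  dot-orthogonal a (orthogonal , _) x s = begin
    dot (a s) (combination x a)
      ≈⟨ dot-combination (a s) x a ⟩
    sum (λ t → x t * dot (a s) (a t))
      ≈⟨ sum-cong-≋ single ⟩
    sum (λ t → x t * dot (a t) (a t) * 1ᴹ t s)
      ≈⟨ sum-1ᴹ (λ t → x t * dot (a t) (a t)) s ⟩
    x s * dot (a s) (a s) ∎
    where
    single : ∀ t → x t * dot (a s) (a t) ≈ x t * dot (a t) (a t) * 1ᴹ t s
    single t with t Finₚ.≟ s
    ... | yes ≡.refl = sym (*-identityʳ _)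
    ... | no t≢s = trans (trans (*-congˡ (orthogonal s t (t≢s ∘ ≡.sym))) (zeroʳ (x t))) (sym (zeroʳ _))

  -- The shape of a singular value decomposition, Σ cₜ aₜ bₜᵀ, with unnormalised vectors.
  _≈Σ_·_⊗_ : ∀ {N ρ} → Matrix N N → Vector Carrier ρ → (a b : Vector (Vector Carrier N) ρ) → Set
  A ≈Σ c · a ⊗ b = ∀ i j → A i j ≈ sum λ t → c t * (a t i * b t j)

  ≈Σ-ᵀ : ∀ {N ρ} {A : Matrix N N} {c} {a b : Vector (Vector Carrier N) ρ} → A ≈Σ c · a ⊗ b → (A ᵀ) ≈Σ c · b ⊗ a
  ≈Σ-ᵀ {c = c} {a} {b} h i j = trans (h j i) (sum-cong-≋ λ t → *-congˡ (*-comm (a t j) (b t i)))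

  ≈Σ-· : ∀ {N ρ} {A : Matrix N N} {c} {a b : Vector (Vector Carrier N) ρ} → A ≈Σ c · a ⊗ b →
    ∀ x → A · x ≈ᵛ combination (λ t → c t * dot (b t) x) a
  ≈Σ-· {A = A} {c} {a} {b} h x i = begin
    sum (λ j → A i j * x j)
      ≈⟨ sum-cong-≋ (λ j → trans (*-comm (A i j) (x j)) (*-congˡ (trans (h i j)
           (sum-cong-≋ λ t → solve 3 (λ c a b → c :* (a :* b) := b :* (c :* a)) refl (c t) (a t i) (b t j))))) ⟩
    sum (λ j → x j * sum λ t → b t j * (c t * a t i))
      ≈⟨ combination-assoc x (λ j t → b t j) (λ t (_ : Fin 1) → c t * a t i) zero ⟩
    sum (λ t → dot x (b t) * (c t * a t i))
      ≈⟨ sum-cong-≋ (λ t → trans (*-congʳ (dot-comm x (b t)))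
           (solve 3 (λ d c a → d :* (c :* a) := c :* d :* a) refl (dot (b t) x) (c t) (a t i))) ⟩
    combination (λ t → c t * dot (b t) x) a i ∎

  module _ {N ρ} {a b : Vector (Vector Carrier N) ρ} (orth-a : Orthogonal a) (orth-b : Orthogonal b) where

    module _ {A : Matrix N N} {c : Vector Carrier ρ} (A≈ : A ≈Σ c · a ⊗ b) where

      private
        AᵀA-coefficient : Vector Carrier N → Vector Carrier ρ
        AᵀA-coefficient x t = c t * (c t * dot (b t) x * dot (a t) (a t))

        AᵀA· : ∀ x → A ᵀ · A · x ≈ᵛ combination (AᵀA-coefficient x) b
        AᵀA· x j = begin
          (A ᵀ · A · x) j
            ≈⟨ f-cong (·-linear (A ᵀ)) (≈Σ-· {a = a} {b} A≈ x) j ⟩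
          (A ᵀ · combination (λ t → c t * dot (b t) x) a) j
            ≈⟨ ≈Σ-· {a = b} {a} (≈Σ-ᵀ {a = a} {b} A≈) _ j ⟩
          combination (λ s → c s * dot (a s) (combination (λ t → c t * dot (b t) x) a)) b j
            ≈⟨ sum-cong-≋ (λ s → *-congʳ (*-congˡ (dot-orthogonal a orth-a (λ t → c t * dot (b t) x) s))) ⟩
          combination (AᵀA-coefficient x) b j ∎

      -- In AᵀA x the vector bₜ has coefficient cₜ² ⟨bₜ , x⟩ ⟨aₜ , aₜ⟩. Pairing with bₜ isolates it,
      -- and as neither aₜ nor bₜ is isotropic, cₜ ⟨bₜ , x⟩ = 0: the coefficient of aₜ in A x.
      kernel-orthogonal : ∀ x → A ᵀ · A · x ≈0ᵛ → A · x ≈0ᵛ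
      kernel-orthogonal x AᵀAx≈0 i = trans (≈Σ-· {a = a} {b} A≈ x i) (sum-0 λ t → trans (*-congʳ (c*dot≈0 t)) (zeroˡ (a t i)))
        where
        coefficient≈0 : ∀ t → AᵀA-coefficient x t ≈ 0#
        coefficient≈0 t = x*y≈0⇒y≈0 (proj₂ orth-b t) (begin
          dot (b t) (b t) * AᵀA-coefficient x t               ≈⟨ *-comm _ _ ⟩
          AᵀA-coefficient x t * dot (b t) (b t)               ≈⟨ dot-orthogonal b orth-b (AᵀA-coefficient x) t ⟨
          dot (b t) (combination (AᵀA-coefficient x) b)
            ≈⟨ sum-0 (λ j → trans (*-congˡ (trans (sym (AᵀA· x j)) (AᵀAx≈0 j))) (zeroʳ (b t j))) ⟩
          0#                                                  ∎)
        c*dot≈0 : ∀ t → c t * dot (b t) x ≈ 0#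
        c*dot≈0 t = [ (λ ct≈0 → trans (*-congʳ ct≈0) (zeroˡ _))
                    , (λ h → x*y≈0⇒y≈0 (proj₂ orth-a t) (trans (*-comm _ _) h)) ]′
          (x*y≈0⇒x≈0∨y≈0 (coefficient≈0 t))

      -- Each bₜ is an eigenvector of AᵀA with eigenvalue cₜ² ⟨bₜ , bₜ⟩ ⟨aₜ , aₜ⟩. Subtracting from
      -- v its projection to their span leaves a vector orthogonal to all bₜ, which AᵀA kills.
      diagonalizable-orthogonal : Diagonalizable (A ᵀ *ᴹ A)
      diagonalizable-orthogonal = eigenvectorsSpan⇒diagonalizable (A ᵀ *ᴹ A) λ X eig∈ v →
        Subspace.∈-resp X (λ i → solve 2 (λ v p → (v :+ con (ℚ.- 1ℚ) :* p) :+ p := v) refl (v i) (projection v i))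
          (Subspace.+∈ X (eig∈ {α = 0#} (remainder-eigenvector v))
            (Subspace.combination∈ X (coordinate v) b λ t → eig∈ {α = eigenvalue t} (b-eigenvector t)))
        where
        eigenvalue : Fin ρ → Carrier
        eigenvalue t = c t * (c t * dot (b t) (b t) * dot (a t) (a t))
        b-eigenvector : ∀ t → Eigenvector ((A ᵀ *ᴹ A) ·_) (eigenvalue t) (b t)
        b-eigenvector t i = begin
          ((A ᵀ *ᴹ A) · b t) i
            ≈⟨ trans (·-assoc (A ᵀ) A (b t) i) (AᵀA· (b t) i) ⟩
          sum (λ s → AᵀA-coefficient (b t) s * b s i)
            ≈⟨ sum-cong-≋ single ⟩
          sum (λ s → eigenvalue s * b s i * 1ᴹ s t)
            ≈⟨ sum-1ᴹ (λ s → eigenvalue s * b s i) t ⟩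
          eigenvalue t * b t i ∎
          where
          single : ∀ s → AᵀA-coefficient (b t) s * b s i ≈ eigenvalue s * b s i * 1ᴹ s t
          single s with s Finₚ.≟ t
          ... | yes ≡.refl = sym (*-identityʳ _)
          ... | no s≢t = trans (trans (*-congʳ (trans (*-congˡ (trans (*-congʳ (trans (*-congˡ (proj₁ orth-b s t s≢t))
            (zeroʳ (c s)))) (zeroˡ _))) (zeroʳ (c s)))) (zeroˡ (b s i))) (sym (zeroʳ _))
        inverse : ∀ t → ∃[ y ] dot (b t) (b t) * y ≈ 1#
        inverse t = invertible (dot (b t) (b t)) (proj₂ orth-b t)
        coordinate : Vector Carrier N → Vector Carrier ρ
        coordinate v t = proj₁ (inverse t) * dot (b t) v
        projection : Vector Carrier N → Vector Carrier N
        projection v = combination (coordinate v) b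
        remainder : Vector Carrier N → Vector Carrier N
        remainder v i = v i + fromℚ′ (ℚ.- 1ℚ) * projection v i
        dot-remainder : ∀ v t → dot (b t) (remainder v) ≈ 0#
        dot-remainder v t = begin
          sum (λ i → b t i * (v i + fromℚ′ (ℚ.- 1ℚ) * projection v i))
            ≈⟨ sum-cong-≋ (λ i → solve 3 (λ b v p → b :* (v :+ con (ℚ.- 1ℚ) :* p) := b :* v :+ con (ℚ.- 1ℚ) :* (b :* p)) refl
                 (b t i) (v i) (projection v i)) ⟩
          sum (λ i → b t i * v i + fromℚ′ (ℚ.- 1ℚ) * (b t i * projection v i))
            ≈⟨ ∑-distrib-+ (λ i → b t i * v i) (λ i → fromℚ′ (ℚ.- 1ℚ) * (b t i * projection v i)) ⟩
          dot (b t) v + sum (λ i → fromℚ′ (ℚ.- 1ℚ) * (b t i * projection v i))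
            ≈⟨ +-congˡ (*-distribˡ-sum (fromℚ′ (ℚ.- 1ℚ)) λ i → b t i * projection v i) ⟨
          dot (b t) v + fromℚ′ (ℚ.- 1ℚ) * dot (b t) (projection v)
            ≈⟨ +-congˡ (*-congˡ (dot-orthogonal b orth-b (coordinate v) t)) ⟩
          dot (b t) v + fromℚ′ (ℚ.- 1ℚ) * (proj₁ (inverse t) * dot (b t) v * dot (b t) (b t))
            ≈⟨ solve 3 (λ d y n → d :+ con (ℚ.- 1ℚ) :* (y :* d :* n) := d :- (n :* y) :* d) refl
                 (dot (b t) v) (proj₁ (inverse t)) (dot (b t) (b t)) ⟩
          dot (b t) v - dot (b t) (b t) * proj₁ (inverse t) * dot (b t) v
            ≈⟨ x≈y⇒x-y≈0 (sym (trans (*-congʳ (proj₂ (inverse t))) (*-identityˡ _))) ⟩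
          0# ∎
        remainder-eigenvector : ∀ v → Eigenvector ((A ᵀ *ᴹ A) ·_) 0# (remainder v)
        remainder-eigenvector v i = begin
          ((A ᵀ *ᴹ A) · remainder v) i
            ≈⟨ trans (·-assoc (A ᵀ) A (remainder v) i) (AᵀA· (remainder v) i) ⟩
          sum (λ s → AᵀA-coefficient (remainder v) s * b s i)
            ≈⟨ sum-0 (λ s → trans (*-congʳ (trans (*-congˡ (trans (*-congʳ (trans (*-congˡ (dot-remainder v s))
                 (zeroʳ (c s)))) (zeroˡ _))) (zeroʳ (c s)))) (zeroˡ (b s i))) ⟩
          0#
            ≈⟨ zeroˡ (remainder v i) ⟨
          0# * remainder v i ∎

    -- Orthogonality of the bₜ leaves A Bᵀ = Σ cₜ cₜ′ ⟨bₜ , bₜ⟩ aₜ aₜᵀ.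
    symmetric-*ᴹᵀ : ∀ {A B : Matrix N N} {c c′ : Vector Carrier ρ} → A ≈Σ c · a ⊗ b → B ≈Σ c′ · a ⊗ b →
      Symmetric (A *ᴹ B ᵀ)
    symmetric-*ᴹᵀ {A} {B} {c} {c′} A≈ B≈ i j = trans (entry j i) (trans
      (sum-cong-≋ λ t → solve 5 (λ c c′ x y n → c :* (c′ :* x :* n) :* y := c :* (c′ :* y :* n) :* x) refl
        (c t) (c′ t) (a t i) (a t j) (dot (b t) (b t)))
      (sym (entry i j)))
      where
      entry : ∀ i j → (A *ᴹ B ᵀ) i j ≈ sum λ t → c t * (c′ t * a t j * dot (b t) (b t)) * a t i
      entry i j = begin
        (A · B j) i
          ≈⟨ f-cong (·-linear A) (λ p → trans (B≈ j p) (sum-cong-≋ λ t → sym (*-assoc (c′ t) (a t j) (b t p)))) i ⟩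
        (A · combination (λ t → c′ t * a t j) b) i
          ≈⟨ ≈Σ-· {a = a} {b} A≈ _ i ⟩
        combination (λ t → c t * dot (b t) (combination (λ t → c′ t * a t j) b)) a i
          ≈⟨ sum-cong-≋ (λ t → *-congʳ (*-congˡ (dot-orthogonal b orth-b (λ t → c′ t * a t j) t))) ⟩
        sum (λ t → c t * (c′ t * a t j * dot (b t) (b t)) * a t i) ∎

  orthogonal⇒sliceConditions : ∀ {N ρ} {a b : Vector (Vector Carrier N) ρ} → Orthogonal a → Orthogonal b →
    (A : Vector (Matrix N N) N) (c : Fin N → Vector Carrier ρ) → (∀ k → A k ≈Σ c k · a ⊗ b) → SliceConditions A
  orthogonal⇒sliceConditions {a = a} {b} orth-a orth-b A c A≈ =
      (λ k → diagonalizable-orthogonal orth-a orth-b (A≈ k)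
           , kernel-ᵀ*ᴹ⇒sameRank (A k) (kernel-orthogonal orth-a orth-b (A≈ k)))
    , (λ k l → symmetric-*ᴹᵀ orth-a orth-b (A≈ k) (A≈ l)
             , symmetric-*ᴹᵀ orth-b orth-a {A k ᵀ} {A l ᵀ} (≈Σ-ᵀ {a = a} {b} (A≈ k)) (≈Σ-ᵀ {a = a} {b} (A≈ l)))

  -- Tensor rank and the two implications

  discardZeros : ∀ {n} m (T : Tensor n) (u v w : Fin m → Vector Carrier n) →
    (∀ i j k → T i j k ≈ sum λ t → u t i * v t j * w t k) → ∃[ m′ ] m′ ℕ.≤ m × SumOfRankOnes T m′
  discardZeros zero T u v w h = 0 , ℕ.z≤n , (λ ()) , (λ ()) , h
  discardZeros (suc m) T u v w h
    with discardZeros m (λ i j k → sum λ t → u (suc t) i * v (suc t) j * w (suc t) k) (u ∘ suc) (v ∘ suc) (w ∘ suc)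
      (λ _ _ _ → refl)
  -- A rank-one tensor has nonzero factors, but cutting vectors down to their first n coordinates
  -- may produce 0; such summands are dropped.
  ... | m′ , m′≤m , X , rankOne , h′ with em {u zero ≈0ᵛ} | em {v zero ≈0ᵛ} | em {w zero ≈0ᵛ}
  ... | yes u≈0 | _ | _ = m′ , ℕₚ.m≤n⇒m≤1+n m′≤m , X , rankOne , λ i j k → trans (h i j k) (trans
    (+-cong (trans (*-congʳ (trans (*-congʳ (u≈0 i)) (zeroˡ _))) (zeroˡ _)) (h′ i j k)) (+-identityˡ _))
  ... | no _ | yes v≈0 | _ = m′ , ℕₚ.m≤n⇒m≤1+n m′≤m , X , rankOne , λ i j k → trans (h i j k) (trans
    (+-cong (trans (*-congʳ (trans (*-congˡ (v≈0 j)) (zeroʳ _))) (zeroˡ _)) (h′ i j k)) (+-identityˡ _))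
  ... | no _ | no _ | yes w≈0 = m′ , ℕₚ.m≤n⇒m≤1+n m′≤m , X , rankOne , λ i j k → trans (h i j k) (trans
    (+-cong (trans (*-congˡ (w≈0 k)) (zeroʳ _)) (h′ i j k)) (+-identityˡ _))
  ... | no u≉0 | no v≉0 | no w≉0 = suc m′ , ℕ.s≤s m′≤m , ⟨ u zero ⊗ v zero ⊗ w zero ⟩ Vec.∷ X
    , (λ { zero → u zero , v zero , w zero , u≉0 , v≉0 , w≉0 , λ _ _ _ → refl ; (suc t) → rankOne t })
    , λ i j k → trans (h i j k) (+-congˡ (h′ i j k))

  -- `TensorRank≤` asks for the exact rank, so a decomposition must be followed by a minimal length.
  least : ∀ (P : ℕ → Set) m → P m → ∃[ k ] k ℕ.≤ m × P k × (∀ l → P l → k ℕ.≤ l)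
  least P m Pm with em {P 0}
  least P m Pm | yes P0 = 0 , ℕ.z≤n , P0 , λ _ _ → ℕ.z≤n
  least P zero P0 | no ¬P0 = contradiction P0 ¬P0
  least P (suc m) Pm | no ¬P0 with least (P ∘ suc) m Pm
  ... | k , k≤m , Pk , minimal = suc k , ℕ.s≤s k≤m , Pk , λ where
    zero P0 → contradiction P0 ¬P0
    (suc l) Pl → ℕ.s≤s (minimal l Pl)

  pad : ∀ {n N} → Vector Carrier n → Vector Carrier N
  pad {n} u i with Fin.toℕ i ℕₚ.<? n
  ... | yes i<n = u (Fin.fromℕ< i<n)
  ... | no _ = 0#

  pad-inject≤ : ∀ {n N} (u : Vector Carrier n) i (n≤N : n ℕ.≤ N) → pad u (Fin.inject≤ i n≤N) ≡ u i
  pad-inject≤ {n} u i n≤N with Fin.toℕ (Fin.inject≤ i n≤N) ℕₚ.<? n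
  ... | yes i<n = cong u (Finₚ.toℕ-injective (≡.trans (Finₚ.toℕ-fromℕ< i<n) (Finₚ.toℕ-inject≤ i n≤N)))
  ... | no i≮n = contradiction (≡.subst (ℕ._< n) (≡.sym (Finₚ.toℕ-inject≤ i n≤N)) (Finₚ.toℕ<n i)) i≮n

  pad-supported : ∀ {n N} (u : Vector Carrier n) (i : Fin N) → n ℕ.≤ Fin.toℕ i → pad u i ≈ 0#
  pad-supported {n} u i n≤i with Fin.toℕ i ℕₚ.<? n
  ... | yes i<n = contradiction n≤i (ℕₚ.<⇒≱ i<n)
  ... | no _ = refl

  OrthogonalExtension : ∀ {n} → Tensor n → ℤ → Set
  OrthogonalExtension {n} T r = ∃[ N ] (ℤ.+ N ≡ r ℤ.+ ℤ.+ n) × (Σ (Tensor N) λ S →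
    (SliceConditions (xSlice S) × SliceConditions (ySlice S) × SliceConditions (zSlice S)) ×
    (T IsSubtensorOf S) ×
    SpanRank≤ (zSlice S) r)

  module _ (√ : ∀ x → ∃[ s ] s * s ≈ x) {n} (T : Tensor n) where

    extension⇒tensorRank≤ : ∀ r → OrthogonalExtension T r → TensorRank≤ T r
    extension⇒tensorRank≤ r (N , _ , S , (_ , _ , conditions) , (n≤N , T≈S) , spanRank≤) =
      let m , y , p , d , S≈ , m≤r = sliceDecomposition √ (zSlice S) conditions r spanRank≤
          m′ , m′≤m , sum-m′ = discardZeros m T (λ t → y t ∘ inject) (λ t → p t ∘ inject) (λ t → d t ∘ inject)
            (λ i j k → trans (T≈S i j k) (S≈ (inject k) (inject i) (inject j)))
          ρ , ρ≤m′ , sum-ρ , minimal = least (SumOfRankOnes T) m′ sum-m′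
      in ρ , (sum-ρ , minimal) , ℤₚ.≤-trans (ℤ.+≤+ (ℕₚ.≤-trans ρ≤m′ m′≤m)) m≤r
      where
      inject : Fin n → Fin N
      inject i = Fin.inject≤ i n≤N

    tensorRank≤⇒extension : ∀ r → TensorRank≤ T r → OrthogonalExtension T r
    -- A bound above ρ ≥ 0 is nonnegative, so from here `r` is a natural number.
    tensorRank≤⇒extension _ (ρ , ((X , rankOne , T≈) , _) , ℤ.+≤+ {n = r} ρ≤r) =
      N , ≡.refl , S
      , ( orthogonal⇒sliceConditions orth-v orth-w (xSlice S) (λ i t → û t i)
            (λ i j k → sum-cong-≋ λ t → *-assoc (û t i) (v̂ t j) (ŵ t k))
        , orthogonal⇒sliceConditions orth-u orth-w (ySlice S) (λ j t → v̂ t j)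
            (λ j i k → sum-cong-≋ λ t → solve 3 (λ u v w → u :* v :* w := v :* (u :* w)) refl (û t i) (v̂ t j) (ŵ t k))
        , orthogonal⇒sliceConditions orth-u orth-v (zSlice S) (λ k t → ŵ t k)
            (λ k i j → sum-cong-≋ λ t → *-comm (û t i * v̂ t j) (ŵ t k)))
      , (n≤N , λ i j k → trans (T≈ i j k) (sum-cong-≋ λ t → trans (rankOne≈ t i j k)
          (*-cong (*-cong (agrees û-extends t i) (agrees v̂-extends t j)) (agrees ŵ-extends t k))))
      -- Every column of `M` is a combination of the ρ vectors `û t`, hence so is every basis vector
      -- of its column space.
      , λ M (x , M≈) → let σ , rank@(b , ind , column) = rank-exists M in
          σ , rank , ℤ.+≤+ (ℕₚ.≤-trans (independent⇒≤ ind λ t →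
            span-minimal (span û) (λ j → (λ t → sum λ k → x k * (v̂ t j * ŵ t k)) , λ i → begin
              M i j
                ≈⟨ M≈ (i , j) ⟩
              sum (λ k → x k * S i j k)
                ≈⟨ sum-cong-≋ (λ k → *-congˡ (sum-cong-≋ λ t →
                     solve 3 (λ u v w → u :* v :* w := v :* w :* u) refl (û t i) (v̂ t j) (ŵ t k))) ⟩
              combination x (λ k → combination (λ t → v̂ t j * ŵ t k) û) i
                ≈⟨ combination-assoc x (λ k t → v̂ t j * ŵ t k) û i ⟩
              combination (λ t → sum λ k → x k * (v̂ t j * ŵ t k)) û i ∎)
            (Equivalence.to (column (b t)) (∈span b t))) ρ≤r)
      where
      N : ℕ
      -- The n coordinates of `T` and one fresh coordinate for each of at most r summands; the three
      -- families reuse the same fresh coordinates.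
      N = r ℕ.+ n
      n≤N : n ℕ.≤ N
      n≤N = ℕₚ.m≤n+m n r
      u v w : Fin ρ → Vector Carrier n
      u t = proj₁ (rankOne t)
      v t = proj₁ (proj₂ (rankOne t))
      w t = proj₁ (proj₂ (proj₂ (rankOne t)))
      rankOne≈ : ∀ t → X t ≈ᵀ ⟨ u t ⊗ v t ⊗ w t ⟩
      rankOne≈ t = proj₂ (proj₂ (proj₂ (proj₂ (proj₂ (proj₂ (rankOne t))))))
      Extends : (Fin ρ → Vector Carrier n) → Set
      Extends u = Σ (Vector (Vector Carrier N) ρ) λ û → (∀ t i → Fin.toℕ i ℕ.< n → û t i ≈ pad (u t) i) × Orthogonal û
      extend : ∀ u → Extends u
      extend u = extendOrthogonal √ ρ n
        (ℕₚ.≤-trans (ℕₚ.≤-reflexive (ℕₚ.+-comm n ρ)) (ℕₚ.+-monoˡ-≤ n ρ≤r)) (pad ∘ u) (λ t → pad-supported (u t))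
      û-extends : Extends u
      û-extends = extend u
      v̂-extends : Extends v
      v̂-extends = extend v
      ŵ-extends : Extends w
      ŵ-extends = extend w
      û v̂ ŵ : Vector (Vector Carrier N) ρ
      û = proj₁ û-extends
      v̂ = proj₁ v̂-extends
      ŵ = proj₁ ŵ-extends
      orth-u : Orthogonal û
      orth-u = proj₂ (proj₂ û-extends)
      orth-v : Orthogonal v̂
      orth-v = proj₂ (proj₂ v̂-extends)
      orth-w : Orthogonal ŵ
      orth-w = proj₂ (proj₂ ŵ-extends)
      agrees : ∀ {u} (ext : Extends u) t i → u t i ≈ proj₁ ext t (Fin.inject≤ i n≤N)
      agrees {u} (û , agrees , _) t i = sym (trans
        (agrees t (Fin.inject≤ i n≤N) (≡.subst (ℕ._< n) (≡.sym (Finₚ.toℕ-inject≤ i n≤N)) (Finₚ.toℕ<n i)))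
        (reflexive (pad-inject≤ (u t) i n≤N)))
      S : Tensor N
      S i j k = sum λ t → û t i * v̂ t j * ŵ t k

open import Defs
open import Data.Integer.Base using (_+_)
open import Data.Product.Base using (Σ-syntax)

theorem28 : ExcludedMiddle 0ℓ →
    ∀ (n : ℕ) (T : Tensor n) (r : ℤ) →
    TensorRank≤ T r ⇔
    (∃[ N ] (+ N ≡ r + + n) × (Σ[ S ∈ Tensor N ]
    (SliceConditions (xSlice S) × SliceConditions (ySlice S) × SliceConditions (zSlice S)) ×
    (T IsSubtensorOf S) ×
    SpanRank≤ (zSlice S) r))
theorem28 em n T r = mk⇔ (tensorRank≤⇒extension ℂ-sqrt T r) (extension⇒tensorRank≤ ℂ-sqrt T r)
  where
  open Complex em
  open LinearAlgebraProperties ℂ-field em
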